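{- Let $s\ge 3$ be an integer, and let $z(q)$ be the mirror map produced by the differential equation $$\bigl(\delta_z^{s-1}-sz(s\delta_z+1)(s\delta_z+2)\cdots(s\delta_z+s-1)\bigr)y=0,\qquad \delta_z=z\frac{\mathrm{d}}{\mathrm{d}z}.$$ Regard $z=z(e^t)$ as a function of $t=\log q$, and let $z',z'',\dots,z^{(k)},\dots$ denote its derivatives with respect to $t$. Then $z$ satisfies an algebraic differential equation (with respect to $\mathrm{d}/\mathrm{d}t$) of order $2s-3$ with coefficients from $\mathbb{C}$. Moreover, $z^{(2s-3)}$ is rational over the field $\mathbb{C}(z,z',\dots,z^{(2s-4)})$, i.e. $z^{(2s-3)}\in\mathbb{C}(z,z',\dots,z^{(2s-4)})$.
   Context: For an integer $s\ge 3$, the mirror map produced by the differential equation $$\bigl(\delta_z^{s-1}-sz(s\delta_z+1)(s\delta_z+2)\cdots(s\delta_z+s-1)\bigr)y=0,\qquad \delta_z=z\frac{\mathrm{d}}{\mathrm{d}z},$$ is defined as follows. Near $z=0$ this differential equation has the solutions $$f_0(z)=\sum_{l=0}^\infty\frac{(sl)!}{(l!)^s}z^l,\qquad f_1(z)=f_0(z)\log z+g_1(z),\qquad g_1(z)=s\sum_{l=1}^\infty\Bigl(\frac{(sl)!}{(l!)^s}\sum_{k=l+1}^{sl}\frac1k\Bigr)z^l.$$ Put $q(z)=\exp(f_1(z)/f_0(z))=z\exp(g_1(z)/f_0(z))$, which is analytic near $z=0$ with $q(z)=z+O(z^2)$. The mirror map $q\mapsto z(q)$ is the inverse function, analytic near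 $q=0$ with $z(q)=q+O(q^2)$. With $t=\log q$ one has $\mathrm{d}/\mathrm{d}t=q\,\mathrm{d}/\mathrm{d}q$. -}

module Defs where

open import Level using (0ℓ)
open import Algebra.Bundles using (CommutativeRing)
import Algebra.Definitions.RawMonoid as RawMonoidDefs
import Algebra.Properties.Monoid.Sum as MonoidSum
import Algebra.Properties.Ring as RingProperties
import Algebra.Solver.Ring.NaturalCoefficients.Default as SemiringSolver
open import Data.Fin.Base using (toℕ)
import Data.Fin.Properties as Finₚ
open import Data.Integer.Base using (+_)
open import Data.List.Base using (List; []; _∷_; drop)
open import Data.List.Relation.Unary.All using (All)
open import Data.Nat.Base as ℕ using (ℕ; zero; suc; _∸_; _!; z≤n; s≤s)
import Data.Nat.Properties as ℕₚ
open import Data.Product.Base using (_,_; _×_; ∃-syntax)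
open import Data.Rational.Base as ℚ using (ℚ; 0ℚ; 1ℚ; ½; _/_)
import Data.Rational.Properties as ℚₚ
import Data.Rational.Solver as ℚ-Solver
open import Data.Sum.Base using (inj₁; inj₂)
open import Function.Base using (_∘_)
open import Relation.Binary.PropositionalEquality as ≡
  using (_≡_; cong; subst)
open import Relation.Nullary.Negation.Core using (¬_)
import Relation.Binary.Reasoning.Setoid as ≈-Reasoning

-- ∣xₘ - yₙ∣ → 0 as m, n → ∞.  In particular x ∼ x says that x is Cauchy,
-- and for Cauchy sequences x ∼ y says that they have the same limit.

infix 4 _∼_

record _∼_ (x y : ℕ → ℚ) : Set where
  constructor within
  field
    close : ∀ ε → 0ℚ ℚ.< ε →
            ∃[ N ] ∀ m n → N ℕ.≤ m → N ℕ.≤ n → ℚ.∣ x m ℚ.- y n ∣ ℚ.< ε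

open _∼_

record ℝ : Set where
  constructor real
  field
    seq    : ℕ → ℚ
    cauchy : seq ∼ seq

open ℝ

private
  module Identities where
    open ℚ-Solver.+-*-Solver using (solve; _:+_; _:*_; _:-_; :-_; _:=_)

    flip : ∀ p q → ℚ.- (p ℚ.- q) ≡ q ℚ.- p
    flip = solve 2 (λ p q → :- (p :- q) := q :- p) ≡.refl

    via : ∀ p q r → p ℚ.- r ≡ (p ℚ.- q) ℚ.+ (q ℚ.- r)
    via = solve 3 (λ p q r → p :- r := (p :- q) :+ (q :- r)) ≡.refl

    split-+ : ∀ a b c d → (a ℚ.+ b) ℚ.- (c ℚ.+ d) ≡ (a ℚ.- c) ℚ.+ (b ℚ.- d)
    split-+ = solve 4 (λ a b c d → (a :+ b) :- (c :+ d) := (a :- c) :+ (b :- d)) ≡.refl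

    push : ∀ p q → ℚ.- (p ℚ.- q) ≡ (ℚ.- p) ℚ.- (ℚ.- q)
    push = solve 2 (λ p q → :- (p :- q) := (:- p) :- (:- q)) ≡.refl

    back : ∀ p q → (p ℚ.- q) ℚ.+ q ≡ p
    back = solve 2 (λ p q → (p :- q) :+ q := p) ≡.refl

    split-* : ∀ a b c d → a ℚ.* b ℚ.- c ℚ.* d ≡ a ℚ.* (b ℚ.- d) ℚ.+ d ℚ.* (a ℚ.- c)
    split-* = solve 4 (λ a b c d →
      a :* b :- c :* d := a :* (b :- d) :+ d :* (a :- c)) ≡.refl

  open Identities

  half+half : ∀ p → ½ ℚ.* p ℚ.+ ½ ℚ.* p ≡ p
  half+half p = ≡.trans (≡.sym (ℚₚ.*-distribʳ-+ p ½ ½)) (ℚₚ.*-identityˡ p)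

  half-pos : ∀ {p} → 0ℚ ℚ.< p → 0ℚ ℚ.< ½ ℚ.* p
  half-pos = ℚₚ.*-monoʳ-<-pos ½

  ≗⇒∼ : ∀ {x y} → y ∼ y → (∀ n → x n ≡ y n) → x ∼ y
  ≗⇒∼ {y = y} c eq .close ε 0<ε with c .close ε 0<ε
  ... | N , h = N , λ m n N≤m N≤n →
    subst (λ p → ℚ.∣ p ℚ.- y n ∣ ℚ.< ε) (≡.sym (eq m)) (h m n N≤m N≤n)

  ∼-sym : ∀ {x y} → x ∼ y → y ∼ x
  ∼-sym {x} {y} x∼y .close ε 0<ε with x∼y .close ε 0<ε
  ... | N , h = N , λ m n N≤m N≤n →
    subst (ℚ._< ε) (≡.trans (≡.sym (ℚₚ.∣-p∣≡∣p∣ _)) (cong ℚ.∣_∣ (flip (x n) (y m))))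
          (h n m N≤n N≤m)

  +-bound : ∀ {p q r ε} → r ≡ p ℚ.+ q → ℚ.∣ p ∣ ℚ.< ½ ℚ.* ε → ℚ.∣ q ∣ ℚ.< ½ ℚ.* ε →
            ℚ.∣ r ∣ ℚ.< ε
  +-bound {p} {q} {ε = ε} ≡.refl hp hq = subst (ℚ.∣ p ℚ.+ q ∣ ℚ.<_) (half+half ε)
    (ℚₚ.≤-<-trans (ℚₚ.∣p+q∣≤∣p∣+∣q∣ p q) (ℚₚ.+-mono-< hp hq))

  ∼-trans : ∀ {x y z} → x ∼ y → y ∼ z → x ∼ z
  ∼-trans {x} {y} {z} x∼y y∼z .close ε 0<ε
    with x∼y .close (½ ℚ.* ε) (half-pos 0<ε) | y∼z .close (½ ℚ.* ε) (half-pos 0<ε)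
  ... | M , f | N , g = M ℕ.⊔ N , λ m n m≥ n≥ →
    let k = M ℕ.⊔ N
    in +-bound (via (x m) (y k) (z n))
         (f m k (ℕₚ.m⊔n≤o⇒m≤o M N m≥) (ℕₚ.m≤m⊔n M N))
         (g k n (ℕₚ.m≤n⊔m M N) (ℕₚ.m⊔n≤o⇒n≤o M N n≥))

  ∼-+ : ∀ {x x′ y y′} → x ∼ x′ → y ∼ y′ →
        (λ n → x n ℚ.+ y n) ∼ (λ n → x′ n ℚ.+ y′ n)
  ∼-+ {x} {x′} {y} {y′} p q .close ε 0<ε
    with p .close (½ ℚ.* ε) (half-pos 0<ε) | q .close (½ ℚ.* ε) (half-pos 0<ε)
  ... | M , f | N , g = M ℕ.⊔ N , λ m n m≥ n≥ →
    +-bound (split-+ (x m) (y m) (x′ n) (y′ n))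
      (f m n (ℕₚ.m⊔n≤o⇒m≤o M N m≥) (ℕₚ.m⊔n≤o⇒m≤o M N n≥))
      (g m n (ℕₚ.m⊔n≤o⇒n≤o M N m≥) (ℕₚ.m⊔n≤o⇒n≤o M N n≥))

  ∼-neg : ∀ {x y} → x ∼ y → (λ n → ℚ.- x n) ∼ (λ n → ℚ.- y n)
  ∼-neg {x} {y} p .close ε 0<ε with p .close ε 0<ε
  ... | N , h = N , λ m n m≥ n≥ →
    subst (ℚ._< ε) (≡.trans (≡.sym (ℚₚ.∣-p∣≡∣p∣ _)) (cong ℚ.∣_∣ (push (x m) (y n))))
          (h m n m≥ n≥)

  Bound : (ℕ → ℚ) → Set
  Bound x = ∃[ B ] ∃[ N ] 0ℚ ℚ.< B × (∀ n → N ℕ.≤ n → ℚ.∣ x n ∣ ℚ.≤ B)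

  0<1 : 0ℚ ℚ.< 1ℚ
  0<1 = ℚₚ.positive⁻¹ 1ℚ

  bound : ∀ {x y} → x ∼ y → Bound x
  bound {x} {y} p with p .close 1ℚ 0<1
  ... | N , h = 1ℚ ℚ.+ ℚ.∣ y N ∣ , N
    , ℚₚ.+-mono-<-≤ 0<1 (ℚₚ.0≤∣p∣ (y N))
    , λ n n≥ → subst (λ p → ℚ.∣ p ∣ ℚ.≤ 1ℚ ℚ.+ ℚ.∣ y N ∣) (back (x n) (y N))
        (ℚₚ.≤-trans (ℚₚ.∣p+q∣≤∣p∣+∣q∣ (x n ℚ.- y N) (y N))
          (ℚₚ.+-monoˡ-≤ ℚ.∣ y N ∣ (ℚₚ.<⇒≤ (h n N n≥ ℕₚ.≤-refl))))

  *-bound : ∀ B ε → 0ℚ ℚ.< B → 0ℚ ℚ.< ε →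
            ∃[ δ ] 0ℚ ℚ.< δ × (∀ p q → ℚ.∣ p ∣ ℚ.≤ B → ℚ.∣ q ∣ ℚ.< δ → ℚ.∣ p ℚ.* q ∣ ℚ.< ε)
  *-bound B ε 0<B 0<ε = ℚ.1/ B ℚ.* ε
    , ℚₚ.positive⁻¹ _ {{ℚₚ.pos*pos⇒pos (ℚ.1/ B) ε}}
    , λ p q hp hq → begin-strict
      ℚ.∣ p ℚ.* q ∣            ≡⟨ ℚₚ.∣p*q∣≡∣p∣*∣q∣ p q ⟩
      ℚ.∣ p ∣ ℚ.* ℚ.∣ q ∣      ≤⟨ ℚₚ.*-monoʳ-≤-nonNeg ℚ.∣ q ∣ {{ℚₚ.∣-∣-nonNeg q}} hp ⟩
      B ℚ.* ℚ.∣ q ∣            <⟨ ℚₚ.*-monoʳ-<-pos B hq ⟩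
      B ℚ.* (ℚ.1/ B ℚ.* ε)     ≡⟨ ℚₚ.*-assoc B (ℚ.1/ B) ε ⟨
      (B ℚ.* ℚ.1/ B) ℚ.* ε     ≡⟨ cong (ℚ._* ε) (ℚₚ.*-inverseʳ B) ⟩
      1ℚ ℚ.* ε                 ≡⟨ ℚₚ.*-identityˡ ε ⟩
      ε                        ∎
    where
    open ℚₚ.≤-Reasoning
    instance
      B>0 = ℚ.positive 0<B
      B≢0 = ℚ.>-nonZero 0<B
      1/B>0 = ℚₚ.1/pos⇒pos B
      ε>0 = ℚ.positive 0<ε

  ∼-* : ∀ {x x′ y y′} → x ∼ x′ → y ∼ y′ →
        (λ n → x n ℚ.* y n) ∼ (λ n → x′ n ℚ.* y′ n)
  ∼-* {x} {x′} {y} {y′} p q .close ε 0<ε =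
    let B , K , 0<B , hB = bound p
        C , L , 0<C , hC = bound (∼-sym q)
        β , 0<β , hβ = *-bound B (½ ℚ.* ε) 0<B (half-pos 0<ε)
        γ , 0<γ , hγ = *-bound C (½ ℚ.* ε) 0<C (half-pos 0<ε)
        M , f = q .close β 0<β
        N , g = p .close γ 0<γ
    in (K ℕ.⊔ L) ℕ.⊔ (M ℕ.⊔ N) , λ m n m≥ n≥ →
    let m≥KL = ℕₚ.m⊔n≤o⇒m≤o (K ℕ.⊔ L) (M ℕ.⊔ N) m≥
        m≥MN = ℕₚ.m⊔n≤o⇒n≤o (K ℕ.⊔ L) (M ℕ.⊔ N) m≥
        n≥KL = ℕₚ.m⊔n≤o⇒m≤o (K ℕ.⊔ L) (M ℕ.⊔ N) n≥
        n≥MN = ℕₚ.m⊔n≤o⇒n≤o (K ℕ.⊔ L) (M ℕ.⊔ N) n≥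
    in +-bound (split-* (x m) (y m) (x′ n) (y′ n))
         (hβ (x m) (y m ℚ.- y′ n) (hB m (ℕₚ.m⊔n≤o⇒m≤o K L m≥KL))
           (f m n (ℕₚ.m⊔n≤o⇒m≤o M N m≥MN) (ℕₚ.m⊔n≤o⇒m≤o M N n≥MN)))
         (hγ (y′ n) (x m ℚ.- x′ n) (hC n (ℕₚ.m⊔n≤o⇒n≤o K L n≥KL))
           (g m n (ℕₚ.m⊔n≤o⇒n≤o M N m≥MN) (ℕₚ.m⊔n≤o⇒n≤o M N n≥MN)))

infix  4 _≈ᴿ_
infixl 6 _+ᴿ_
infixl 7 _*ᴿ_

record _≈ᴿ_ (x y : ℝ) : Set where
  constructor same-limit
  field
    limit : seq x ∼ seq y

open _≈ᴿ_

fromℚ : ℚ → ℝ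
fromℚ p = real (λ _ → p) (within λ ε 0<ε → 0 , λ _ _ _ _ →
  subst (λ q → ℚ.∣ q ∣ ℚ.< ε) (≡.sym (ℚₚ.+-inverseʳ p)) 0<ε)

_+ᴿ_ _*ᴿ_ : ℝ → ℝ → ℝ
x +ᴿ y = real (λ n → seq x n ℚ.+ seq y n) (∼-+ (cauchy x) (cauchy y))
x *ᴿ y = real (λ n → seq x n ℚ.* seq y n) (∼-* (cauchy x) (cauchy y))

-ᴿ_ : ℝ → ℝ
-ᴿ x = real (λ n → ℚ.- seq x n) (∼-neg (cauchy x))

private
  pointwise : ∀ x y → (∀ n → seq x n ≡ seq y n) → x ≈ᴿ y
  pointwise x y = same-limit ∘ ≗⇒∼ (cauchy y)

ℝ-commutativeRing : CommutativeRing 0ℓ 0ℓ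
ℝ-commutativeRing = record
  { Carrier = ℝ
  ; _≈_     = _≈ᴿ_
  ; _+_     = _+ᴿ_
  ; _*_     = _*ᴿ_
  ; -_      = -ᴿ_
  ; 0#      = fromℚ 0ℚ
  ; 1#      = fromℚ 1ℚ
  ; isCommutativeRing = record
    { isRing = record
      { +-isAbelianGroup = record
        { isGroup = record
          { isMonoid = record
            { isSemigroup = record
              { isMagma = record
                { isEquivalence = record
                  { refl  = λ {x} → same-limit (cauchy x)
                  ; sym   = λ p → same-limit (∼-sym (limit p))
                  ; trans = λ p q → same-limit (∼-trans (limit p) (limit q))
                  }
                ; ∙-cong = λ p q → same-limit (∼-+ (limit p) (limit q))
                }
              ; assoc = λ x y z → pointwise ((x +ᴿ y) +ᴿ z) (x +ᴿ (y +ᴿ z))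
                  λ n → ℚₚ.+-assoc (seq x n) (seq y n) (seq z n)
              }
            ; identity =
                (λ x → pointwise (fromℚ 0ℚ +ᴿ x) x λ n → ℚₚ.+-identityˡ (seq x n))
              , (λ x → pointwise (x +ᴿ fromℚ 0ℚ) x λ n → ℚₚ.+-identityʳ (seq x n))
            }
          ; inverse =
              (λ x → pointwise ((-ᴿ x) +ᴿ x) (fromℚ 0ℚ) λ n → ℚₚ.+-inverseˡ (seq x n))
            , (λ x → pointwise (x +ᴿ (-ᴿ x)) (fromℚ 0ℚ) λ n → ℚₚ.+-inverseʳ (seq x n))
          ; ⁻¹-cong = λ p → same-limit (∼-neg (limit p))
          }
        ; comm = λ x y → pointwise (x +ᴿ y) (y +ᴿ x)
            λ n → ℚₚ.+-comm (seq x n) (seq y n)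
        }
      ; *-cong = λ p q → same-limit (∼-* (limit p) (limit q))
      ; *-assoc = λ x y z → pointwise ((x *ᴿ y) *ᴿ z) (x *ᴿ (y *ᴿ z))
          λ n → ℚₚ.*-assoc (seq x n) (seq y n) (seq z n)
      ; *-identity =
          (λ x → pointwise (fromℚ 1ℚ *ᴿ x) x λ n → ℚₚ.*-identityˡ (seq x n))
        , (λ x → pointwise (x *ᴿ fromℚ 1ℚ) x λ n → ℚₚ.*-identityʳ (seq x n))
      ; distrib =
          (λ x y z → pointwise (x *ᴿ (y +ᴿ z)) (x *ᴿ y +ᴿ x *ᴿ z)
            λ n → ℚₚ.*-distribˡ-+ (seq x n) (seq y n) (seq z n))
        , (λ x y z → pointwise ((y +ᴿ z) *ᴿ x) (y *ᴿ x +ᴿ z *ᴿ x)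
            λ n → ℚₚ.*-distribʳ-+ (seq x n) (seq y n) (seq z n))
      }
    ; *-comm = λ x y → pointwise (x *ᴿ y) (y *ᴿ x)
        λ n → ℚₚ.*-comm (seq x n) (seq y n)
    }
  }

-- R[i] with i² = -1.

module Gaussian {c ℓ} (R : CommutativeRing c ℓ) where

  private
    module R = CommutativeRing R
    module S = SemiringSolver (CommutativeRing.commutativeSemiring R)
    open S using (_:+_; _:*_; _:=_)
  open R hiding (refl; sym; trans; distribˡ)

  infix 4 _+i_

  record Carrierᵢ : Set c where
    constructor _+i_
    field
      re im : Carrier

  open Carrierᵢ public

  commutativeRing : CommutativeRing c ℓ
  commutativeRing = record
    { Carrier = Carrierᵢ
    ; _≈_     = λ x y → re x ≈ re y × im x ≈ im y
    ; _+_     = λ x y → re x + re y +i im x + im y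
    ; _*_     = λ x y → re x * re y - im x * im y +i re x * im y + im x * re y
    ; -_      = λ x → - re x +i - im x
    ; 0#      = 0# +i 0#
    ; 1#      = 1# +i 0#
    ; isCommutativeRing = record
      { isRing = record
        { +-isAbelianGroup = record
          { isGroup = record
            { isMonoid = record
              { isSemigroup = record
                { isMagma = record
                  { isEquivalence = record
                    { refl  = R.refl , R.refl
                    ; sym   = λ (p , q) → R.sym p , R.sym q
                    ; trans = λ (p , q) (p′ , q′) → R.trans p p′ , R.trans q q′
                    }
                  ; ∙-cong = λ (p , q) (p′ , q′) → +-cong p p′ , +-cong q q′
                  }
                ; assoc = λ x y z → +-assoc _ _ _ , +-assoc _ _ _
                }
              ; identity = (λ x → +-identityˡ _ , +-identityˡ _)
                         , (λ x → +-identityʳ _ , +-identityʳ _)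
              }
            ; inverse = (λ x → -‿inverseˡ _ , -‿inverseˡ _)
                      , (λ x → -‿inverseʳ _ , -‿inverseʳ _)
            ; ⁻¹-cong = λ (p , q) → -‿cong p , -‿cong q
            }
          ; comm = λ x y → +-comm _ _ , +-comm _ _
          }
        ; *-cong = λ (p , q) (p′ , q′) →
              +-cong (*-cong p p′) (-‿cong (*-cong q q′))
            , +-cong (*-cong p q′) (*-cong q p′)
        ; *-assoc = λ x y z → assoc-re _ _ _ _ _ _ , assoc-im _ _ _ _ _ _
        ; *-identity = identityˡ , λ x → ≈-trans (*-commᵢ x (1# +i 0#)) (identityˡ x)
        ; distrib = distribˡ , λ x y z →
            ≈-trans (*-commᵢ (y +ᵢ z) x)
              (≈-trans (distribˡ x y z) (+ᵢ-cong (*-commᵢ x y) (*-commᵢ x z)))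
        }
      ; *-comm = *-commᵢ
      }
    }
    where
    open RingProperties ring using (-‿distribˡ-*; -‿distribʳ-*; -‿+-comm; -0#≈0#)
    open ≈-Reasoning setoid

    _≈ᵢ_ : Carrierᵢ → Carrierᵢ → Set ℓ
    x ≈ᵢ y = re x ≈ re y × im x ≈ im y

    _+ᵢ_ _*ᵢ_ : Carrierᵢ → Carrierᵢ → Carrierᵢ
    x +ᵢ y = re x + re y +i im x + im y
    x *ᵢ y = re x * re y - im x * im y +i re x * im y + im x * re y

    ≈-trans : ∀ {x y z} → x ≈ᵢ y → y ≈ᵢ z → x ≈ᵢ z
    ≈-trans (p , q) (p′ , q′) = R.trans p p′ , R.trans q q′

    +ᵢ-cong : ∀ {x x′ y y′} → x ≈ᵢ x′ → y ≈ᵢ y′ → (x +ᵢ y) ≈ᵢ (x′ +ᵢ y′)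
    +ᵢ-cong (p , q) (p′ , q′) = +-cong p p′ , +-cong q q′

    *-commᵢ : ∀ x y → (x *ᵢ y) ≈ᵢ (y *ᵢ x)
    *-commᵢ x y = +-cong (*-comm _ _) (-‿cong (*-comm _ _))
                , R.trans (+-comm _ _) (+-cong (*-comm _ _) (*-comm _ _))

    identityˡ : ∀ x → ((1# +i 0#) *ᵢ x) ≈ᵢ x
    identityˡ (a +i b) =
        R.trans (+-cong (*-identityˡ a) (R.trans (-‿cong (zeroˡ b)) -0#≈0#)) (+-identityʳ a)
      , R.trans (+-cong (*-identityˡ b) (zeroˡ a)) (+-identityʳ b)

    assoc-re : ∀ a b c d e f →
      (a * c - b * d) * e - (a * d + b * c) * f ≈ a * (c * e - d * f) - b * (c * f + d * e)
    assoc-re a b c d e f = begin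
      (a * c - b * d) * e - (a * d + b * c) * f
        ≈⟨ +-cong (*-congʳ (+-congˡ (-‿distribʳ-* b d))) (-‿distribʳ-* _ f) ⟩
      (a * c + b * - d) * e + (a * d + b * c) * - f
        ≈⟨ S.solve 7 (λ a b c d d′ e f′ →
             ((a :* c :+ b :* d′) :* e :+ (a :* d :+ b :* c) :* f′)
             := (a :* (c :* e :+ d :* f′) :+ b :* (c :* f′ :+ d′ :* e)))
             R.refl a b c d (- d) e (- f) ⟩
      a * (c * e + d * - f) + b * (c * - f + - d * e)
        ≈⟨ +-cong (*-congˡ (+-congˡ (-‿distribʳ-* d f)))
             (*-congˡ (+-cong (-‿distribʳ-* c f) (-‿distribˡ-* d e))) ⟨
      a * (c * e - d * f) + b * (- (c * f) - d * e)
        ≈⟨ +-congˡ (*-congˡ (-‿+-comm _ _)) ⟩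
      a * (c * e - d * f) + b * - (c * f + d * e)
        ≈⟨ +-congˡ (-‿distribʳ-* b _) ⟨
      a * (c * e - d * f) - b * (c * f + d * e) ∎

    assoc-im : ∀ a b c d e f →
      (a * c - b * d) * f + (a * d + b * c) * e ≈ a * (c * f + d * e) + b * (c * e - d * f)
    assoc-im a b c d e f = begin
      (a * c - b * d) * f + (a * d + b * c) * e
        ≈⟨ +-congʳ (*-congʳ (+-congˡ (-‿distribʳ-* b d))) ⟩
      (a * c + b * - d) * f + (a * d + b * c) * e
        ≈⟨ S.solve 7 (λ a b c d d′ e f →
             ((a :* c :+ b :* d′) :* f :+ (a :* d :+ b :* c) :* e)
             := (a :* (c :* f :+ d :* e) :+ b :* (c :* e :+ d′ :* f)))
             R.refl a b c d (- d) e f ⟩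
      a * (c * f + d * e) + b * (c * e + - d * f)
        ≈⟨ +-congˡ (*-congˡ (+-congˡ (-‿distribˡ-* d f))) ⟨
      a * (c * f + d * e) + b * (c * e - d * f) ∎

    +-interchange : ∀ w x y z → (w + x) + (y + z) ≈ (w + y) + (x + z)
    +-interchange = S.solve 4
      (λ w x y z → ((w :+ x) :+ (y :+ z)) := ((w :+ y) :+ (x :+ z))) R.refl

    distribˡ : ∀ x y z → (x *ᵢ (y +ᵢ z)) ≈ᵢ ((x *ᵢ y) +ᵢ (x *ᵢ z))
    distribˡ (a +i b) (c +i d) (e +i f) =
        R.trans (+-cong (R.distribˡ a c e)
                  (R.trans (-‿cong (R.distribˡ b d f)) (R.sym (-‿+-comm _ _))))
          (+-interchange _ _ _ _)
      , R.trans (+-cong (R.distribˡ a d f) (R.distribˡ b c e)) (+-interchange _ _ _ _)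

ℂ-commutativeRing : CommutativeRing 0ℓ 0ℓ
ℂ-commutativeRing = Gaussian.commutativeRing ℝ-commutativeRing

ℂ : Set
ℂ = CommutativeRing.Carrier ℂ-commutativeRing

fromℚᶜ : ℚ → ℂ
fromℚᶜ p = fromℚ p Gaussian.+i fromℚ 0ℚ

module PowerSeries {c ℓ} (R : CommutativeRing c ℓ) where

  open CommutativeRing R
  open MonoidSum +-monoid
  open RawMonoidDefs +-rawMonoid using () renaming (_×_ to _·_)

  Series : Set c
  Series = ℕ → Carrier

  infix  4 _≈ˢ_
  infixl 6 _+ˢ_ _-ˢ_
  infixl 7 _*ˢ_
  infixr 8 _^ˢ_
  infixr 9 _∘ˢ_

  _≈ˢ_ : Series → Series → Set ℓ
  f ≈ˢ g = ∀ n → f n ≈ g n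

  constˢ : Carrier → Series
  constˢ a zero    = a
  constˢ a (suc n) = 0#

  0ˢ 1ˢ X : Series
  0ˢ = constˢ 0#
  1ˢ = constˢ 1#
  X zero          = 0#
  X (suc zero)    = 1#
  X (suc (suc n)) = 0#

  _+ˢ_ _-ˢ_ _*ˢ_ : Series → Series → Series
  (f +ˢ g) n = f n + g n
  (f -ˢ g) n = f n - g n
  (f *ˢ g) n = ∑[ i ≤ n ] (f (toℕ i) * g (n ∸ toℕ i))

  _^ˢ_ : Series → ℕ → Series
  f ^ˢ zero  = 1ˢ
  f ^ˢ suc k = f ^ˢ k *ˢ f

  -- The substitution g(h(X)), meaningful only when h has no constant term:
  -- then hᵏ does not contribute to the coefficient of Xⁿ for k > n.

  _∘ˢ_ : Series → Series → Series
  (g ∘ˢ h) n = ∑[ k ≤ n ] (g (toℕ k) * (h ^ˢ toℕ k) n)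

  -- 1/f = ∑ (1 - f)ᵏ, meaningful only when f has constant term 1.

  recip : Series → Series
  recip f = (λ _ → 1#) ∘ˢ (1ˢ -ˢ f)

  -- The derivation X d/dX.

  θ : Series → Series
  θ f n = n · f n

  -- Compositional inverse of Q = X + O(X²): the approximations
  -- Zₙ₊₁ = X - (Q - X)(Zₙ) are correct up to Xⁿ⁺¹.

  private
    beyond-X : Series → Series
    beyond-X Q zero          = 0#
    beyond-X Q (suc zero)    = 0#
    beyond-X Q (suc (suc n)) = Q (suc (suc n))

    approx : Series → ℕ → Series
    approx Q zero    = 0ˢ
    approx Q (suc n) = X -ˢ (beyond-X Q ∘ˢ approx Q n)

  revert : Series → Series
  revert Q n = approx Q n n

  private
    Agree : ℕ → Series → Series → Set ℓ
    Agree n f g = ∀ i → i ℕ.≤ n → f i ≈ g i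

    *ˢ-cong₀ : ∀ f f′ g g′ m →
               (∀ j d → j ℕ.+ d ≡ m → f j * g d ≈ f′ j * g′ d) →
               (f *ˢ g) m ≈ (f′ *ˢ g′) m
    *ˢ-cong₀ _ _ _ _ m h = sum-cong-≋ {suc m} λ i →
      h (toℕ i) (m ∸ toℕ i) (ℕₚ.m+[n∸m]≡n (ℕ.s≤s⁻¹ (Finₚ.toℕ<n i)))

    *ˢ-agree : ∀ {f f′ g g′ n} → Agree n f f′ → Agree n g g′ → Agree n (f *ˢ g) (f′ *ˢ g′)
    *ˢ-agree {f} {f′} {g} {g′} p q m m≤n = *ˢ-cong₀ f f′ g g′ m λ { j d ≡.refl →
      *-cong (p j (ℕₚ.m+n≤o⇒m≤o j m≤n)) (q d (ℕₚ.m+n≤o⇒n≤o j m≤n)) }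

    *ˢ-agree⁺ : ∀ {f f′ g g′ n} → f 0 ≈ 0# → f′ 0 ≈ 0# → g 0 ≈ 0# → g′ 0 ≈ 0# →
                Agree n f f′ → Agree n g g′ → Agree (suc n) (f *ˢ g) (f′ *ˢ g′)
    *ˢ-agree⁺ {f} {f′} {g} {g′} {n} f0 f′0 g0 g′0 p q m m≤ =
      *ˢ-cong₀ f f′ g g′ m λ { j d ≡.refl → term j d m≤ }
      where
      0*_≈0*_ : ∀ {a b} x y → a ≈ 0# → b ≈ 0# → a * x ≈ b * y
      0*_≈0*_ x y a b = trans (trans (*-congʳ a) (zeroˡ x)) (sym (trans (*-congʳ b) (zeroˡ y)))
      term : ∀ j d → j ℕ.+ d ℕ.≤ suc n → f j * g d ≈ f′ j * g′ d
      term zero    d       _ = 0*_≈0*_ _ _ f0 f′0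
      term (suc j) zero    _ = trans (*-comm _ _) (trans (0*_≈0*_ _ _ g0 g′0) (*-comm _ _))
      term (suc j) (suc d) (s≤s j+d≤) = *-cong
        (p (suc j) (ℕₚ.m+n≤o⇒m≤o (suc j) (subst (ℕ._≤ n) (ℕₚ.+-suc j d) j+d≤)))
        (q (suc d) (ℕₚ.m+n≤o⇒n≤o j j+d≤))

    ^ˢ-zero : ∀ {h} k → h 0 ≈ 0# → (h ^ˢ suc k) 0 ≈ 0#
    ^ˢ-zero k h0 = trans (+-identityʳ _) (trans (*-congˡ h0) (zeroʳ _))

    ^ˢ-agree : ∀ {h h′ n} k → Agree n h h′ → Agree n (h ^ˢ k) (h′ ^ˢ k)
    ^ˢ-agree zero    p _ _ = refl
    ^ˢ-agree (suc k) p = *ˢ-agree (^ˢ-agree k p) p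

    beyond-agree : ∀ Q {h h′ n} → h 0 ≈ 0# → h′ 0 ≈ 0# → Agree n h h′ →
                   Agree (suc n) (beyond-X Q ∘ˢ h) (beyond-X Q ∘ˢ h′)
    beyond-agree Q {h} {h′} {n} h0 h′0 p m m≤ = sum-cong-≋ {suc m} λ k → term (toℕ k)
      where
      term : ∀ k → beyond-X Q k * (h ^ˢ k) m ≈ beyond-X Q k * (h′ ^ˢ k) m
      term zero          = refl
      term (suc zero)    = trans (zeroˡ _) (sym (zeroˡ _))
      term (suc (suc k)) = *-congˡ (*ˢ-agree⁺ (^ˢ-zero k h0) (^ˢ-zero k h′0) h0 h′0
                             (^ˢ-agree (suc k) p) p m m≤)

    approx-zero : ∀ Q n → approx Q n 0 ≈ 0#
    approx-zero Q zero    = refl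
    approx-zero Q (suc n) = trans
      (+-congˡ (trans (-‿cong (trans (+-identityʳ _) (zeroˡ _))) (RingProperties.-0#≈0# ring)))
      (+-identityʳ _)

    approx-step : ∀ Q n → Agree n (approx Q n) (approx Q (suc n))
    approx-step Q zero    zero _ = sym (approx-zero Q 1)
    approx-step Q (suc n) m m≤ = +-congˡ (-‿cong
      (beyond-agree Q (approx-zero Q n) (approx-zero Q (suc n)) (approx-step Q n) m m≤))

    revert-agree : ∀ Q n → Agree n (revert Q) (approx Q n)
    revert-agree Q zero    zero z≤n = refl
    revert-agree Q (suc n) m m≤ with ℕₚ.m≤n⇒m<n∨m≡n m≤
    ... | inj₁ (s≤s m≤n) = trans (revert-agree Q n m m≤n) (approx-step Q n m m≤n)
    ... | inj₂ ≡.refl    = refl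

    1ˢ*ˢ : ∀ h n → (1ˢ *ˢ h) n ≈ h n
    1ˢ*ˢ h n = trans (+-cong (*-identityˡ _)
      (trans (sum-cong-≋ {n} λ i → zeroˡ _) (sum-replicate-zero n))) (+-identityʳ _)

  revert-zero : ∀ Q → revert Q 0 ≈ 0#
  revert-zero Q = refl

  ∘ˢ-revert : ∀ Q → Q 0 ≈ 0# → Q 1 ≈ 1# → Q ∘ˢ revert Q ≈ˢ X
  ∘ˢ-revert Q Q0 Q1 zero = trans (+-identityʳ _) (trans (*-congʳ Q0) (zeroˡ _))
  ∘ˢ-revert Q Q0 Q1 (suc n) = begin
    Q 0 * 0# + (Q 1 * (1ˢ *ˢ z) (suc n) + rest)
      ≈⟨ +-cong (zeroʳ _) (+-congʳ (trans (*-cong Q1 (1ˢ*ˢ z (suc n))) (*-identityˡ _))) ⟩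
    0# + (z (suc n) + rest)
      ≈⟨ +-identityˡ _ ⟩
    (X (suc n) - (beyond-X Q ∘ˢ approx Q n) (suc n)) + rest
      ≈⟨ +-congˡ rest≈ ⟩
    (X (suc n) - (beyond-X Q ∘ˢ approx Q n) (suc n)) + (beyond-X Q ∘ˢ approx Q n) (suc n)
      ≈⟨ +-assoc _ _ _ ⟩
    X (suc n) + (- (beyond-X Q ∘ˢ approx Q n) (suc n) + (beyond-X Q ∘ˢ approx Q n) (suc n))
      ≈⟨ +-congˡ (-‿inverseˡ _) ⟩
    X (suc n) + 0#
      ≈⟨ +-identityʳ _ ⟩
    X (suc n) ∎
    where
    open ≈-Reasoning setoid
    z = revert Q
    rest = ∑[ k < n ] (Q (suc (suc (toℕ k))) * (z ^ˢ suc (suc (toℕ k))) (suc n))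
    rest≈ : rest ≈ (beyond-X Q ∘ˢ approx Q n) (suc n)
    rest≈ = begin
      rest              ≈⟨ +-identityˡ _ ⟨
      0# + rest         ≈⟨ +-identityˡ _ ⟨
      0# + (0# + rest)  ≈⟨ +-cong (zeroˡ _) (+-congʳ (zeroˡ _)) ⟨
      (beyond-X Q ∘ˢ z) (suc n)
        ≈⟨ beyond-agree Q (revert-zero Q) (approx-zero Q n) (revert-agree Q n) (suc n) ℕₚ.≤-refl ⟩
      (beyond-X Q ∘ˢ approx Q n) (suc n) ∎

  private
    ∘ˢ-zero : ∀ g h → (g ∘ˢ h) 0 ≈ g 0
    ∘ˢ-zero g h = trans (+-identityʳ _) (*-identityʳ _)

    X*ˢ-zero : ∀ f → (X *ˢ f) 0 ≈ 0#
    X*ˢ-zero f = trans (+-identityʳ _) (zeroˡ _)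

    X*ˢ-one : ∀ f → (X *ˢ f) 1 ≈ f 0
    X*ˢ-one f = trans (+-cong (zeroˡ _) (trans (+-identityʳ _) (*-identityˡ _))) (+-identityˡ _)

  X*∘ˢ-revert : ∀ g h → g 0 ≈ 1# →
                let Q = X *ˢ (g ∘ˢ h) in Q ∘ˢ revert Q ≈ˢ X
  X*∘ˢ-revert g h g0 = ∘ˢ-revert (X *ˢ (g ∘ˢ h)) (X*ˢ-zero (g ∘ˢ h))
    (trans (X*ˢ-one (g ∘ˢ h)) (trans (∘ˢ-zero g h) g0))

module DifferentialAlgebra {ℓ} (R : CommutativeRing ℓ ℓ) where

  open CommutativeRing R
  open PowerSeries R

  -- Poly n = R[Y₀,…,Yₙ₋₁].  An element of R[Y₀,…,Yₙ] is the list of its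
  -- coefficients in R[Y₀,…,Yₙ₋₁] with respect to the powers 1, Yₙ, Yₙ², ….

  Poly : ℕ → Set ℓ
  Poly zero    = Carrier
  Poly (suc n) = List (Poly n)

  IsZero : ∀ n → Poly n → Set ℓ
  IsZero zero    a = a ≈ 0#
  IsZero (suc n) p = All (IsZero n) p

  InvolvesLast : ∀ n → Poly (suc n) → Set ℓ
  InvolvesLast n p = ¬ All (IsZero n) (drop 1 p)

  eval : ∀ n → Poly n → (ℕ → Series) → Series
  eval zero    a        y = constˢ a
  eval (suc n) []       y = 0ˢ
  eval (suc n) (p ∷ ps) y = eval n p y +ˢ y n *ˢ eval (suc n) ps y

  -- If X = eᵗ then θ = d/dt, so this is the k-th derivative with respect to t.

  _⟨_⟩ : Series → ℕ → Series
  f ⟨ zero  ⟩ = f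
  f ⟨ suc k ⟩ = θ (f ⟨ k ⟩)

  SatisfiesADE : ℕ → Series → Set ℓ
  SatisfiesADE n f = ∃[ P ] InvolvesLast n P × eval (suc n) P (f ⟨_⟩) ≈ˢ 0ˢ

  -- g belongs to the field R(f, f′, …, f⁽ⁿ⁻¹⁾).

  InJetField : ℕ → Series → Series → Set ℓ
  InJetField n f g = ∃[ P ] ∃[ Q ]
    ¬ (eval n Q (f ⟨_⟩) ≈ˢ 0ˢ) × g *ˢ eval n Q (f ⟨_⟩) ≈ˢ eval n P (f ⟨_⟩)

module ℚ⟦X⟧ = PowerSeries ℚₚ.+-*-commutativeRing
module ℂ⟦X⟧ = PowerSeries ℂ-commutativeRing
module ℂ-DifferentialAlgebra = DifferentialAlgebra ℂ-commutativeRing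

open ℚ⟦X⟧ using (X; _≈ˢ_; _*ˢ_; _∘ˢ_; recip; revert; X*∘ˢ-revert)
open MonoidSum ℚₚ.+-0-monoid using (sum-syntax)

-- f₀(z) and f₀(z) log z + g₁(z) are the solutions at z = 0 of
-- (θˢ⁻¹ - s z (s θ + 1) (s θ + 2) ⋯ (s θ + s - 1)) y = 0.

f₀ : ℕ → ℚ⟦X⟧.Series
f₀ s l = (+ ((s ℕ.* l) !) / (l !) ℕ.^ s)
  where instance _ = l ℕₚ.!≢0
                 _ = ℕₚ.m^n≢0 (l !) s

-- The inner sum is ∑ 1/k over l < k ≤ s l; it is empty for l = 0.

g₁ : ℕ → ℚ⟦X⟧.Series
g₁ s l = (+ s / 1) ℚ.* (f₀ s l ℚ.* ∑[ j < s ℕ.* l ∸ l ] (+ 1 / suc (l ℕ.+ toℕ j)))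

expˢ : ℚ⟦X⟧.Series
expˢ n = (+ 1 / n !) where instance _ = n ℕₚ.!≢0

-- exp((f₀ log z + g₁) / f₀) = z exp(g₁ / f₀)

qSeries : ℕ → ℚ⟦X⟧.Series
qSeries s = X *ˢ (expˢ ∘ˢ (g₁ s *ˢ recip (f₀ s)))

IsMirrorMap : ℕ → ℚ⟦X⟧.Series → Set
IsMirrorMap s z = z 0 ≡ 0ℚ × qSeries s ∘ˢ z ≈ˢ X

mirrorMap-exists : ∀ s → ∃[ z ] IsMirrorMap s z
mirrorMap-exists s = revert (qSeries s) , ≡.refl ,
  X*∘ˢ-revert expˢ (g₁ s *ˢ recip (f₀ s)) ≡.refl

toℂ⟦X⟧ : ℚ⟦X⟧.Series → ℂ⟦X⟧.Series
toℂ⟦X⟧ f n = fromℚᶜ (f n)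

{-# OPTIONS --safe #-}

-- Let ∂ = d/dt and D = z d/dz = W ∂ with W = z/z′.  The series f = f₀(z(q)) and t f are both
-- annihilated by the operator L of order s - 1, hence [L, t] f = 0, a linear relation between
-- f, D f, …, Dˢ⁻²f in which Dˢ⁻¹t, and with it z⁽ˢ⁻¹⁾, occurs in the coefficient of f only.
-- Let Kₘ be the field generated by z, z′, …, z⁽ᵐ⁾ and suppose that z⁽ᵐ⁾ ∉ Kₘ₋₁ whenever
-- 1 ≤ m ≤ 2 s - 3.  Then c ∈ Kₘ₋₁ whenever c and ∂c lie in Kₘ and m < 2 s - 3.  Choose
-- generators of the Kₘ-span of f, …, Dˢ⁻²f, starting with all of them for m = s - 2, and drop
-- one of them other than f each time they become dependent over Kₘ₊₁.  They stay independent
-- for some m ≤ 2 s - 4.  Differentiating the expressions of the Dⁱf in these generators shows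
-- that the coefficients have their derivatives in Kₘ, hence lie in Kₘ₋₁, and by repetition in
-- Kₛ₋₂.  Now [L, t] f = 0 yields Dˢ⁻¹t ∈ Kₛ₋₂, a contradiction.  So z⁽ᵐ⁾ ∈ Kₘ₋₁ for some
-- m ≤ 2 s - 3, and applying ∂ repeatedly gives this for m = 2 s - 3.  All this happens over ℚ,
-- in the fraction field of ℚ⟦q⟧.

module Submission where

open import Defs
open import Level using (0ℓ)
open import Algebra.Bundles using (CommutativeRing)
import Algebra.Definitions.RawMonoid as RawMonoidDefs
import Algebra.Properties.AbelianGroup as AbelianGroupProperties
import Algebra.Properties.CommutativeMonoid.Mult as CommutativeMonoidMult
import Algebra.Properties.Monoid.Mult as MonoidMult
import Algebra.Properties.Monoid.Sum as MonoidSum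
import Algebra.Properties.Ring as RingProperties
import Algebra.Properties.Semiring.Mult as SemiringMult
import Algebra.Properties.Semiring.Mult.TCOptimised as TCOptimisedMult
import Algebra.Solver.Ring as RingSolver
open import Algebra.Solver.Ring.AlmostCommutativeRing
  using (fromCommutativeRing; _-Raw-AlmostCommutative⟶_)
open import Axiom.ExcludedMiddle using (ExcludedMiddle)
open import Data.Empty using (⊥; ⊥-elim)
open import Data.Fin.Base using (toℕ)
open import Data.Integer.Base as ℤ using (ℤ; +_; -[1+_]; _⊖_)
import Data.Integer.Properties as ℤₚ
open import Data.List.Base using (List; []; _∷_; length)
open import Data.List.Relation.Unary.All using (All; []; _∷_)
open import Data.Maybe.Base using (Maybe; just; nothing)
open import Data.Nat.Base as ℕ using (ℕ; zero; suc; _!; z≤n; s≤s)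
import Data.Nat.Properties as ℕₚ
open import Data.Product.Base using (_,_; _×_; ∃-syntax; proj₁; proj₂)
open import Data.Rational.Base as ℚ using (ℚ; 0ℚ; 1ℚ; _/_)
import Data.Rational.Properties as ℚₚ
import Data.Rational.Unnormalised.Base as ℚᵘ
import Data.Rational.Unnormalised.Properties as ℚᵘₚ
open import Data.Sum.Base using (_⊎_; inj₁; inj₂)
open import Data.Unit.Base using (⊤; tt)
open import Relation.Binary.PropositionalEquality as ≡ using (_≡_; _≢_)
import Relation.Binary.Reasoning.Setoid as ≈-Reasoning
open import Relation.Nullary.Decidable.Core using (Dec; yes; no)
open import Relation.Nullary.Negation.Core using (¬_)

-- Comparing coefficients in [L, t] f = 0 requires independent generators, but nothing is known
-- about linear relations between the Dⁱf over the fields Kₘ. So relations are allowed and counted: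
-- there are s - 2 generators besides f, each loss costs one step up the tower from Kₛ₋₂, and this
-- is the origin of 2 s - 4 and of the order 2 s - 3. On the way back down, coefficients are
-- compared over a field that also contains their derivatives.
--
-- Neither t = log q nor the logarithm in f₁ = t f lies in the fraction field of ℚ⟦q⟧. They enter
-- only through Dᵏ(t f) - t Dᵏf, where log z cancels because t = log z + g₁ / f₀. That t f satisfies
-- the same equation as f is Frobenius' method: the coefficients of f₀ and g₁ are the two parts of
-- one sequence of dual numbers, obtained by putting l + ε with ε² = 0 in place of l and normalising
-- at l = 0.
--
-- The passage to ℂ is harmless because a nonzero series over ℚ stays nonzero over ℂ, so
-- denominators survive. Excluded middle decides whether an element vanishes and whether it lies in
-- a given field or span.

-- Ring solver with integer coefficients over a commutative ring

module IntegerSolver {c ℓ} (R : CommutativeRing c ℓ) where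

  open CommutativeRing R
  open RingProperties ring using (-‿distribˡ-*; -‿distribʳ-*; -0#≈0#; -‿involutive)
  open AbelianGroupProperties +-abelianGroup using () renaming (⁻¹-∙-comm to -‿+-comm)
  open TCOptimisedMult semiring using (×-homo-+; ×1-homo-*) renaming (_×_ to _·_)
  open ≈-Reasoning setoid

  private
    -- Multiples are taken in the variant for which 1 · 1# computes to 1#, so that `con (+ 1)`
    -- denotes 1# itself.
    ⟦_⟧ : ℤ → Carrier
    ⟦ + n ⟧      = n · 1#
    ⟦ -[1+ n ] ⟧ = - (suc n · 1#)

    ⟦-⟧ : ∀ i → ⟦ ℤ.- i ⟧ ≈ - ⟦ i ⟧
    ⟦-⟧ (+ zero)  = sym -0#≈0#
    ⟦-⟧ (+ suc n) = refl
    ⟦-⟧ -[1+ n ]  = sym (-‿involutive _)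

    cancel-one : ∀ x y → (1# + x) - (1# + y) ≈ x - y
    cancel-one x y = begin
      (1# + x) - (1# + y)         ≈⟨ +-cong (+-comm 1# x) (sym (-‿+-comm 1# y)) ⟩
      (x + 1#) + (- 1# + - y)     ≈⟨ +-assoc x 1# _ ⟩
      x + (1# + (- 1# + - y))     ≈⟨ +-congˡ (+-assoc 1# _ _) ⟨
      x + ((1# + - 1#) + - y)     ≈⟨ +-congˡ (+-congʳ (-‿inverseʳ 1#)) ⟩
      x + (0# + - y)              ≈⟨ +-congˡ (+-identityˡ _) ⟩
      x - y                       ∎

    ⟦⊖⟧ : ∀ m n → ⟦ m ⊖ n ⟧ ≈ m · 1# - n · 1#
    ⟦⊖⟧ m       zero    = sym (trans (+-congˡ -0#≈0#) (+-identityʳ _))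
    ⟦⊖⟧ zero    (suc n) = sym (+-identityˡ _)
    ⟦⊖⟧ (suc m) (suc n) = begin
      ⟦ suc m ⊖ suc n ⟧              ≡⟨ ≡.cong ⟦_⟧ (ℤₚ.[1+m]⊖[1+n]≡m⊖n m n) ⟩
      ⟦ m ⊖ n ⟧                      ≈⟨ ⟦⊖⟧ m n ⟩
      m · 1# - n · 1#                ≈⟨ cancel-one _ _ ⟨
      (1# + m · 1#) - (1# + n · 1#)  ≈⟨ +-cong (×-homo-+ 1# 1 m) (-‿cong (×-homo-+ 1# 1 n)) ⟨
      suc m · 1# - suc n · 1#        ∎

    ⟦+⟧ : ∀ i j → ⟦ i ℤ.+ j ⟧ ≈ ⟦ i ⟧ + ⟦ j ⟧
    ⟦+⟧ (+ m)    (+ n)    = ×-homo-+ 1# m n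
    ⟦+⟧ (+ m)    -[1+ n ] = ⟦⊖⟧ m (suc n)
    ⟦+⟧ -[1+ m ] (+ n)    = trans (⟦⊖⟧ n (suc m)) (+-comm _ _)
    ⟦+⟧ -[1+ m ] -[1+ n ] = begin
      - (suc (suc (m ℕ.+ n)) · 1#)     ≡⟨ ≡.cong (λ k → - (suc k · 1#)) (≡.sym (ℕₚ.+-suc m n)) ⟩
      - ((suc m ℕ.+ suc n) · 1#)       ≈⟨ -‿cong (×-homo-+ 1# (suc m) (suc n)) ⟩
      - (suc m · 1# + suc n · 1#)      ≈⟨ -‿+-comm _ _ ⟨
      - (suc m · 1#) - (suc n · 1#)    ∎

    ⟦*⟧⁺ : ∀ m j → ⟦ + m ℤ.* j ⟧ ≈ ⟦ + m ⟧ * ⟦ j ⟧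
    ⟦*⟧⁺ m (+ n)    = trans (reflexive (≡.cong ⟦_⟧ (≡.sym (ℤₚ.pos-* m n)))) (×1-homo-* m n)
    ⟦*⟧⁺ m -[1+ n ] = begin
      ⟦ + m ℤ.* ℤ.- (+ suc n) ⟧    ≡⟨ ≡.cong ⟦_⟧ (ℤₚ.neg-distribʳ-* (+ m) (+ suc n)) ⟨
      ⟦ ℤ.- (+ m ℤ.* + suc n) ⟧    ≈⟨ ⟦-⟧ (+ m ℤ.* + suc n) ⟩
      - ⟦ + m ℤ.* + suc n ⟧        ≈⟨ -‿cong (⟦*⟧⁺ m (+ suc n)) ⟩
      - (⟦ + m ⟧ * (suc n · 1#))   ≈⟨ -‿distribʳ-* _ _ ⟩
      ⟦ + m ⟧ * - (suc n · 1#)     ∎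

    ⟦*⟧ : ∀ i j → ⟦ i ℤ.* j ⟧ ≈ ⟦ i ⟧ * ⟦ j ⟧
    ⟦*⟧ (+ m)    j = ⟦*⟧⁺ m j
    ⟦*⟧ -[1+ m ] j = begin
      ⟦ ℤ.- (+ suc m) ℤ.* j ⟧    ≡⟨ ≡.cong ⟦_⟧ (ℤₚ.neg-distribˡ-* (+ suc m) j) ⟨
      ⟦ ℤ.- (+ suc m ℤ.* j) ⟧    ≈⟨ ⟦-⟧ (+ suc m ℤ.* j) ⟩
      - ⟦ + suc m ℤ.* j ⟧        ≈⟨ -‿cong (⟦*⟧⁺ (suc m) j) ⟩
      - ((suc m · 1#) * ⟦ j ⟧)   ≈⟨ -‿distribˡ-* _ _ ⟩
      - (suc m · 1#) * ⟦ j ⟧     ∎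

    homomorphism : ℤ.+-*-rawRing -Raw-AlmostCommutative⟶ fromCommutativeRing R
    homomorphism = record
      { ⟦_⟧    = ⟦_⟧
      ; +-homo = ⟦+⟧
      ; *-homo = ⟦*⟧
      ; -‿homo = ⟦-⟧
      ; 0-homo = refl
      ; 1-homo = refl
      }

    dec : ∀ i j → Maybe (⟦ i ⟧ ≈ ⟦ j ⟧)
    dec i j with i ℤₚ.≟ j
    ... | yes ≡.refl = just refl
    ... | no  _      = nothing

  open RingSolver ℤ.+-*-rawRing (fromCommutativeRing R) homomorphism dec public
    using (solve; con; _:+_; _:*_; _:-_; :-_; _:=_)

-- Subrings, adjunction of an element, subfields as sets of fractions

module Subrings (A : CommutativeRing 0ℓ 0ℓ) where

  open CommutativeRing A
  open RingProperties ring using (-‿distribˡ-*)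
  open IntegerSolver A

  record IsSubring (S : Carrier → Set) : Set where
    field
      resp : ∀ {x y} → x ≈ y → S x → S y
      one  : S 1#
      add  : ∀ {x y} → S x → S y → S (x + y)
      mul  : ∀ {x y} → S x → S y → S (x * y)
      neg  : ∀ {x} → S x → S (- x)

    sub : ∀ {x y} → S x → S y → S (x - y)
    sub p q = add p (neg q)

    nil : S 0#
    nil = resp (-‿inverseʳ 1#) (sub one one)

  -- The intersection of the ring with a subfield of its fraction field.

  record IsSubfield (K : Carrier → Set) : Set where
    field
      isSubring : IsSubring K
      div : ∀ {x b c} → K b → ¬ b ≈ 0# → K c → x * b ≈ c → K x
    open IsSubring isSubring public

  ev : List Carrier → Carrier → Carrier
  ev []       y = 0#
  ev (p ∷ ps) y = p + y * ev ps y

  -- Membership is existence of a polynomial with the given value, not the polynomial itself: `y`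
  -- may be algebraic over `S`, and then several lists have the same value.
  data Adjoin (S : Carrier → Set) (y : Carrier) : Carrier → Set where
    value : ∀ {g} ps → All S ps → g ≈ ev ps y → Adjoin S y g

  module _ {S : Carrier → Set} (S-sub : IsSubring S) (y : Carrier) where

    open IsSubring S-sub

    private
      A[_] = Adjoin S y

      cons : ∀ {p g} → S p → A[ g ] → A[ p + y * g ]
      cons p (value ps all eq) = value (_ ∷ ps) (p ∷ all) (+-congˡ (*-congˡ eq))

      respᴬ : ∀ {g h} → g ≈ h → A[ g ] → A[ h ]
      respᴬ eq (value ps all e) = value ps all (trans (sym eq) e)

      const : ∀ {p} → S p → A[ p ]
      const {p} s = value (p ∷ []) (s ∷ []) (sym (trans (+-congˡ (zeroʳ y)) (+-identityʳ p)))

      add-ev : ∀ ps qs → All S ps → All S qs → A[ ev ps y + ev qs y ]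
      add-ev []       qs       _        ss       = value qs ss (+-identityˡ _)
      add-ev (p ∷ ps) []       rs       _        = value (p ∷ ps) rs (+-identityʳ _)
      add-ev (p ∷ ps) (q ∷ qs) (r ∷ rs) (s ∷ ss) =
        respᴬ (solve 5 (λ p q y a b → (p :+ q) :+ y :* (a :+ b) := (p :+ y :* a) :+ (q :+ y :* b))
                 refl p q y _ _)
          (cons (add r s) (add-ev ps qs rs ss))

      addᴬ : ∀ {g h} → A[ g ] → A[ h ] → A[ g + h ]
      addᴬ (value ps rs e) (value qs ss e′) =
        respᴬ (sym (+-cong e e′)) (add-ev ps qs rs ss)

      scale-ev : ∀ {c} ps → S c → All S ps → A[ c * ev ps y ]
      scale-ev {c} []       sc _        = value [] [] (zeroʳ c)
      scale-ev {c} (p ∷ ps) sc (r ∷ rs) =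
        respᴬ (solve 4 (λ c p y a → c :* p :+ y :* (c :* a) := c :* (p :+ y :* a)) refl c p y _)
          (cons (mul sc r) (scale-ev ps sc rs))

      mul-ev : ∀ {h} ps → All S ps → A[ h ] → A[ ev ps y * h ]
      mul-ev {h} []       _        _               = value [] [] (zeroˡ h)
      mul-ev {h} (p ∷ ps) (r ∷ rs) H@(value qs ss e) =
        respᴬ (solve 4 (λ p y a h → p :* h :+ (con (+ 0) :+ y :* (a :* h)) := (p :+ y :* a) :* h)
                 refl p y _ h)
          (addᴬ (respᴬ (*-congˡ (sym e)) (scale-ev qs r ss)) (cons nil (mul-ev ps rs H)))

    Adjoin-isSubring : IsSubring A[_]
    Adjoin-isSubring = record
      { resp = respᴬ
      ; one  = const one
      ; add  = addᴬ
      ; mul  = λ { (value ps rs e) H → respᴬ (*-congʳ (sym e)) (mul-ev ps rs H) }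
      ; neg  = λ { {g} (value ps rs e) →
          respᴬ (trans (*-congˡ (sym e)) (solve 1 (λ g → (:- con (+ 1)) :* g := :- g) refl g))
            (scale-ev ps (neg one) rs) }
      }

    ⊆-Adjoin : ∀ {g} → S g → A[ g ]
    ⊆-Adjoin = const

    ∈-Adjoin : A[ y ]
    ∈-Adjoin = respᴬ (solve 1 (λ y → con (+ 0) :+ y :* con (+ 1) := y) refl y)
      (cons nil (const one))

  -- The quotient a / b is characterised by multiplication, so the ambient ring need not have
  -- division. In a field, and for a subring `S`, this is the subfield generated by `S`.
  Frac : (Carrier → Set) → Carrier → Set
  Frac S g = ∃[ a ] ∃[ b ] S a × S b × ¬ b ≈ 0# × g * b ≈ a

  module _ (1≉0 : ¬ 1# ≈ 0#)
           (domain : ∀ {a b} → a * b ≈ 0# → ¬ a ≈ 0# → b ≈ 0#) where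

    *-≉0 : ∀ {a b} → ¬ a ≈ 0# → ¬ b ≈ 0# → ¬ a * b ≈ 0#
    *-≉0 a b ab = b (domain ab a)

    *-cancelˡ : ∀ {c x y} → ¬ c ≈ 0# → c * x ≈ c * y → x ≈ y
    *-cancelˡ {c} {x} {y} c≉0 e = begin
      x            ≈⟨ solve 2 (λ x y → x := (x :- y) :+ y) refl x y ⟩
      (x - y) + y  ≈⟨ +-congʳ (domain c[x-y]≈0 c≉0) ⟩
      0# + y       ≈⟨ +-identityˡ y ⟩
      y            ∎
      where
      open ≈-Reasoning setoid
      c[x-y]≈0 : c * (x - y) ≈ 0#
      c[x-y]≈0 = begin
        c * (x - y)    ≈⟨ solve 3 (λ c x y → c :* (x :- y) := c :* x :- c :* y) refl c x y ⟩
        c * x - c * y  ≈⟨ +-congʳ e ⟩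
        c * y - c * y  ≈⟨ -‿inverseʳ _ ⟩
        0#             ∎

    ⊆-Frac : ∀ {S g} → IsSubring S → S g → Frac S g
    ⊆-Frac s Sg = _ , 1# , Sg , IsSubring.one s , 1≉0 , *-identityʳ _

    Frac-isSubfield : ∀ {S} → IsSubring S → IsSubfield (Frac S)
    Frac-isSubfield {S} S-sub = record
      { isSubring = record
        { resp = λ { eq (a , b , sa , sb , b≉0 , e) →
            a , b , sa , sb , b≉0 , trans (*-congʳ (sym eq)) e }
        ; one  = ⊆-Frac S-sub one
        ; add  = λ { {g} {h} (a , b , sa , sb , b≉0 , e) (a′ , b′ , sa′ , sb′ , b′≉0 , e′) →
            _ , _ , add (mul sa sb′) (mul sa′ sb) , mul sb sb′ , *-≉0 b≉0 b′≉0
            , trans (solve 4 (λ g h b b′ → (g :+ h) :* (b :* b′) := (g :* b) :* b′ :+ (h :* b′) :* b)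
                       refl g h b b′)
                    (+-cong (*-congʳ e) (*-congʳ e′)) }
        ; mul  = λ { {g} {h} (a , b , sa , sb , b≉0 , e) (a′ , b′ , sa′ , sb′ , b′≉0 , e′) →
            _ , _ , mul sa sa′ , mul sb sb′ , *-≉0 b≉0 b′≉0
            , trans (solve 4 (λ g h b b′ → (g :* h) :* (b :* b′) := (g :* b) :* (h :* b′))
                       refl g h b b′)
                    (*-cong e e′) }
        ; neg  = λ { {g} (a , b , sa , sb , b≉0 , e) →
            _ , b , neg sa , sb , b≉0 , trans (sym (-‿distribˡ-* g b)) (-‿cong e) }
        }
      ; div = λ { {x} {h} {g} (c , d , sc , sd , d≉0 , hd≈c) h≉0 (a , b , sa , sb , b≉0 , gb≈a) xh≈g →
          -- With h = c / d and g = a / b the quotient g / h is (a d) / (c b), and c b is nonzero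
          -- because it equals h d b.
          _ , _ , mul sa sd , mul sc sb
          , (λ cb≈0 → *-≉0 (*-≉0 h≉0 d≉0) b≉0 (trans (*-congʳ hd≈c) cb≈0))
          , (begin
            x * (c * b)        ≈⟨ *-congˡ (*-congʳ hd≈c) ⟨
            x * ((h * d) * b)  ≈⟨ solve 4 (λ x h d b → x :* ((h :* d) :* b) := ((x :* h) :* b) :* d)
                                    refl x h d b ⟩
            ((x * h) * b) * d  ≈⟨ *-congʳ (*-congʳ xh≈g) ⟩
            (g * b) * d        ≈⟨ *-congʳ gb≈a ⟩
            a * d              ∎) }
      }
      where
      open IsSubring S-sub
      open ≈-Reasoning setoid

-- Differential fields and the tower of jet fields

record DifferentialField : Set₁ where
  field
    ring : CommutativeRing 0ℓ 0ℓ
  open CommutativeRing ring public hiding (ring)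
  open RawMonoidDefs +-rawMonoid public using () renaming (_×_ to _·_)
  field
    1≉0          : ¬ 1# ≈ 0#
    inverse      : ∀ x → ¬ x ≈ 0# → ∃[ x⁻¹ ] x⁻¹ * x ≈ 1#
    torsion-free : ∀ n {a} → suc n · a ≈ 0# → a ≈ 0#
    ∂            : Carrier → Carrier
    ∂-cong       : ∀ {x y} → x ≈ y → ∂ x ≈ ∂ y
    ∂-+          : ∀ x y → ∂ (x + y) ≈ ∂ x + ∂ y
    ∂-*          : ∀ x y → ∂ (x * y) ≈ ∂ x * y + x * ∂ y

  domain : ∀ {a b} → a * b ≈ 0# → ¬ a ≈ 0# → b ≈ 0#
  domain {a} {b} ab≈0 a≉0 =
    let a⁻¹ , e = inverse a a≉0
    in trans (sym (trans (*-congʳ e) (*-identityˡ b)))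
         (trans (*-assoc a⁻¹ a b) (trans (*-congˡ ab≈0) (zeroʳ a⁻¹)))

record Jets (D : DifferentialField) : Set₁ where
  open DifferentialField D
  open Subrings ring
  field
    {C}     : Carrier → Set
    C-sub   : IsSubring C
    ∂-const : ∀ {c} → C c → ∂ c ≈ 0#
    y       : ℕ → Carrier
    ∂-y     : ∀ n → ∂ (y n) ≈ y (suc n)

module JetFields (em : ExcludedMiddle 0ℓ) (D : DifferentialField) (T : Jets D) where

  open DifferentialField D
  open Subrings ring
  open Jets T
  open RingProperties (CommutativeRing.ring ring) using (x∙y⁻¹≈ε⇒x≈y)
  open IntegerSolver ring
  open ≈-Reasoning setoid

  -- jets n = C[y₀,…,yₙ₋₁] and J n = C(y₀,…,yₙ₋₁).

  jets : ℕ → Carrier → Set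
  jets zero    = C
  jets (suc n) = Adjoin (jets n) (y n)

  jets-isSubring : ∀ n → IsSubring (jets n)
  jets-isSubring zero    = C-sub
  jets-isSubring (suc n) = Adjoin-isSubring (jets-isSubring n) (y n)

  jets-suc : ∀ {n g} → jets n g → jets (suc n) g
  jets-suc {n} = ⊆-Adjoin (jets-isSubring n) (y n)

  y∈jets : ∀ n → jets (suc n) (y n)
  y∈jets n = ∈-Adjoin (jets-isSubring n) (y n)

  J : ℕ → Carrier → Set
  J n = Frac (jets n)

  J-isSubfield : ∀ n → IsSubfield (J n)
  J-isSubfield n = Frac-isSubfield 1≉0 domain (jets-isSubring n)

  module Polynomials n = IsSubring (jets-isSubring n)
  module J n = IsSubfield (J-isSubfield n)

  jets⊆J : ∀ {n g} → jets n g → J n g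
  jets⊆J {n} = ⊆-Frac 1≉0 domain (jets-isSubring n)

  J-suc : ∀ {n g} → J n g → J (suc n) g
  J-suc {n} (a , b , sa , sb , rest) = a , b , jets-suc {n} sa , jets-suc {n} sb , rest

  J-mono : ∀ {m n g} → m ℕ.≤ n → J m g → J n g
  J-mono {m} {g = g} m≤n = go (ℕₚ.≤⇒≤′ m≤n)
    where
    go : ∀ {n} → m ℕ.≤′ n → J m g → J n g
    go ℕ.≤′-refl             j = j
    go (ℕ.≤′-step {n} m≤′n) j = J-suc {n} (go m≤′n j)

  -- The index counts generators, so Kₘ, generated by y₀, ..., yₘ, is `J (suc m)`.
  y∈J : ∀ n → J (suc n) (y n)
  y∈J n = jets⊆J {suc n} (y∈jets n)

  ∂-0 : ∂ 0# ≈ 0#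
  ∂-0 = ∂-const (IsSubring.nil C-sub)

  ∂-jets : ∀ n {g} → jets n g → jets (suc n) (∂ g)
  ∂-jets zero    c = Polynomials.resp 1 (sym (∂-const c)) (Polynomials.nil 1)
  ∂-jets (suc n) (value ps all e) = Polynomials.resp (2 ℕ.+ n) (sym (∂-cong e)) (go ps all)
    where
    open Polynomials (2 ℕ.+ n)
    lift₁ : ∀ {g} → jets (suc n) g → jets (2 ℕ.+ n) g
    lift₁ = jets-suc {suc n}
    ev∈ : ∀ ps → All (jets n) ps → jets (suc n) (ev ps (y n))
    ev∈ ps all = value ps all refl
    go : ∀ ps → All (jets n) ps → jets (2 ℕ.+ n) (∂ (ev ps (y n)))
    go []       _       = resp (sym ∂-0) nil
    go (p ∷ ps) (j ∷ js) = resp (sym (trans (∂-+ _ _) (+-congˡ (∂-* _ _))))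
      (add (lift₁ (∂-jets n j))
        (add (mul (resp (sym (∂-y n)) (y∈jets (suc n))) (lift₁ (ev∈ ps js)))
             (mul (lift₁ (y∈jets n)) (go ps js))))

  -- Solving ∂g · b + g · ∂b = ∂a for ∂g.

  ∂-J : ∀ {n g} → J n g → J (suc n) (∂ g)
  ∂-J {n} {g} G@(a , b , sa , sb , b≉0 , gb≈a) =
    div (jets⊆J {suc n} (jets-suc {n} sb)) b≉0
      (sub (jets⊆J {suc n} (∂-jets n sa)) (mul (J-suc {n} G) (jets⊆J {suc n} (∂-jets n sb)))) (begin
        ∂ g * b
          ≈⟨ solve 2 (λ u v → u := (u :+ v) :- v) refl _ _ ⟩
        (∂ g * b + g * ∂ b) - g * ∂ b
          ≈⟨ +-congʳ (∂-* g b) ⟨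
        ∂ (g * b) - g * ∂ b
          ≈⟨ +-congʳ (∂-cong gb≈a) ⟩
        ∂ a - g * ∂ b ∎)
    where open J (suc n)

  ∂-J-y : ∀ {n} → J n (y n) → J (suc n) (y (suc n))
  ∂-J-y {n} j = J.resp (suc n) (∂-y n) (∂-J {n} j)

  -- If `ps` lists the coefficients of P, the result lists those of x¹⁻ᵏ (xᵏ P)′. The offset `k` is
  -- the exponent already passed in the recursion along the list.
  derivative-from : ℕ → List Carrier → List Carrier
  derivative-from k []       = []
  derivative-from k (p ∷ ps) = k · p ∷ derivative-from (suc k) ps

  derivative : List Carrier → List Carrier
  derivative []       = []
  derivative (p ∷ ps) = derivative-from 1 ps

  length-derivative-from : ∀ k ps → length (derivative-from k ps) ≡ length ps
  length-derivative-from k []       = ≡.refl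
  length-derivative-from k (p ∷ ps) = ≡.cong suc (length-derivative-from (suc k) ps)

  ev-derivative-from : ∀ k ps x →
    ev (derivative-from (suc k) ps) x ≈ ev ps x + ev (derivative-from k ps) x
  ev-derivative-from k []       x = sym (+-identityˡ _)
  ev-derivative-from k (p ∷ ps) x = begin
    (p + k · p) + x * ev (derivative-from (2 ℕ.+ k) ps) x
      ≈⟨ +-congˡ (*-congˡ (ev-derivative-from (suc k) ps x)) ⟩
    (p + k · p) + x * (ev ps x + ev (derivative-from (suc k) ps) x)
      ≈⟨ solve 5 (λ p kp x a b → (p :+ kp) :+ x :* (a :+ b) := (p :+ x :* a) :+ (kp :+ x :* b))
           refl p (k · p) x _ _ ⟩
    (p + x * ev ps x) + (k · p + x * ev (derivative-from (suc k) ps) x) ∎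

  ev-derivative-∷ : ∀ p ps x → ev (derivative (p ∷ ps)) x ≈ ev ps x + x * ev (derivative ps) x
  ev-derivative-∷ p []       x = sym (trans (+-identityˡ _) (zeroʳ x))
  ev-derivative-∷ p (q ∷ ps) x = begin
    (q + 0#) + x * ev (derivative-from 2 ps) x
      ≈⟨ +-cong (+-identityʳ q) (*-congˡ (ev-derivative-from 1 ps x)) ⟩
    q + x * (ev ps x + ev (derivative-from 1 ps) x)
      ≈⟨ solve 4 (λ q x a b → q :+ x :* (a :+ b) := (q :+ x :* a) :+ x :* b) refl q x _ _ ⟩
    (q + x * ev ps x) + x * ev (derivative-from 1 ps) x ∎

  derivative-from-All : ∀ {S} → IsSubring S → ∀ k {ps} → All S ps → All S (derivative-from k ps)
  derivative-from-All s k []       = []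
  derivative-from-All {S} s k (p ∷ ps) = multiple k ∷ derivative-from-All s (suc k) ps
    where
    multiple : ∀ k → S (k · _)
    multiple zero    = IsSubring.nil s
    multiple (suc k) = IsSubring.add s p (multiple k)

  derivative-All : ∀ {S} → IsSubring S → ∀ {ps} → All S ps → All S (derivative ps)
  derivative-All s []       = []
  derivative-All s (p ∷ ps) = derivative-from-All s 1 ps

  -- Characteristic zero enters here. The offset `suc k` keeps every multiplier nonzero; taken from
  -- 1 on, the list says that a polynomial with zero derivative is constant.
  derivative-from-≈0 : ∀ k ps → All (_≈ 0#) (derivative-from (suc k) ps) → All (_≈ 0#) ps
  derivative-from-≈0 k []       []       = []
  derivative-from-≈0 k (p ∷ ps) (e ∷ es) = torsion-free k e ∷ derivative-from-≈0 (suc k) ps es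

  ev-≈0 : ∀ {ps x} → All (_≈ 0#) ps → ev ps x ≈ 0#
  ev-≈0 []                 = refl
  ev-≈0 {_} {x} (e ∷ es) = trans (+-cong e (trans (*-congˡ (ev-≈0 es)) (zeroʳ x))) (+-identityʳ 0#)

  ev-∷-≈ : ∀ {p ps x} → All (_≈ 0#) ps → ev (p ∷ ps) x ≈ p
  ev-∷-≈ {p} {x = x} es = trans (+-congˡ (trans (*-congˡ (ev-≈0 es)) (zeroʳ x))) (+-identityʳ p)

  -- The total derivative of a polynomial in y⁽ⁿ⁾ is linear in y⁽ⁿ⁺¹⁾. Its slope is the formal
  -- derivative, and `r` collects the derivatives of the coefficients, which reach no further than
  -- y⁽ⁿ⁾.
  ∂-ev : ∀ n ps → All (jets n) ps →
         ∃[ r ] jets (suc n) r × ∂ (ev ps (y n)) ≈ ev (derivative ps) (y n) * y (suc n) + r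
  ∂-ev n []       _        = 0# , Polynomials.nil (suc n)
    , trans ∂-0 (sym (trans (+-congʳ (zeroˡ _)) (+-identityʳ 0#)))
  ∂-ev n (p ∷ ps) (j ∷ js) with ∂-ev n ps js
  ... | r , jr , e = ∂ p + y n * r
    , Polynomials.add (suc n) (∂-jets n j) (Polynomials.mul (suc n) (y∈jets n) jr)
    , (begin
      ∂ (p + y n * E)
        ≈⟨ trans (∂-+ _ _) (+-congˡ (∂-* _ _)) ⟩
      ∂ p + (∂ (y n) * E + y n * ∂ E)
        ≈⟨ +-congˡ (+-cong (*-congʳ (∂-y n)) (*-congˡ e)) ⟩
      ∂ p + (y (suc n) * E + y n * (E′ * y (suc n) + r))
        ≈⟨ solve 6 (λ p y y′ E E′ r → p :+ (y′ :* E :+ y :* (E′ :* y′ :+ r))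
                     := (E :+ y :* E′) :* y′ :+ (p :+ y :* r)) refl (∂ p) (y n) (y (suc n)) E E′ r ⟩
      (E + y n * E′) * y (suc n) + (∂ p + y n * r)
        ≈⟨ +-congʳ (*-congʳ (ev-derivative-∷ p ps (y n))) ⟨
      ev (derivative (p ∷ ps)) (y n) * y (suc n) + (∂ p + y n * r) ∎)
    where
    E = ev ps (y n)
    E′ = ev (derivative ps) (y n)

  -- Unless y⁽ⁿ⁺¹⁾ is rational in the lower jets, y⁽ⁿ⁾ is transcendental over them,
  -- and an element is free of y⁽ⁿ⁾ as soon as its derivative is free of y⁽ⁿ⁺¹⁾.

  module _ {n} (irrational : ¬ J (suc n) (y (suc n))) where

    private
      open J (suc n)

      isolate : ∀ {a d r x} → a ≈ 0# → a ≈ d * x + r → - r ≈ d * x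
      isolate {a} {d} {r} {x} a≈0 e = begin
        - r                ≈⟨ +-identityˡ _ ⟨
        0# - r             ≈⟨ +-congʳ a≈0 ⟨
        a - r              ≈⟨ +-congʳ e ⟩
        (d * x + r) - r    ≈⟨ solve 2 (λ u v → (u :+ v) :- v := u) refl _ r ⟩
        d * x              ∎

      isolate-quotient : ∀ {p r v c q t x} → p * x + r ≈ v + c * (q * x + t) →
                         (r - v) - c * t ≈ (c * q - p) * x
      isolate-quotient {p} {r} {v} {c} {q} {t} {x} e = begin
        (r - v) - c * t
          ≈⟨ solve 4 (λ u r v w → (r :- v) :- w := ((u :+ r) :- v) :- (u :+ w)) refl (p * x) r v _ ⟩
        ((p * x + r) - v) - (p * x + c * t)
          ≈⟨ +-congʳ (+-congʳ e) ⟩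
        ((v + c * (q * x + t)) - v) - (p * x + c * t)
          ≈⟨ solve 6 (λ c v q p x t → ((v :+ c :* (q :* x :+ t)) :- v) :- (p :* x :+ c :* t)
                       := (c :* q :- p) :* x) refl c v q p x t ⟩
        (c * q - p) * x ∎

      -- The hypothesis `irrational` acts through this alone: a nonzero `u` could be divided out,
      -- which would put y⁽ⁿ⁺¹⁾ into the field.
      coefficient-≈0 : ∀ {u} → J (suc n) u → J (suc n) (u * y (suc n)) → u ≈ 0#
      coefficient-≈0 {u} Ju Juy with em {P = u ≈ 0#}
      ... | yes u≈0 = u≈0
      ... | no  u≉0 = ⊥-elim (irrational (div Ju u≉0 Juy (*-comm _ _)))

      ev∈J : ∀ {ps} → All (jets n) ps → J (suc n) (ev ps (y n))
      ev∈J {ps} js = jets⊆J {suc n} (value ps js refl)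

      derivative∈J : ∀ {ps} → All (jets n) ps → J (suc n) (ev (derivative ps) (y n))
      derivative∈J js = ev∈J (derivative-All (jets-isSubring n) js)

    -- Differentiating P(y⁽ⁿ⁾) = 0 and comparing coefficients of y⁽ⁿ⁺¹⁾ leaves the shorter relation
    -- P′(y⁽ⁿ⁾) = 0. By recursion P′ has zero coefficients, hence so has P apart from its constant
    -- term, which then vanishes too. `len` bounds the length because `derivative` is not a sublist.
    ev≈0⇒All≈0 : ∀ len ps → length ps ℕ.≤ len → All (jets n) ps → ev ps (y n) ≈ 0# →
                 All (_≈ 0#) ps
    ev≈0⇒All≈0 len []       _ _ _ = []
    ev≈0⇒All≈0 (suc len) (p ∷ ps) (s≤s l) (j ∷ js) e = trans (sym (ev-∷-≈ ps≈0)) e ∷ ps≈0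
      where
      E′ = ev (derivative (p ∷ ps)) (y n)
      Dy∈J : J (suc n) (E′ * y (suc n))
      Dy∈J = let r , jr , e′ = ∂-ev n (p ∷ ps) (j ∷ js) in resp
        (isolate (trans (∂-cong e) ∂-0) e′)
        (neg (jets⊆J {suc n} jr))
      ps≈0 : All (_≈ 0#) ps
      ps≈0 = derivative-from-≈0 0 ps (ev≈0⇒All≈0 len (derivative-from 1 ps)
        (≡.subst (ℕ._≤ len) (≡.sym (length-derivative-from 1 ps)) l)
        (derivative-from-All (jets-isSubring n) 1 js)
        (coefficient-≈0 (derivative∈J (j ∷ js)) Dy∈J))

    private
      tail-≈0 : ∀ {ps} → All (jets n) ps → ev (derivative ps) (y n) ≈ 0# →
                ∃[ p ] jets n p × ev ps (y n) ≈ p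
      tail-≈0 []       _ = 0# , Polynomials.nil n , refl
      tail-≈0 {p ∷ ps} (j ∷ js) e = p , j , ev-∷-≈ (derivative-from-≈0 0 ps
        (ev≈0⇒All≈0 (length (derivative-from 1 ps)) _ ℕₚ.≤-refl
          (derivative-from-All (jets-isSubring n) 1 js) e))

      -- Differentiating c Q = P and comparing coefficients of y⁽ⁿ⁺¹⁾ gives c Q′ = P′, so P and Q
      -- may be replaced by their derivatives as long as Q′ is nonzero. Once Q′ vanishes, so does
      -- P′, and by transcendence of y⁽ⁿ⁾ both P and Q are free of it.
      descend′ : ∀ len {c ps qs} → length qs ℕ.≤ len → All (jets n) ps → All (jets n) qs →
                 ¬ ev qs (y n) ≈ 0# → c * ev qs (y n) ≈ ev ps (y n) →
                 J (suc n) c → J (suc n) (∂ c) → J n c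
      descend′ len {qs = []} _ _ _ Q≉0 _ _ _ = ⊥-elim (Q≉0 refl)
      descend′ (suc len) {c} {ps} {q ∷ qs} (s≤s l) js ks Q≉0 cQ≈P Jc J∂c = conclude em
        where
        P = ev ps (y n)
        Q = ev (q ∷ qs) (y n)
        P′ = ev (derivative ps) (y n)
        Q′ = ev (derivative (q ∷ qs)) (y n)

        JQ′y : J (suc n) ((c * Q′ - P′) * y (suc n))
        JQ′y = resp
          (isolate-quotient lhs)
          (sub (sub (jets⊆J {suc n} jr) (mul J∂c (ev∈J ks))) (mul Jc (jets⊆J {suc n} jt)))
          where
          r = proj₁ (∂-ev n ps js)
          jr = proj₁ (proj₂ (∂-ev n ps js))
          ∂P = proj₂ (proj₂ (∂-ev n ps js))
          t = proj₁ (∂-ev n (q ∷ qs) ks)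
          jt = proj₁ (proj₂ (∂-ev n (q ∷ qs) ks))
          ∂Q = proj₂ (proj₂ (∂-ev n (q ∷ qs) ks))
          lhs : P′ * y (suc n) + r ≈ ∂ c * Q + c * (Q′ * y (suc n) + t)
          lhs = begin
            P′ * y (suc n) + r                   ≈⟨ ∂P ⟨
            ∂ P                                  ≈⟨ ∂-cong cQ≈P ⟨
            ∂ (c * Q)                            ≈⟨ ∂-* c Q ⟩
            ∂ c * Q + c * ∂ Q                    ≈⟨ +-congˡ (*-congˡ ∂Q) ⟩
            ∂ c * Q + c * (Q′ * y (suc n) + t)   ∎

        cQ′≈P′ : c * Q′ ≈ P′
        cQ′≈P′ = x∙y⁻¹≈ε⇒x≈y _ _
          (coefficient-≈0 (sub (mul Jc (derivative∈J ks)) (derivative∈J js)) JQ′y)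

        conclude : Dec (Q′ ≈ 0#) → J n c
        conclude (no Q′≉0) = descend′ len
          (≡.subst (ℕ._≤ len) (≡.sym (length-derivative-from 1 qs)) l)
          (derivative-All (jets-isSubring n) js) (derivative-All (jets-isSubring n) ks)
          Q′≉0 cQ′≈P′ Jc J∂c
        conclude (yes Q′≈0) =
          let p₀ , jp₀ , P≈p₀ = tail-≈0 js (trans (sym cQ′≈P′) (trans (*-congˡ Q′≈0) (zeroʳ c)))
              q₀ , jq₀ , Q≈q₀ = tail-≈0 ks Q′≈0
          in p₀ , q₀ , jp₀ , jq₀ , (λ q₀≈0 → Q≉0 (trans Q≈q₀ q₀≈0))
             , trans (*-congˡ (sym Q≈q₀)) (trans cQ≈P P≈p₀)

    descend : ∀ {c} → J (suc n) c → J (suc n) (∂ c) → J n c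
    descend Jc@(a , b , value ps js P , value qs ks Q , b≉0 , e) =
      descend′ (length qs) ℕₚ.≤-refl js ks (λ Q≈0 → b≉0 (trans Q Q≈0))
        (trans (*-congˡ (sym Q)) (trans e P)) Jc

-- The fraction field of an integral domain and its derivation

record IntegralDomain : Set₁ where
  field
    ring : CommutativeRing 0ℓ 0ℓ
  open CommutativeRing ring public hiding (ring)
  field
    1≉0    : ¬ 1# ≈ 0#
    domain : ∀ {a b} → a * b ≈ 0# → ¬ a ≈ 0# → b ≈ 0#

module Fractions (A : IntegralDomain) where

  open IntegralDomain A
  open Subrings ring using (*-≉0; *-cancelˡ)
  open RingProperties (CommutativeRing.ring ring) using (-‿distribˡ-*)
  open IntegerSolver ring
  open ≈-Reasoning setoid

  record Fraction : Set where
    constructor _÷_∣_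
    field
      num den : Carrier
      den≉0   : ¬ den ≈ 0#

  open Fraction public

  infix 4 _≃_

  record _≃_ (x y : Fraction) : Set where
    constructor cross
    field
      crossed : num x * den y ≈ num y * den x

  open _≃_ public

  private
    ≃-refl : ∀ {x} → x ≃ x
    ≃-refl = cross refl

    ≃-sym : ∀ {x y} → x ≃ y → y ≃ x
    ≃-sym (cross e) = cross (sym e)

    ≃-trans : ∀ {x y z} → x ≃ y → y ≃ z → x ≃ z
    ≃-trans {a ÷ b ∣ _} {c ÷ d ∣ d≉0} {e ÷ f ∣ _} (cross p) (cross q) =
      cross (*-cancelˡ 1≉0 domain d≉0 (begin
        d * (a * f)   ≈⟨ solve 3 (λ d a f → d :* (a :* f) := (a :* d) :* f) refl d a f ⟩
        (a * d) * f   ≈⟨ *-congʳ p ⟩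
        (c * b) * f   ≈⟨ solve 3 (λ c b f → (c :* b) :* f := (c :* f) :* b) refl c b f ⟩
        (c * f) * b   ≈⟨ *-congʳ q ⟩
        (e * d) * b   ≈⟨ solve 3 (λ e d b → (e :* d) :* b := d :* (e :* b)) refl e d b ⟩
        d * (e * b)   ∎))

    -- The two sides of a law of fractions often differ by a common factor `k` of numerator and
    -- denominator, as for distributivity and the product rule.
    expand : ∀ {x y} k → k * num x ≈ num y → k * den x ≈ den y → x ≃ y
    expand {a ÷ b ∣ _} {c ÷ d ∣ _} k p q = cross (begin
      a * d         ≈⟨ *-congˡ q ⟨
      a * (k * b)   ≈⟨ solve 3 (λ a k b → a :* (k :* b) := (k :* a) :* b) refl a k b ⟩
      (k * a) * b   ≈⟨ *-congʳ p ⟩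
      c * b         ∎)

    componentwise : ∀ {x y} → num x ≈ num y → den x ≈ den y → x ≃ y
    componentwise p q = expand 1# (trans (*-identityˡ _) p) (trans (*-identityˡ _) q)

    infixl 6 _⊕_
    infixl 7 _⊗_

    _⊕_ _⊗_ : Fraction → Fraction → Fraction
    (a ÷ b ∣ b≉0) ⊕ (c ÷ d ∣ d≉0) = (a * d + c * b) ÷ b * d ∣ *-≉0 1≉0 domain b≉0 d≉0
    (a ÷ b ∣ b≉0) ⊗ (c ÷ d ∣ d≉0) = (a * c) ÷ b * d ∣ *-≉0 1≉0 domain b≉0 d≉0

    ⊖_ : Fraction → Fraction
    ⊖ (a ÷ b ∣ b≉0) = (- a) ÷ b ∣ b≉0

    ⊕-comm : ∀ x y → x ⊕ y ≃ y ⊕ x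
    ⊕-comm (a ÷ b ∣ _) (c ÷ d ∣ _) = componentwise (+-comm _ _) (*-comm _ _)

    ⊗-comm : ∀ x y → x ⊗ y ≃ y ⊗ x
    ⊗-comm (a ÷ b ∣ _) (c ÷ d ∣ _) = componentwise (*-comm _ _) (*-comm _ _)

    ⊕-congʳ : ∀ {x x′} y → x ≃ x′ → x ⊕ y ≃ x′ ⊕ y
    ⊕-congʳ {a ÷ b ∣ _} {a′ ÷ b′ ∣ _} (c ÷ d ∣ _) (cross p) = cross (begin
      (a * d + c * b) * (b′ * d)
        ≈⟨ solve 5 (λ a b b′ c d → (a :* d :+ c :* b) :* (b′ :* d)
             := (a :* b′) :* (d :* d) :+ c :* b :* b′ :* d) refl a b b′ c d ⟩
      (a * b′) * (d * d) + c * b * b′ * d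
        ≈⟨ +-congʳ (*-congʳ p) ⟩
      (a′ * b) * (d * d) + c * b * b′ * d
        ≈⟨ solve 5 (λ a′ b b′ c d → (a′ :* b) :* (d :* d) :+ c :* b :* b′ :* d
             := (a′ :* d :+ c :* b′) :* (b :* d)) refl a′ b b′ c d ⟩
      (a′ * d + c * b′) * (b * d) ∎)

    ⊗-congʳ : ∀ {x x′} y → x ≃ x′ → x ⊗ y ≃ x′ ⊗ y
    ⊗-congʳ {a ÷ b ∣ _} {a′ ÷ b′ ∣ _} (c ÷ d ∣ _) (cross p) = cross (begin
      (a * c) * (b′ * d)
        ≈⟨ solve 4 (λ a b′ c d → (a :* c) :* (b′ :* d) := (a :* b′) :* (c :* d)) refl a b′ c d ⟩
      (a * b′) * (c * d)
        ≈⟨ *-congʳ p ⟩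
      (a′ * b) * (c * d)
        ≈⟨ solve 4 (λ a′ b c d → (a′ :* b) :* (c :* d) := (a′ :* c) :* (b :* d)) refl a′ b c d ⟩
      (a′ * c) * (b * d) ∎)

    ⊕-cong : ∀ {x x′ y y′} → x ≃ x′ → y ≃ y′ → x ⊕ y ≃ x′ ⊕ y′
    ⊕-cong {x} {x′} {y} {y′} p q = ≃-trans (⊕-congʳ y p)
      (≃-trans (⊕-comm x′ y) (≃-trans (⊕-congʳ x′ q) (⊕-comm y′ x′)))

    ⊗-cong : ∀ {x x′ y y′} → x ≃ x′ → y ≃ y′ → x ⊗ y ≃ x′ ⊗ y′
    ⊗-cong {x} {x′} {y} {y′} p q = ≃-trans (⊗-congʳ y p)
      (≃-trans (⊗-comm x′ y) (≃-trans (⊗-congʳ x′ q) (⊗-comm y′ x′)))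

    0ᶠ 1ᶠ : Fraction
    0ᶠ = 0# ÷ 1# ∣ 1≉0
    1ᶠ = 1# ÷ 1# ∣ 1≉0

    ⊕-identityˡ : ∀ x → 0ᶠ ⊕ x ≃ x
    ⊕-identityˡ (a ÷ b ∣ _) = componentwise
      (trans (+-cong (zeroˡ b) (*-identityʳ a)) (+-identityˡ a)) (*-identityˡ b)

    ⊗-identityˡ : ∀ x → 1ᶠ ⊗ x ≃ x
    ⊗-identityˡ (a ÷ b ∣ _) = componentwise (*-identityˡ a) (*-identityˡ b)

    ⊕-inverseˡ : ∀ x → (⊖ x) ⊕ x ≃ 0ᶠ
    ⊕-inverseˡ (a ÷ b ∣ _) = cross
      (solve 2 (λ a b → ((:- a) :* b :+ a :* b) :* con (+ 1) := con (+ 0) :* (b :* b)) refl a b)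

    ⊗-distribˡ-⊕ : ∀ x y z → x ⊗ (y ⊕ z) ≃ x ⊗ y ⊕ x ⊗ z
    ⊗-distribˡ-⊕ (a ÷ b ∣ _) (c ÷ d ∣ _) (e ÷ f ∣ _) = expand b
      (solve 6 (λ a b c d e f → b :* (a :* (c :* f :+ e :* d))
         := (a :* c) :* (b :* f) :+ (a :* e) :* (b :* d)) refl a b c d e f)
      (solve 3 (λ b d f → b :* (b :* (d :* f)) := (b :* d) :* (b :* f)) refl b d f)

  fractionField : CommutativeRing 0ℓ 0ℓ
  fractionField = record
    { Carrier = Fraction
    ; _≈_     = _≃_
    ; _+_     = _⊕_
    ; _*_     = _⊗_
    ; -_      = ⊖_
    ; 0#      = 0ᶠ
    ; 1#      = 1ᶠ
    ; isCommutativeRing = record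
      { isRing = record
        { +-isAbelianGroup = record
          { isGroup = record
            { isMonoid = record
              { isSemigroup = record
                { isMagma = record
                  { isEquivalence = record { refl = ≃-refl ; sym = ≃-sym ; trans = ≃-trans }
                  ; ∙-cong = ⊕-cong
                  }
                ; assoc = λ { (a ÷ b ∣ _) (c ÷ d ∣ _) (e ÷ f ∣ _) → componentwise
                    (solve 6 (λ a b c d e f → (a :* d :+ c :* b) :* f :+ e :* (b :* d)
                       := a :* (d :* f) :+ (c :* f :+ e :* d) :* b) refl a b c d e f)
                    (*-assoc b d f) }
                }
              ; identity = ⊕-identityˡ , λ x → ≃-trans (⊕-comm x 0ᶠ) (⊕-identityˡ x)
              }
            ; inverse = ⊕-inverseˡ , λ x → ≃-trans (⊕-comm x (⊖ x)) (⊕-inverseˡ x)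
            ; ⁻¹-cong = λ (cross p) → cross
                (trans (sym (-‿distribˡ-* _ _)) (trans (-‿cong p) (-‿distribˡ-* _ _)))
            }
          ; comm = ⊕-comm
          }
        ; *-cong = ⊗-cong
        ; *-assoc = λ { (a ÷ b ∣ _) (c ÷ d ∣ _) (e ÷ f ∣ _) →
            componentwise (*-assoc a c e) (*-assoc b d f) }
        ; *-identity = ⊗-identityˡ , λ x → ≃-trans (⊗-comm x 1ᶠ) (⊗-identityˡ x)
        ; distrib = ⊗-distribˡ-⊕
                  , λ x y z → ≃-trans (⊗-comm (y ⊕ z) x)
                      (≃-trans (⊗-distribˡ-⊕ x y z) (⊕-cong (⊗-comm x y) (⊗-comm x z)))
        }
      ; *-comm = ⊗-comm
      }
    }

  private
    module Q = CommutativeRing fractionField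
    module A× = RawMonoidDefs +-rawMonoid
    module Q× = RawMonoidDefs Q.+-rawMonoid

  ι : Carrier → Fraction
  ι a = a ÷ 1# ∣ 1≉0

  ι-cong : ∀ {a b} → a ≈ b → ι a Q.≈ ι b
  ι-cong e = componentwise e refl

  ι-injective : ∀ {a b} → ι a Q.≈ ι b → a ≈ b
  ι-injective (cross e) = trans (sym (*-identityʳ _)) (trans e (*-identityʳ _))

  ι-+ : ∀ a b → ι (a + b) Q.≈ ι a Q.+ ι b
  ι-+ a b = componentwise (sym (+-cong (*-identityʳ a) (*-identityʳ b))) (sym (*-identityʳ 1#))

  ι-* : ∀ a b → ι (a * b) Q.≈ ι a Q.* ι b
  ι-* a b = componentwise refl (sym (*-identityʳ 1#))

  num≈0⇒≃0 : ∀ {x} → num x ≈ 0# → x Q.≈ Q.0#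
  num≈0⇒≃0 {a ÷ b ∣ _} e = cross (trans (*-congʳ e) (trans (zeroˡ _) (sym (zeroˡ b))))

  ≃0⇒num≈0 : ∀ {x} → x Q.≈ Q.0# → num x ≈ 0#
  ≃0⇒num≈0 {a ÷ b ∣ _} (cross e) = trans (sym (*-identityʳ a)) (trans e (zeroˡ b))

  1≄0 : ¬ Q.1# Q.≈ Q.0#
  1≄0 e = 1≉0 (≃0⇒num≈0 e)

  inverse : ∀ x → ¬ x Q.≈ Q.0# → ∃[ x⁻¹ ] x⁻¹ Q.* x Q.≈ Q.1#
  inverse (a ÷ b ∣ b≉0) x≄0 = (b ÷ a ∣ λ a≈0 → x≄0 (num≈0⇒≃0 a≈0))
    , cross (solve 2 (λ a b → (b :* a) :* con (+ 1) := con (+ 1) :* (a :* b)) refl a b)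

  fraction-torsion-free : (∀ n {a} → suc n A×.× a ≈ 0# → a ≈ 0#) →
                          ∀ n {x} → suc n Q×.× x Q.≈ Q.0# → x Q.≈ Q.0#
  fraction-torsion-free torsion-free n {x@(a ÷ b ∣ b≉0)} e =
    num≈0⇒≃0 (torsion-free n (≃0⇒num≈0 {(suc n A×.× a) ÷ b ∣ b≉0} (Q.trans (Q.sym (multiple (suc n))) e)))
    where
    multiple : ∀ n → n Q×.× x Q.≈ ((n A×.× a) ÷ b ∣ b≉0)
    multiple zero    = Q.sym (num≈0⇒≃0 refl)
    multiple (suc n) = Q.trans (Q.+-congˡ {x} (multiple n)) (≃-sym (expand b
      (solve 3 (λ a n b → b :* (a :+ n) := a :* b :+ n :* b) refl a (n A×.× a) b) refl))

  module Derivation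
    (∂ : Carrier → Carrier)
    (∂-cong : ∀ {x y} → x ≈ y → ∂ x ≈ ∂ y)
    (∂-+ : ∀ x y → ∂ (x + y) ≈ ∂ x + ∂ y)
    (∂-* : ∀ x y → ∂ (x * y) ≈ ∂ x * y + x * ∂ y)
    where

    ∂ᶠ : Fraction → Fraction
    ∂ᶠ (a ÷ b ∣ b≉0) = (∂ a * b - a * ∂ b) ÷ b * b ∣ *-≉0 1≉0 domain b≉0 b≉0

    ∂ᶠ-cong : ∀ {x y} → x Q.≈ y → ∂ᶠ x Q.≈ ∂ᶠ y
    ∂ᶠ-cong {a ÷ b ∣ _} {a′ ÷ b′ ∣ _} (cross p) = cross (begin
      (∂ a * b - a * ∂ b) * (b′ * b′)
        ≈⟨ solve 6 (λ da a db b db′ b′ → (da :* b :- a :* db) :* (b′ :* b′)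
             := b :* b′ :* (da :* b′ :+ a :* db′) :- b :* db′ :* (a :* b′) :- db :* b′ :* (a :* b′))
             refl (∂ a) a (∂ b) b (∂ b′) b′ ⟩
      b * b′ * (∂ a * b′ + a * ∂ b′) - b * ∂ b′ * (a * b′) - ∂ b * b′ * (a * b′)
        ≈⟨ +-cong (+-cong (*-congˡ ∂p) (-‿cong (*-congˡ p))) (-‿cong (*-congˡ p)) ⟩
      b * b′ * (∂ a′ * b + a′ * ∂ b) - b * ∂ b′ * (a′ * b) - ∂ b * b′ * (a′ * b)
        ≈⟨ solve 6 (λ da′ a′ db b db′ b′ →
             b :* b′ :* (da′ :* b :+ a′ :* db) :- b :* db′ :* (a′ :* b) :- db :* b′ :* (a′ :* b)
             := (da′ :* b′ :- a′ :* db′) :* (b :* b)) refl (∂ a′) a′ (∂ b) b (∂ b′) b′ ⟩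
      (∂ a′ * b′ - a′ * ∂ b′) * (b * b) ∎)
      where
      ∂p : ∂ a * b′ + a * ∂ b′ ≈ ∂ a′ * b + a′ * ∂ b
      ∂p = trans (sym (∂-* a b′)) (trans (∂-cong p) (∂-* a′ b))

    ∂ᶠ-+ : ∀ x y → ∂ᶠ (x Q.+ y) Q.≈ ∂ᶠ x Q.+ ∂ᶠ y
    ∂ᶠ-+ (a ÷ b ∣ _) (c ÷ d ∣ _) = componentwise
      (begin
        ∂ (a * d + c * b) * (b * d) - (a * d + c * b) * ∂ (b * d)
          ≈⟨ +-cong (*-congʳ (trans (∂-+ _ _) (+-cong (∂-* a d) (∂-* c b))))
                    (-‿cong (*-congˡ (∂-* b d))) ⟩
        ((∂ a * d + a * ∂ d) + (∂ c * b + c * ∂ b)) * (b * d)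
          - (a * d + c * b) * (∂ b * d + b * ∂ d)
          ≈⟨ solve 8 (λ a b c d a′ b′ c′ d′ →
               ((a′ :* d :+ a :* d′) :+ (c′ :* b :+ c :* b′)) :* (b :* d)
                 :- (a :* d :+ c :* b) :* (b′ :* d :+ b :* d′)
               := (a′ :* b :- a :* b′) :* (d :* d) :+ (c′ :* d :- c :* d′) :* (b :* b))
               refl a b c d (∂ a) (∂ b) (∂ c) (∂ d) ⟩
        (∂ a * b - a * ∂ b) * (d * d) + (∂ c * d - c * ∂ d) * (b * b) ∎)
      (solve 2 (λ b d → (b :* d) :* (b :* d) := (b :* b) :* (d :* d)) refl b d)

    ∂ᶠ-* : ∀ x y → ∂ᶠ (x Q.* y) Q.≈ ∂ᶠ x Q.* y Q.+ x Q.* ∂ᶠ y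
    ∂ᶠ-* (a ÷ b ∣ _) (c ÷ d ∣ _) = expand (b * d)
      (begin
        (b * d) * (∂ (a * c) * (b * d) - (a * c) * ∂ (b * d))
          ≈⟨ *-congˡ (+-cong (*-congʳ (∂-* a c)) (-‿cong (*-congˡ (∂-* b d)))) ⟩
        (b * d) * ((∂ a * c + a * ∂ c) * (b * d) - (a * c) * (∂ b * d + b * ∂ d))
          ≈⟨ solve 8 (λ a b c d a′ b′ c′ d′ →
               (b :* d) :* ((a′ :* c :+ a :* c′) :* (b :* d) :- (a :* c) :* (b′ :* d :+ b :* d′))
               := ((a′ :* b :- a :* b′) :* c) :* (b :* (d :* d))
                  :+ (a :* (c′ :* d :- c :* d′)) :* ((b :* b) :* d))
               refl a b c d (∂ a) (∂ b) (∂ c) (∂ d) ⟩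
        ((∂ a * b - a * ∂ b) * c) * (b * (d * d)) + (a * (∂ c * d - c * ∂ d)) * ((b * b) * d) ∎)
      (solve 2 (λ b d → (b :* d) :* ((b :* d) :* (b :* d)) := ((b :* b) :* d) :* (b :* (d :* d)))
        refl b d)

    ∂ᶠ-ι : ∀ a → ∂ᶠ (ι a) Q.≈ ι (∂ a)
    ∂ᶠ-ι a = Q.sym (expand 1# (trans (*-identityˡ _) (sym num≈)) refl)
      where
      ∂1≈0 : ∂ 1# ≈ 0#
      ∂1≈0 = begin
        ∂ 1#                                ≈⟨ solve 1 (λ u → u := (u :* con (+ 1) :+ con (+ 1) :* u) :- u)
                                                 refl (∂ 1#) ⟩
        (∂ 1# * 1# + 1# * ∂ 1#) - ∂ 1#      ≈⟨ +-congʳ (trans (∂-cong (sym (*-identityˡ 1#))) (∂-* 1# 1#)) ⟨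
        ∂ 1# - ∂ 1#                         ≈⟨ -‿inverseʳ _ ⟩
        0#                                  ∎
      num≈ : ∂ a * 1# - a * ∂ 1# ≈ ∂ a
      num≈ = begin
        ∂ a * 1# - a * ∂ 1#  ≈⟨ +-congˡ (-‿cong (*-congˡ ∂1≈0)) ⟩
        ∂ a * 1# - a * 0#    ≈⟨ solve 2 (λ u a → u :* con (+ 1) :- a :* con (+ 0) := u) refl (∂ a) a ⟩
        ∂ a                  ∎

-- Linear spans with a distinguished generator

module Spans
  (em : ExcludedMiddle 0ℓ) (D : DifferentialField)
  (b₀ : DifferentialField.Carrier D)
  (b₀≉0 : ¬ DifferentialField._≈_ D b₀ (DifferentialField.0# D))
  where

  open DifferentialField D
  open Subrings ring
  open IntegerSolver ring
  open RingProperties (CommutativeRing.ring ring) using (x∙y⁻¹≈ε⇒x≈y)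
  open ≈-Reasoning setoid

  -- b₀ is a generator of every span: reduce drops one of the others.

  data Span (K : Carrier → Set) : List Carrier → Carrier → Set where
    base : ∀ {c x} → K c → x ≈ c * b₀ → Span K [] x
    step : ∀ {b B c x x′} → K c → Span K B x′ → x ≈ c * b + x′ → Span K (b ∷ B) x

  -- Every span contains b₀, which is nonzero, so this is linear independence of b₀ together with
  -- the list.
  Independent : (Carrier → Set) → List Carrier → Set
  Independent K []      = ⊤
  Independent K (b ∷ B) = ¬ Span K B b × Independent K B

  span-mono : ∀ {K L : Carrier → Set} → (∀ {c} → K c → L c) → ∀ {B x} → Span K B x → Span L B x
  span-mono K⊆L (base k e)   = base (K⊆L k) e
  span-mono K⊆L (step k s e) = step (K⊆L k) (span-mono K⊆L s) e

  module _ {K : Carrier → Set} (K-sub : IsSubfield K) where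

    open IsSubfield K-sub

    span-resp : ∀ {B x x′} → x ≈ x′ → Span K B x → Span K B x′
    span-resp e (base k e′)   = base k (trans (sym e) e′)
    span-resp e (step k s e′) = step k s (trans (sym e) e′)

    span-add : ∀ {B x x′} → Span K B x → Span K B x′ → Span K B (x + x′)
    span-add (base k e) (base k′ e′) = base (add k k′) (trans (+-cong e e′) (sym (distribʳ _ _ _)))
    span-add (step {b} {c = c} {x′ = u} k s e) (step {c = c′} {x′ = v} k′ s′ e′) =
      step (add k k′) (span-add s s′) (trans (+-cong e e′)
        (solve 5 (λ c c′ b u v → (c :* b :+ u) :+ (c′ :* b :+ v) := (c :+ c′) :* b :+ (u :+ v))
          refl c c′ b u v))

    span-scale : ∀ {B d x} → K d → Span K B x → Span K B (d * x)
    span-scale {d = d} h (base k e)   = base (mul h k) (trans (*-congˡ e) (sym (*-assoc _ _ _)))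
    span-scale {d = d} h (step {b} {c = c} {x′ = u} k s e) =
      step (mul h k) (span-scale h s) (trans (*-congˡ e)
        (solve 4 (λ d c b u → d :* (c :* b :+ u) := (d :* c) :* b :+ d :* u) refl d c b u))

    span-sub : ∀ {B x x′} → Span K B x → Span K B x′ → Span K B (x - x′)
    span-sub {x = x} {x′} s s′ = span-resp
      (solve 2 (λ u v → u :+ (:- con (+ 1)) :* v := u :- v) refl x x′)
      (span-add s (span-scale (neg one) s′))

    span-cons : ∀ {b B x} → Span K B x → Span K (b ∷ B) x
    span-cons {b} {x = x} s = step nil s (sym (trans (+-congʳ (zeroˡ b)) (+-identityˡ x)))

    span-base : ∀ {c} B → K c → Span K B (c * b₀)
    span-base []      k = base k refl
    span-base (b ∷ B) k = span-cons (span-base B k)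

    span-zero : ∀ B → Span K B 0#
    span-zero B = span-resp (zeroˡ b₀) (span-base B nil)

    span-head : ∀ b B → Span K (b ∷ B) b
    span-head b B = step one (span-zero B)
      (solve 1 (λ b → b := con (+ 1) :* b :+ con (+ 0)) refl b)

    span-div : ∀ {B d x} → K d → ¬ d ≈ 0# → Span K B (d * x) → Span K B x
    span-div {d = d} {x} k d≉0 s =
      let d⁻¹ , e = inverse d d≉0
      in span-resp (trans (sym (*-assoc d⁻¹ d x)) (trans (*-congʳ e) (*-identityˡ x)))
           (span-scale (div k d≉0 one e) s)

    coefficients-unique : ∀ {b B c c′ x x′} → Independent K (b ∷ B) → K c → K c′ →
      Span K B x → Span K B x′ → c * b + x ≈ c′ * b + x′ → c ≈ c′ × x ≈ x′
    coefficients-unique {b} {B} {c} {c′} {x} {x′} (b∉ , _) k k′ s s′ e = go em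
      where
      difference : (c - c′) * b ≈ x′ - x
      difference = begin
        (c - c′) * b
          ≈⟨ solve 4 (λ c c′ b x → (c :- c′) :* b := (c :* b :+ x) :- (c′ :* b :+ x)) refl c c′ b x ⟩
        (c * b + x) - (c′ * b + x)
          ≈⟨ +-congʳ e ⟩
        (c′ * b + x′) - (c′ * b + x)
          ≈⟨ solve 3 (λ u x′ x → (u :+ x′) :- (u :+ x) := x′ :- x) refl _ x′ x ⟩
        x′ - x ∎
      go : Dec (c - c′ ≈ 0#) → c ≈ c′ × x ≈ x′
      go (no ≉0)  = ⊥-elim (b∉ (span-div (sub k k′) ≉0
        (span-resp (sym difference) (span-sub s′ s))))
      go (yes ≈0) = x∙y⁻¹≈ε⇒x≈y c c′ ≈0
        , sym (x∙y⁻¹≈ε⇒x≈y x′ x (trans (sym difference) (trans (*-congʳ ≈0) (zeroˡ b))))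

    base-coefficient-unique : ∀ {c c′} → c * b₀ ≈ c′ * b₀ → c ≈ c′
    base-coefficient-unique {c} {c′} e =
      let i , i*b₀≈1 = inverse b₀ b₀≉0
          through d = trans (solve 3 (λ d b i → (d :* b) :* i := d :* (i :* b)) refl d b₀ i)
                        (trans (*-congˡ i*b₀≈1) (*-identityʳ d))
      in trans (sym (through c)) (trans (*-congʳ e) (through c′))

    -- A generator that lies in the span of the later ones is replaced by its expression in them.
    -- Generators are only dropped and never altered, hence any property `P` of theirs survives.
    reduce : ∀ {P : Carrier → Set} B → All P B →
      Independent K B ⊎
      ∃[ B′ ] length B ≡ suc (length B′) × All P B′ × (∀ {x} → Span K B x → Span K B′ x)
    reduce []      _        = inj₁ tt
    reduce {P} (b ∷ B) (p ∷ ps) = go em (reduce B ps)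
      where
      Result = Independent K (b ∷ B) ⊎
        ∃[ B′ ] length (b ∷ B) ≡ suc (length B′) × All P B′ × (∀ {x} → Span K (b ∷ B) x → Span K B′ x)
      go : Dec (Span K B b) → _ → Result
      go (yes b∈) _ = inj₂ (B , ≡.refl , ps , λ { (step k s e) →
        span-resp (sym e) (span-add (span-scale k b∈) s) })
      go (no b∉) (inj₁ ind) = inj₁ (b∉ , ind)
      go (no b∉) (inj₂ (B′ , l , ps′ , h)) = inj₂ (b ∷ B′ , ≡.cong suc l , p ∷ ps′
        , λ { (step k s e) → step k (h s) e })

  -- The element e b₀ has two expansions over `L`: the evident one, in which only b₀ occurs, and the
  -- given one, with coefficients in `K`. Uniqueness over `L` identifies `e` with a coefficient of
  -- the second.
  base-coefficient : ∀ {K L B e} → IsSubfield L → (∀ {c} → K c → L c) → IsSubfield K →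
    Independent L B → L e → Span K B (e * b₀) → K e
  base-coefficient L-sub K⊆L K-sub ind l (base k eq) =
    IsSubfield.resp K-sub (sym (base-coefficient-unique L-sub eq)) k
  base-coefficient {L = L} {b ∷ B} {e} L-sub K⊆L K-sub ind l (step {c = c} {x′ = x′} k s eq) =
    base-coefficient L-sub K⊆L K-sub (proj₂ ind) l (span-resp K-sub (sym tail≈) s)
    where
    tail≈ : e * b₀ ≈ x′
    tail≈ = proj₂ (coefficients-unique L-sub ind (IsSubfield.nil L-sub) (K⊆L k)
      (span-base L-sub B l) (span-mono K⊆L s)
      (trans (trans (+-congʳ (zeroˡ b)) (+-identityˡ _)) eq))

-- The linear system satisfied by f and t f, and its descent through the jet fields

module _ (A : CommutativeRing 0ℓ 0ℓ) where

  open CommutativeRing A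

  -- One and the same linear form with coefficients in `K`, evaluated at the first `n` terms of both
  -- sequences. Keeping the two values together is what carries the differential equation from f to
  -- t f.
  data Comb (K : Carrier → Set) (n : ℕ) (f m : ℕ → Carrier) : Carrier → Carrier → Set where
    term  : ∀ {k} → k ℕ.< n → Comb K n f m (f k) (m k)
    null  : Comb K n f m 0# 0#
    sum   : ∀ {x x′ w w′} → Comb K n f m x x′ → Comb K n f m w w′ → Comb K n f m (x + w) (x′ + w′)
    scale : ∀ {c x x′} → K c → Comb K n f m x x′ → Comb K n f m (c * x) (c * x′)
    resp  : ∀ {x x′ w w′} → x ≈ w → x′ ≈ w′ → Comb K n f m x x′ → Comb K n f m w w′

-- f k and m k stand for Dᵏf and Dᵏ(t f) - t Dᵏf, where D = W ∂ and ∂t = 1.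

record LogarithmicPair (D : DifferentialField) (T : Jets D) : Set₁ where
  open DifferentialField D
  open Jets T
  field
    y₀≉0    : ¬ y 0 ≈ 0#
    V W     : Carrier
    VW≈1    : V * W ≈ 1#
    Vy₀≈y₁  : V * y 0 ≈ y 1
    f m     : ℕ → Carrier
    f₀≉0    : ¬ f 0 ≈ 0#
    ∂-f     : ∀ i → ∂ (f i) ≈ V * f (suc i)
    m₀≈0    : m 0 ≈ 0#
    ∂-m     : ∀ i → ∂ (m i) + f i ≈ V * m (suc i)

module LinearSystem
  (em : ExcludedMiddle 0ℓ) (D : DifferentialField) (T : Jets D) (P : LogarithmicPair D T)
  where

  open DifferentialField D
  open Subrings ring
  open Jets T
  open LogarithmicPair P
  open JetFields em D T
  open Spans em D (f 0) f₀≉0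
  open IntegerSolver ring
  open ≈-Reasoning setoid

  V∈J : J 2 V
  V∈J = J.div 2 (J-suc {1} (y∈J 0)) y₀≉0 (y∈J 1) Vy₀≈y₁

  V≉0 : ¬ V ≈ 0#
  V≉0 V≈0 = 1≉0 (trans (sym VW≈1) (trans (*-congʳ V≈0) (zeroˡ W)))

  W∈J : J 2 W
  W∈J = J.div 2 V∈J V≉0 (J.one 2) (trans (*-comm W V) VW≈1)

  WVx≈x : ∀ x → W * (V * x) ≈ x
  WVx≈x x = trans (sym (*-assoc W V x))
    (trans (*-congʳ (trans (*-comm W V) VW≈1)) (*-identityˡ x))

  VWx≈x : ∀ x → V * (W * x) ≈ x
  VWx≈x x = trans (sym (*-assoc V W x)) (trans (*-congʳ VW≈1) (*-identityˡ x))

  -- With D = W∂ = z d/dz, w k is D⁽ᵏ⁺¹⁾t.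

  w : ℕ → Carrier
  w zero    = W
  w (suc k) = W * ∂ (w k)

  w∈J : ∀ k → J (2 ℕ.+ k) (w k)
  w∈J zero    = W∈J
  w∈J (suc k) = J.mul (3 ℕ.+ k) (J-mono (s≤s (s≤s z≤n)) W∈J) (∂-J {2 ℕ.+ k} (w∈J k))

  data Low (K : Carrier → Set) (k : ℕ) : Carrier → Set where
    term  : ∀ {i} → i ℕ.< k → Low K k (f i)
    null  : Low K k 0#
    sum   : ∀ {x x′} → Low K k x → Low K k x′ → Low K k (x + x′)
    scale : ∀ {c x} → K c → Low K k x → Low K k (c * x)
    resp  : ∀ {x x′} → x ≈ x′ → Low K k x → Low K k x′

  low-mono : ∀ {K L k l x} → (∀ {c} → K c → L c) → k ℕ.≤ l → Low K k x → Low L l x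
  low-mono K⊆L k≤l (term i<k)  = term (ℕₚ.≤-trans i<k k≤l)
  low-mono K⊆L k≤l null        = null
  low-mono K⊆L k≤l (sum p q)   = sum (low-mono K⊆L k≤l p) (low-mono K⊆L k≤l q)
  low-mono K⊆L k≤l (scale c p) = scale (K⊆L c) (low-mono K⊆L k≤l p)
  low-mono K⊆L k≤l (resp e p)  = resp e (low-mono K⊆L k≤l p)

  W∂-low : ∀ {k x} → Low (J (suc k)) (suc k) x → Low (J (2 ℕ.+ k)) (2 ℕ.+ k) (W * ∂ x)
  W∂-low (term {i} i<k) = resp (sym (trans (*-congˡ (∂-f i)) (WVx≈x _))) (term (s≤s i<k))
  W∂-low null = resp (sym (trans (*-congˡ ∂-0) (zeroʳ W))) null
  W∂-low (sum {x} {x′} p q) = resp (trans (sym (distribˡ W _ _)) (*-congˡ (sym (∂-+ x x′))))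
    (sum (W∂-low p) (W∂-low q))
  W∂-low {k} (scale {c} {x} j p) = resp
    (begin
      (W * ∂ c) * x + c * (W * ∂ x)
        ≈⟨ solve 5 (λ W c′ x c x′ → (W :* c′) :* x :+ c :* (W :* x′) := W :* (c′ :* x :+ c :* x′))
             refl W (∂ c) x c (∂ x) ⟩
      W * (∂ c * x + c * ∂ x)
        ≈⟨ *-congˡ (∂-* c x) ⟨
      W * ∂ (c * x) ∎)
    (sum (scale (J.mul (2 ℕ.+ k) (J-mono (s≤s (s≤s z≤n)) W∈J) (∂-J {suc k} j))
            (low-mono (J-suc {suc k}) (ℕₚ.n≤1+n _) p))
         (scale (J-suc {suc k} j) (W∂-low p)))
  W∂-low (resp e p) = resp (*-congˡ (∂-cong e)) (W∂-low p)

  m-suc : ∀ i → m (suc i) ≈ W * ∂ (m i) + W * f i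
  m-suc i = begin
    m (suc i)               ≈⟨ WVx≈x _ ⟨
    W * (V * m (suc i))     ≈⟨ *-congˡ (∂-m i) ⟨
    W * (∂ (m i) + f i)     ≈⟨ distribˡ W _ _ ⟩
    W * ∂ (m i) + W * f i   ∎

  -- Leibniz' rule: `m (suc k)` is the sum over i ≤ k of binomial(k + 1, i) Dᵏ⁺¹⁻ⁱt Dⁱf. Only the
  -- coefficient Dᵏ⁺¹t of f can involve y⁽ᵏ⁺¹⁾; all others contain lower derivatives of t.
  m-leading : ∀ k → ∃[ r ] Low (J (suc k)) (suc k) r × m (suc k) ≈ w k * f 0 + r
  m-leading zero = 0# , null , (begin
    m 1                     ≈⟨ m-suc 0 ⟩
    W * ∂ (m 0) + W * f 0   ≈⟨ +-congʳ (trans (*-congˡ (trans (∂-cong m₀≈0) ∂-0)) (zeroʳ W)) ⟩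
    0# + W * f 0            ≈⟨ +-comm _ _ ⟩
    W * f 0 + 0#            ∎)
  m-leading (suc k) =
    let r , low , e = m-leading k
        2≤ = s≤s (s≤s z≤n)
    in w k * f 1 + (W * ∂ r + W * f (suc k))
     , sum (scale (w∈J k) (term (s≤s (s≤s z≤n))))
           (sum (W∂-low low) (scale (J-mono 2≤ W∈J) (term ℕₚ.≤-refl)))
     , (begin
       m (2 ℕ.+ k)
         ≈⟨ m-suc (suc k) ⟩
       W * ∂ (m (suc k)) + W * f (suc k)
         ≈⟨ +-congʳ (*-congˡ (∂-cong e)) ⟩
       W * ∂ (w k * f 0 + r) + W * f (suc k)
         ≈⟨ +-congʳ (*-congˡ (trans (∂-+ _ _) (+-congʳ (∂-* _ _)))) ⟩
       W * ((∂ (w k) * f 0 + w k * ∂ (f 0)) + ∂ r) + W * f (suc k)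
         ≈⟨ +-congʳ (*-congˡ (+-congʳ (+-congˡ (*-congˡ (∂-f 0))))) ⟩
       W * ((∂ (w k) * f 0 + w k * (V * f 1)) + ∂ r) + W * f (suc k)
         ≈⟨ regroup _ _ _ _ _ _ ⟩
       (W * ∂ (w k)) * f 0 + (w k * (W * (V * f 1)) + (W * ∂ r + W * f (suc k)))
         ≈⟨ +-congˡ (+-congʳ (*-congˡ (WVx≈x (f 1)))) ⟩
       w (suc k) * f 0 + (w k * f 1 + (W * ∂ r + W * f (suc k))) ∎)
    where
    regroup : ∀ w′ f₀ u v r′ g →
      W * ((w′ * f₀ + u * v) + r′) + W * g ≈ (W * w′) * f₀ + (u * (W * v) + (W * r′ + W * g))
    regroup = solve 7 (λ W w′ f₀ u v r′ g →
      W :* ((w′ :* f₀ :+ u :* v) :+ r′) :+ W :* g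
      := (W :* w′) :* f₀ :+ (u :* (W :* v) :+ (W :* r′ :+ W :* g))) refl W

  -- Here n = s - 2. The relation is the equation L of order n + 1, with leading coefficient `a` and
  -- all coefficients rational in z, for f and for t f at once.
  module _ (n : ℕ)
    (a : Carrier) (a∈J : J 1 a) (a≉0 : ¬ a ≈ 0#)
    (relation : Comb ring (J 1) (suc n) f m (a * f (suc n)) (a * m (suc n)))
    where

    -- Up to index n the leading coefficients `w k` still lie in `J (suc n)`; only `m (suc n)`
    -- brings in a further jet.
    m∈low : ∀ {k} → k ℕ.≤ n → Low (J (suc n)) (suc n) (m k)
    m∈low {zero}  _   = resp (sym m₀≈0) null
    m∈low {suc k} k<n =
      let r , low , e = m-leading k
      in resp (sym e) (sum (scale (J-mono (s≤s k<n) (w∈J k)) (term (s≤s z≤n)))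
           (low-mono (J-mono (ℕₚ.m≤n⇒m≤1+n k<n)) (ℕₚ.m≤n⇒m≤1+n k<n) low))

    comb⇒lowˡ : ∀ {x x′} → Comb ring (J 1) (suc n) f m x x′ → Low (J 1) (suc n) x
    comb⇒lowˡ (term k<) = term k<
    comb⇒lowˡ null = null
    comb⇒lowˡ (sum p q) = sum (comb⇒lowˡ p) (comb⇒lowˡ q)
    comb⇒lowˡ (scale c p) = scale c (comb⇒lowˡ p)
    comb⇒lowˡ (resp e _ p) = resp e (comb⇒lowˡ p)

    comb⇒lowʳ : ∀ {x x′} → Comb ring (J 1) (suc n) f m x x′ → Low (J (suc n)) (suc n) x′
    comb⇒lowʳ (term (s≤s k≤)) = m∈low k≤
    comb⇒lowʳ null = null
    comb⇒lowʳ (sum p q) = sum (comb⇒lowʳ p) (comb⇒lowʳ q)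
    comb⇒lowʳ (scale c p) = scale (J-mono (s≤s z≤n) c) (comb⇒lowʳ p)
    comb⇒lowʳ (resp _ e p) = resp e (comb⇒lowʳ p)

    -- This is [L, t] f = 0 solved for its single coefficient outside `J (suc n)`, the one that
    -- contains Dⁿ⁺¹t.
    awf∈low : Low (J (suc n)) (suc n) ((a * w n) * f 0)
    awf∈low =
      let r , low , e = m-leading n
      in resp
        (begin
          a * m (suc n) + (- 1#) * (a * r)
            ≈⟨ +-congʳ (*-congˡ e) ⟩
          a * (w n * f 0 + r) + (- 1#) * (a * r)
            ≈⟨ solve 4 (λ a w f r → a :* (w :* f :+ r) :+ (:- con (+ 1)) :* (a :* r) := (a :* w) :* f)
                 refl a (w n) (f 0) r ⟩
          (a * w n) * f 0 ∎)
        (sum (comb⇒lowʳ relation)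
          (scale (J.neg (suc n) (J.one (suc n))) (scale (J-mono (s≤s z≤n) a∈J) low)))

    Spanning : (Carrier → Set) → List Carrier → Set
    Spanning K B = ∀ {i} → i ℕ.≤ n → Span K B (f i)

    low⇒span : ∀ {K B x} → IsSubfield K → Spanning K B → Low K (suc n) x → Span K B x
    low⇒span s h (term (s≤s i≤)) = h i≤
    low⇒span {B = B} s h null = span-zero s B
    low⇒span s h (sum p q)   = span-add s (low⇒span s h p) (low⇒span s h q)
    low⇒span s h (scale c p) = span-scale s c (low⇒span s h p)
    low⇒span s h (resp e p)  = span-resp s e (low⇒span s h p)

    -- The span is closed under D because the differential equation expresses a Dⁿ⁺¹f by lower
    -- derivatives, and `a` can be divided out already over `J 1`.
    f-suc∈span : ∀ {j B} → Spanning (J (suc j)) B → ∀ {i} → i ℕ.≤ n → Span (J (suc j)) B (f (suc i))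
    f-suc∈span {j} h {i} i≤n = go (ℕₚ.m≤n⇒m<n∨m≡n i≤n)
      where
      S = J-isSubfield (suc j)
      go : i ℕ.< n ⊎ i ≡ n → _
      go (inj₁ i<n)    = h i<n
      go (inj₂ ≡.refl) = span-div S (J-mono (s≤s z≤n) a∈J) a≉0
        (low⇒span S h (low-mono (J-mono (s≤s z≤n)) ℕₚ.≤-refl (comb⇒lowˡ relation)))

    Member : Carrier → Set
    Member b = ∃[ i ] i ℕ.≤ n × b ≈ f i

    -- For x = Σ c b this is Σ ∂c b. It depends on the chosen expression and not on its value alone,
    -- hence the recursion on the span derivation.
    ∂-coefficients : ∀ {K B x} → Span K B x → Carrier
    ∂-coefficients (base {c} _ _)       = ∂ c * f 0
    ∂-coefficients (step {b} {c = c} _ s _) = ∂ c * b + ∂-coefficients s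

    module _ {j} {B : List Carrier} (B⊆f : All Member B)
             (spanning : Spanning (J (2 ℕ.+ j)) B) where

      private
        K = J (2 ℕ.+ j)
        S = J-isSubfield (2 ℕ.+ j)

      ∂-member : ∀ {b} → Member b → Span K B (∂ b)
      ∂-member (i , i≤n , b≈f) = span-resp S (trans (sym (∂-f i)) (sym (∂-cong b≈f)))
        (span-scale S (J-mono (s≤s (s≤s z≤n)) V∈J) (f-suc∈span {suc j} spanning i≤n))

      -- By the product rule the difference is Σ c ∂b, and every ∂b lies in the span since b is one
      -- of the Dⁱf. `B′` runs through the tails of `B`, while the span stays that of all of `B`.
      ∂-remainder : ∀ {B′ x} → All Member B′ → (s : Span K B′ x) → Span K B (∂ x - ∂-coefficients s)
      ∂-remainder {x = x} _ (base {c} k e) = span-resp S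
        (sym (begin
          ∂ x - ∂ c * f 0
            ≈⟨ +-congʳ (trans (∂-cong e) (∂-* c (f 0))) ⟩
          (∂ c * f 0 + c * ∂ (f 0)) - ∂ c * f 0
            ≈⟨ solve 2 (λ u v → (u :+ v) :- u := v) refl _ _ ⟩
          c * ∂ (f 0) ∎))
        (span-scale S k (∂-member (0 , z≤n , refl)))
      ∂-remainder {x = x} (mb ∷ ms) (step {b} {c = c} {x′ = x′} k s e) = span-resp S
        (sym (begin
          ∂ x - (∂ c * b + d)
            ≈⟨ +-congʳ (trans (∂-cong e) (trans (∂-+ _ _) (+-congʳ (∂-* c b)))) ⟩
          ((∂ c * b + c * ∂ b) + ∂ x′) - (∂ c * b + d)
            ≈⟨ solve 4 (λ u v x d → ((u :+ v) :+ x) :- (u :+ d) := v :+ (x :- d)) refl _ _ (∂ x′) d ⟩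
          c * ∂ b + (∂ x′ - d) ∎))
        (span-add S (span-scale S k (∂-member mb)) (∂-remainder ms s))
        where d = ∂-coefficients s

      ∂-coefficients∈span : ∀ {x} (s : Span K B x) → Span K B (∂ x) → Span K B (∂-coefficients s)
      ∂-coefficients∈span {x} s ∂x∈ = span-resp S
        (solve 2 (λ u v → u :- (u :- v) := v) refl (∂ x) _)
        (span-sub S ∂x∈ (∂-remainder B⊆f s))

      module _ {M} (3+j≤M : 3 ℕ.+ j ℕ.≤ M) (irrational : ¬ J (2 ℕ.+ j) (y (2 ℕ.+ j))) where

        private
          L = J M
          K⊆L : ∀ {c} → K c → L c
          K⊆L = J-mono (ℕₚ.≤-trans (ℕₚ.n≤1+n _) 3+j≤M)

          ∂∈L : ∀ {c} → K c → L (∂ c)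
          ∂∈L k = J-mono 3+j≤M (∂-J {2 ℕ.+ j} k)

          ∂-coefficients∈L : ∀ {B′ x} (s : Span K B′ x) → Span L B′ (∂-coefficients s)
          ∂-coefficients∈L (base k e)   = base (∂∈L k) refl
          ∂-coefficients∈L (step k s e) = step (∂∈L k) (∂-coefficients∈L s) refl

        -- A priori the derivatives ∂c lie one field above `K`. Comparing Σ ∂c b over the larger `L`
        -- with an expansion of the same element over `K` forces each ∂c into `K`, and then
        -- `descend` frees c of the last jet.
        descend-coefficients : ∀ {B′ x} → Independent L B′ → (s : Span K B′ x) →
          Span K B′ (∂-coefficients s) → Span (J (suc j)) B′ x
        descend-coefficients ind (base k e) (base k′ e′) = base
          (descend {suc j} irrational k
            (IsSubfield.resp S (sym (base-coefficient-unique S e′)) k′)) e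
        descend-coefficients ind (step {c = c} k s e) (step {c = c′} k′ s′ e′) =
          let ∂c≈c′ , rest = coefficients-unique (J-isSubfield M) ind (∂∈L k) (K⊆L k′)
                               (∂-coefficients∈L s) (span-mono K⊆L s′) e′
          in step (descend {suc j} irrational k (IsSubfield.resp S (sym ∂c≈c′) k′))
               (descend-coefficients (proj₂ ind) s (span-resp S (sym rest) s′)) e

        descend-spanning : Independent L B → Spanning (J (suc j)) B
        descend-spanning ind {i} i≤n = descend-coefficients ind (spanning i≤n)
          (∂-coefficients∈span (spanning i≤n) (∂-member (i , i≤n , refl)))

    module _ (irrational : ∀ i → i ℕ.≤ n ℕ.+ n → ¬ J (suc i) (y (suc i))) where

      -- Contraposition of `descend`: if Dᵏ⁺²t lacked its top jet, then ∂ of Dᵏ⁺¹t would lie in the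
      -- field of Dᵏ⁺¹t, which would lose its top jet too. The chain ends at W = z / z′, which would
      -- make z′ rational in z.
      w∉J : ∀ k → k ℕ.≤ n ℕ.+ n → ¬ J (suc k) (w k)
      w∉J zero _ W∈J₁ = irrational 0 z≤n (J.div 1 W∈J₁ W≉0 (y∈J 0) (begin
        y 1 * W          ≈⟨ *-comm _ W ⟩
        W * y 1          ≈⟨ *-congˡ Vy₀≈y₁ ⟨
        W * (V * y 0)    ≈⟨ WVx≈x (y 0) ⟩
        y 0              ∎))
        where
        W≉0 : ¬ W ≈ 0#
        W≉0 W≈0 = 1≉0 (trans (sym VW≈1) (trans (*-congˡ W≈0) (zeroʳ V)))
      w∉J (suc k) k<2n w∈ = w∉J k (ℕₚ.<⇒≤ k<2n)
        (descend {suc k} (irrational (suc k) k<2n) (w∈J k)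
          (J.resp (2 ℕ.+ k) (VWx≈x _)
            (J.mul (2 ℕ.+ k) (J-mono (s≤s (s≤s z≤n)) V∈J) w∈)))

      -- Independence over one field `J M` above all others serves for every descent. At d = 0 the
      -- coefficient of f is read off from [L, t] f = 0 and contradicts `w∉J`.
      ¬spanning-independent : ∀ d {M B} → 2 ℕ.+ (d ℕ.+ n) ℕ.≤ M → d ℕ.≤ n → All Member B →
        Independent (J M) B → ¬ Spanning (J (suc (d ℕ.+ n))) B
      ¬spanning-independent zero {M} ≤M _ ms ind spanning =
        w∉J n (ℕₚ.m≤m+n n n) (J.div (suc n) (J-mono (s≤s z≤n) a∈J) a≉0 aw∈J (*-comm _ a))
        where
        aw∈J : J (suc n) (a * w n)
        aw∈J = base-coefficient (J-isSubfield M) (J-mono (ℕₚ.≤-trans (ℕₚ.n≤1+n _) ≤M)) (J-isSubfield (suc n)) ind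
          (J.mul M (J-mono (ℕₚ.≤-trans (s≤s z≤n) ≤M) a∈J) (J-mono ≤M (w∈J n)))
          (low⇒span (J-isSubfield (suc n)) spanning awf∈low)
      ¬spanning-independent (suc d) {M} ≤M d<n ms ind spanning =
        ¬spanning-independent d (ℕₚ.≤-trans (ℕₚ.n≤1+n _) ≤M) (ℕₚ.<⇒≤ d<n) ms ind
          (descend-spanning {d ℕ.+ n} ms spanning ≤M
            (irrational (suc (d ℕ.+ n)) (ℕₚ.+-monoˡ-≤ n d<n)) ind)

      ¬spanning : ∀ l d B → length B ≡ l → d ℕ.+ l ℕ.≤ n → All Member B →
        ¬ Spanning (J (suc (d ℕ.+ n))) B
      -- Dependence is tested one field above that of the spanning coefficients, because their
      -- derivatives lie there.
      ¬spanning l d B len d+l≤n ms spanning = go l len d+l≤n (reduce (J-isSubfield (2 ℕ.+ (d ℕ.+ n))) B ms)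
        where
        go : ∀ l → length B ≡ l → d ℕ.+ l ℕ.≤ n → _ → ⊥
        go l _ d+l≤n (inj₁ ind) =
          ¬spanning-independent d ℕₚ.≤-refl (ℕₚ.m+n≤o⇒m≤o d d+l≤n) ms ind spanning
        go zero    len _ (inj₂ (B′ , len′ , _)) with () ← ≡.trans (≡.sym len) len′
        go (suc l) len d+l≤n (inj₂ (B′ , len′ , ms′ , ⊆)) =
          ¬spanning l (suc d) B′ (ℕₚ.suc-injective (≡.trans (≡.sym len′) len))
            (≡.subst (ℕ._≤ n) (ℕₚ.+-suc d l) d+l≤n) ms′
            (λ i≤n → ⊆ (span-mono (J-suc {suc (d ℕ.+ n)}) (spanning i≤n)))

      -- f 0 is left out, being the generator that every span contains.
      segment : ℕ → List Carrier
      segment zero    = []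
      segment (suc k) = f (suc k) ∷ segment k

      length-segment : ∀ k → length (segment k) ≡ k
      length-segment zero    = ≡.refl
      length-segment (suc k) = ≡.cong suc (length-segment k)

      segment-members : ∀ {k} → k ℕ.≤ n → All Member (segment k)
      segment-members {zero}  _   = []
      segment-members {suc k} k<n = (_ , k<n , refl) ∷ segment-members (ℕₚ.<⇒≤ k<n)

      segment-spans : ∀ {K} → IsSubfield K → ∀ k {i} → i ℕ.≤ k → Span K (segment k) (f i)
      segment-spans S zero    z≤n = base (IsSubfield.one S) (sym (*-identityˡ _))
      segment-spans S (suc k) {i} i≤ = go (ℕₚ.m≤n⇒m<n∨m≡n i≤)
        where
        go : i ℕ.< suc k ⊎ i ≡ suc k → _
        go (inj₁ (s≤s i≤k)) = span-cons S (segment-spans S k i≤k)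
        go (inj₂ ≡.refl)    = span-head S (f (suc k)) (segment k)

      contradictory : ⊥
      contradictory = ¬spanning n 0 (segment n) (length-segment n) ℕₚ.≤-refl
        (segment-members ℕₚ.≤-refl) (segment-spans (J-isSubfield (suc n)) n)

    y-rational : J (suc (n ℕ.+ n)) (y (suc (n ℕ.+ n)))
    y-rational = go em
      where
      raise : ∀ {i l} → i ℕ.≤′ l → J (suc i) (y (suc i)) → J (suc l) (y (suc l))
      raise ℕ.≤′-refl             j = j
      raise (ℕ.≤′-step {l} i≤′l) j = ∂-J-y {suc l} (raise i≤′l j)
      go : Dec (∃[ i ] i ℕ.≤ n ℕ.+ n × J (suc i) (y (suc i))) → J (suc (n ℕ.+ n)) (y (suc (n ℕ.+ n)))
      go (yes (i , i≤ , j)) = raise (ℕₚ.≤⇒≤′ i≤) j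
      go (no none) = ⊥-elim (contradictory λ i i≤ j → none (i , i≤ , j))

-- The ring of power series, composition and the chain rule

module SeriesRing {c ℓ} (R : CommutativeRing c ℓ) where

  open CommutativeRing R
  open PowerSeries R
  open IntegerSolver R
  open RawMonoidDefs +-rawMonoid using () renaming (_×_ to _·_)
  open MonoidMult +-monoid using (×-congʳ)
  open CommutativeMonoidMult +-commutativeMonoid using (×-distrib-+)
  open SemiringMult semiring using (×-comm-*)
  open MonoidSum +-monoid using (sum-syntax; sum-cong-≋)
  open ≈-Reasoning setoid

  shift : Series → Series
  shift f n = f (suc n)

  -ˢ_ : Series → Series
  (-ˢ f) n = - f n

  infix 4 _≋_

  record _≋_ (f g : Series) : Set ℓ where
    constructor coefficientwise
    field
      at : f ≈ˢ g

  open _≋_ public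

  *ˢ-zero : ∀ f g → (f *ˢ g) 0 ≈ f 0 * g 0
  *ˢ-zero f g = +-identityʳ _

  *ˢ-cong-≤ : ∀ n {f f′ g g′} → (∀ i → i ℕ.≤ n → f i ≈ f′ i) → (∀ i → i ℕ.≤ n → g i ≈ g′ i) →
              (f *ˢ g) n ≈ (f′ *ˢ g′) n
  *ˢ-cong-≤ zero    p q = +-congʳ (*-cong (p 0 z≤n) (q 0 z≤n))
  *ˢ-cong-≤ (suc n) {f} {f′} {g} {g′} p q = +-cong (*-cong (p 0 z≤n) (q (suc n) ℕₚ.≤-refl))
    (*ˢ-cong-≤ n {shift f} {shift f′} {g} {g′} (λ i i≤n → p (suc i) (s≤s i≤n)) (λ i i≤n → q i (ℕₚ.m≤n⇒m≤1+n i≤n)))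

  *ˢ-cong : ∀ {f f′ g g′} → f ≈ˢ f′ → g ≈ˢ g′ → f *ˢ g ≈ˢ f′ *ˢ g′
  *ˢ-cong {f} {f′} {g} {g′} p q n = *ˢ-cong-≤ n {f} {f′} {g} {g′} (λ i _ → p i) (λ i _ → q i)

  *ˢ-zeroˡ : ∀ {f} g → (∀ n → f n ≈ 0#) → ∀ n → (f *ˢ g) n ≈ 0#
  *ˢ-zeroˡ {f} g f≈0 zero    = trans (*ˢ-zero f g) (trans (*-congʳ (f≈0 0)) (zeroˡ _))
  *ˢ-zeroˡ {f} g f≈0 (suc n) = trans (+-cong (trans (*-congʳ (f≈0 0)) (zeroˡ _))
    (*ˢ-zeroˡ {shift f} g (λ i → f≈0 (suc i)) n)) (+-identityʳ 0#)

  *ˢ-distribʳ : ∀ h f g → (f +ˢ g) *ˢ h ≈ˢ f *ˢ h +ˢ g *ˢ h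
  *ˢ-distribʳ h f g zero =
    solve 3 (λ f g h → (f :+ g) :* h :+ con (+ 0) := (f :* h :+ con (+ 0)) :+ (g :* h :+ con (+ 0)))
      refl (f 0) (g 0) (h 0)
  *ˢ-distribʳ h f g (suc n) = begin
    (f 0 + g 0) * h (suc n) + (shift (f +ˢ g) *ˢ h) n
      ≈⟨ +-congˡ (*ˢ-distribʳ h (shift f) (shift g) n) ⟩
    (f 0 + g 0) * h (suc n) + ((shift f *ˢ h) n + (shift g *ˢ h) n)
      ≈⟨ solve 5 (λ f g h u v → (f :+ g) :* h :+ (u :+ v) := (f :* h :+ u) :+ (g :* h :+ v))
           refl (f 0) (g 0) (h (suc n)) _ _ ⟩
    (f *ˢ h) (suc n) + (g *ˢ h) (suc n) ∎

  *ˢ-scaleˡ : ∀ a f g n → ((λ i → a * f i) *ˢ g) n ≈ a * (f *ˢ g) n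
  *ˢ-scaleˡ a f g zero =
    solve 3 (λ a f g → (a :* f) :* g :+ con (+ 0) := a :* (f :* g :+ con (+ 0))) refl a (f 0) (g 0)
  *ˢ-scaleˡ a f g (suc n) = begin
    (a * f 0) * g (suc n) + ((λ i → a * shift f i) *ˢ g) n
      ≈⟨ +-congˡ (*ˢ-scaleˡ a (shift f) g n) ⟩
    (a * f 0) * g (suc n) + a * (shift f *ˢ g) n
      ≈⟨ solve 4 (λ a f g u → (a :* f) :* g :+ a :* u := a :* (f :* g :+ u)) refl a (f 0) (g (suc n)) _ ⟩
    a * (f *ˢ g) (suc n) ∎

  -- The defining sum unfolds at the constant term of the first factor; commutativity also needs it
  -- unfolded at that of the second.
  *ˢ-sucʳ : ∀ f g n → (f *ˢ g) (suc n) ≈ (f *ˢ shift g) n + f (suc n) * g 0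
  *ˢ-sucʳ f g zero = solve 2 (λ u v → u :+ (v :+ con (+ 0)) := (u :+ con (+ 0)) :+ v) refl _ _
  *ˢ-sucʳ f g (suc n) = trans (+-congˡ (*ˢ-sucʳ (shift f) g n)) (sym (+-assoc _ _ _))

  *ˢ-comm : ∀ f g → f *ˢ g ≈ˢ g *ˢ f
  *ˢ-comm f g zero    = +-congʳ (*-comm _ _)
  *ˢ-comm f g (suc n) = begin
    f 0 * g (suc n) + (shift f *ˢ g) n   ≈⟨ +-cong (*-comm _ _) (*ˢ-comm (shift f) g n) ⟩
    g (suc n) * f 0 + (g *ˢ shift f) n   ≈⟨ +-comm _ _ ⟩
    (g *ˢ shift f) n + g (suc n) * f 0   ≈⟨ *ˢ-sucʳ g f n ⟨
    (g *ˢ f) (suc n)                     ∎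

  *ˢ-assoc : ∀ f g h → (f *ˢ g) *ˢ h ≈ˢ f *ˢ (g *ˢ h)
  *ˢ-assoc f g h zero = solve 3 (λ f g h →
    (f :* g :+ con (+ 0)) :* h :+ con (+ 0) := f :* (g :* h :+ con (+ 0)) :+ con (+ 0))
    refl (f 0) (g 0) (h 0)
  *ˢ-assoc f g h (suc n) = begin
    (f *ˢ g) 0 * h (suc n) + (((λ i → f 0 * shift g i) +ˢ shift f *ˢ g) *ˢ h) n
      ≈⟨ +-cong (*-congʳ (*ˢ-zero f g)) (*ˢ-distribʳ h (λ i → f 0 * shift g i) (shift f *ˢ g) n) ⟩
    (f 0 * g 0) * h (suc n) + (((λ i → f 0 * shift g i) *ˢ h) n + ((shift f *ˢ g) *ˢ h) n)
      ≈⟨ +-congˡ (+-cong (*ˢ-scaleˡ (f 0) (shift g) h n) (*ˢ-assoc (shift f) g h n)) ⟩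
    (f 0 * g 0) * h (suc n) + (f 0 * (shift g *ˢ h) n + (shift f *ˢ (g *ˢ h)) n)
      ≈⟨ solve 5 (λ f g h u v → (f :* g) :* h :+ (f :* u :+ v) := f :* (g :* h :+ u) :+ v)
           refl (f 0) (g 0) (h (suc n)) _ _ ⟩
    (f *ˢ (g *ˢ h)) (suc n) ∎

  constˢ-* : ∀ a f n → (constˢ a *ˢ f) n ≈ a * f n
  constˢ-* a f zero    = *ˢ-zero (constˢ a) f
  constˢ-* a f (suc n) = trans (+-congˡ (*ˢ-zeroˡ {shift (constˢ a)} f (λ _ → refl) n)) (+-identityʳ _)

  *ˢ-identityˡ : ∀ f → 1ˢ *ˢ f ≈ˢ f
  *ˢ-identityˡ f n = trans (constˢ-* 1# f n) (*-identityˡ _)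

  seriesRing : CommutativeRing c ℓ
  seriesRing = record
    { Carrier = Series
    ; _≈_     = _≋_
    ; _+_     = _+ˢ_
    ; _*_     = _*ˢ_
    ; -_      = -ˢ_
    ; 0#      = 0ˢ
    ; 1#      = 1ˢ
    ; isCommutativeRing = record
      { isRing = record
        { +-isAbelianGroup = record
          { isGroup = record
            { isMonoid = record
              { isSemigroup = record
                { isMagma = record
                  { isEquivalence = record
                    { refl  = coefficientwise λ n → refl
                    ; sym   = λ p → coefficientwise λ n → sym (at p n)
                    ; trans = λ p q → coefficientwise λ n → trans (at p n) (at q n)
                    }
                  ; ∙-cong = λ p q → coefficientwise λ n → +-cong (at p n) (at q n)
                  }
                ; assoc = λ f g h → coefficientwise λ n → +-assoc _ _ _
                }
              ; identity = (λ f → coefficientwise λ { zero → +-identityˡ _ ; (suc n) → +-identityˡ _ })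
                         , (λ f → coefficientwise λ { zero → +-identityʳ _ ; (suc n) → +-identityʳ _ })
              }
            ; inverse = (λ f → coefficientwise λ { zero → -‿inverseˡ _ ; (suc n) → -‿inverseˡ _ })
                      , (λ f → coefficientwise λ { zero → -‿inverseʳ _ ; (suc n) → -‿inverseʳ _ })
            ; ⁻¹-cong = λ p → coefficientwise λ n → -‿cong (at p n)
            }
          ; comm = λ f g → coefficientwise λ n → +-comm _ _
          }
        ; *-cong = λ p q → coefficientwise (*ˢ-cong (at p) (at q))
        ; *-assoc = λ f g h → coefficientwise (*ˢ-assoc f g h)
        ; *-identity = (λ f → coefficientwise (*ˢ-identityˡ f))
                     , (λ f → coefficientwise λ n → trans (*ˢ-comm f 1ˢ n) (*ˢ-identityˡ f n))
        ; distrib = (λ h f g → coefficientwise λ n → trans (*ˢ-comm h (f +ˢ g) n)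
                      (trans (*ˢ-distribʳ h f g n) (+-cong (*ˢ-comm f h n) (*ˢ-comm g h n))))
                  , (λ h f g → coefficientwise (*ˢ-distribʳ h f g))
        }
      ; *-comm = λ f g → coefficientwise (*ˢ-comm f g)
      }
    }

  θ-cong : ∀ {f g} → f ≈ˢ g → θ f ≈ˢ θ g
  θ-cong p n = ×-congʳ n (p n)

  θ-+ : ∀ f g → θ (f +ˢ g) ≈ˢ θ f +ˢ θ g
  θ-+ f g n = ×-distrib-+ (f n) (g n) n

  θ-constˢ : ∀ a → θ (constˢ a) ≈ˢ 0ˢ
  θ-constˢ a zero    = refl
  θ-constˢ a (suc n) = multiple-zero (suc n)
    where
    multiple-zero : ∀ n → n · 0# ≈ 0#
    multiple-zero zero    = refl
    multiple-zero (suc n) = trans (+-identityˡ _) (multiple-zero n)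

  -- Induction along `shift`, which does not commute with θ: the shift of θ f is θ (shift f) + shift
  -- f. The extra summand accounts for `r`.
  θ-* : ∀ f g → θ (f *ˢ g) ≈ˢ θ f *ˢ g +ˢ f *ˢ θ g
  θ-* f g zero =
    solve 2 (λ f g → con (+ 0) := (con (+ 0) :* g :+ con (+ 0)) :+ (f :* con (+ 0) :+ con (+ 0)))
      refl (f 0) (g 0)
  θ-* f g (suc n) = begin
    (a + r) + n · (a + r)
      ≈⟨ +-congˡ (×-distrib-+ a r n) ⟩
    (a + r) + (n · a + n · r)
      ≈⟨ +-congˡ (+-cong (sym (×-comm-* n (f 0) (g (suc n)))) (θ-* (shift f) g n)) ⟩
    (a + r) + (f 0 * (n · g (suc n)) + ((θ (shift f) *ˢ g) n + (shift f *ˢ θ g) n))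
      ≈⟨ solve 6 (λ f g ng r u v → (f :* g :+ r) :+ (f :* ng :+ (u :+ v))
           := (con (+ 0) :* g :+ (r :+ u)) :+ (f :* (g :+ ng) :+ v))
           refl (f 0) (g (suc n)) (n · g (suc n)) r _ _ ⟩
    (0# * g (suc n) + (r + (θ (shift f) *ˢ g) n)) + (f 0 * (g (suc n) + n · g (suc n)) + (shift f *ˢ θ g) n)
      ≈⟨ +-congʳ (+-congˡ (*ˢ-distribʳ g (shift f) (θ (shift f)) n)) ⟨
    (θ f *ˢ g) (suc n) + (f *ˢ θ g) (suc n) ∎
    where
    a = f 0 * g (suc n)
    r = (shift f *ˢ g) n

  X-*-suc : ∀ f n → (X *ˢ f) (suc n) ≈ f n
  X-*-suc f n = trans (+-congʳ (zeroˡ _)) (trans (+-identityˡ _)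
    (trans (*ˢ-cong {shift X} {1ˢ} {f} {f} (λ { zero → refl ; (suc i) → refl }) (λ i → refl) n) (*ˢ-identityˡ f n)))

  X-*-zero : ∀ f → (X *ˢ f) 0 ≈ 0#
  X-*-zero f = trans (*ˢ-zero X f) (zeroˡ _)

  derivative : Series → Series
  derivative f n = suc n · f (suc n)

  X-*-derivative : ∀ f → X *ˢ derivative f ≈ˢ θ f
  X-*-derivative f zero    = X-*-zero (derivative f)
  X-*-derivative f (suc n) = X-*-suc (derivative f) n

  -- The product rule applied to f = f 0 + X · `shift f`.
  derivative-horner : ∀ f → derivative f ≈ˢ shift f +ˢ X *ˢ derivative (shift f)
  derivative-horner f zero    = +-congˡ (sym (X-*-zero (derivative (shift f))))
  derivative-horner f (suc n) = +-congˡ (sym (X-*-suc (derivative (shift f)) n))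

  θ-X : θ X ≈ˢ X
  θ-X zero          = refl
  θ-X (suc zero)    = +-identityʳ 1#
  θ-X (suc (suc n)) = trans (+-identityˡ _) (θ-constˢ 1# (suc n))

  module Composition (h : Series) (h₀≈0 : h 0 ≈ 0#) where

    private
      partial : Series → ℕ → Series
      partial a N n = ∑[ k < N ] (a (toℕ k) * (h ^ˢ toℕ k) n)

      *ˢ-partial : ∀ N (a : Series) (u : ℕ → Series) n →
        ∑[ k < N ] (a (toℕ k) * (u (toℕ k) *ˢ h) n)
        ≈ ((λ i → ∑[ k < N ] (a (toℕ k) * u (toℕ k) i)) *ˢ h) n
      *ˢ-partial zero    a u n = sym (*ˢ-zeroˡ {λ _ → 0#} h (λ _ → refl) n)
      *ˢ-partial (suc N) a u n = trans
        (+-cong (sym (*ˢ-scaleˡ (a 0) (u 0) h n)) (*ˢ-partial N (shift a) (λ k → u (suc k)) n))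
        (sym (*ˢ-distribʳ h (λ i → a 0 * u 0 i) (λ i → ∑[ k < N ] (a (suc (toℕ k)) * u (suc (toℕ k)) i)) n))

      partial-suc : ∀ a N → partial a (suc N) ≈ˢ (λ n → a 0 * 1ˢ n) +ˢ partial (shift a) N *ˢ h
      partial-suc a N n = +-congˡ (*ˢ-partial N (shift a) (h ^ˢ_) n)

    *ˢ-h-zero : ∀ f → (f *ˢ h) 0 ≈ 0#
    *ˢ-h-zero f = trans (*ˢ-zero f h) (trans (*-congˡ h₀≈0) (zeroʳ _))

    *ˢ-h-suc : ∀ f n → (f *ˢ h) (suc n) ≈ (f *ˢ shift h) n
    *ˢ-h-suc f n = trans (*ˢ-sucʳ f h n) (trans (+-congˡ (trans (*-congˡ h₀≈0) (zeroʳ _))) (+-identityʳ _))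

    *ˢ-h-cong : ∀ {f g} n → (∀ i → i ℕ.≤ n → f i ≈ g i) → (f *ˢ h) (suc n) ≈ (g *ˢ h) (suc n)
    *ˢ-h-cong {f} {g} n p = trans (*ˢ-h-suc f n)
      (trans (*ˢ-cong-≤ n {f} {g} {shift h} {shift h} p (λ i _ → refl)) (sym (*ˢ-h-suc g n)))

    private
      partial-zero : ∀ a N → partial a (suc N) 0 ≈ a 0
      partial-zero a N = trans (partial-suc a N 0)
        (trans (+-cong (*-identityʳ _) (*ˢ-h-zero (partial (shift a) N))) (+-identityʳ _))

      partial-at-suc : ∀ a N n → partial a (suc N) (suc n) ≈ (partial (shift a) N *ˢ h) (suc n)
      partial-at-suc a N n = trans (partial-suc a N (suc n))
        (trans (+-congʳ (zeroʳ _)) (+-identityˡ _))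

      -- Since h has no constant term, hᵏ starts at order k, so summands with k > i do not reach the
      -- coefficient i. In the induction, the factor h split off by `partial-at-suc` supplies the
      -- missing order.
      partial-stable : ∀ n a N i → i ℕ.≤ n → i ℕ.< N → partial a N i ≈ (a ∘ˢ h) i
      partial-stable n       a (suc N) zero    _         _         =
        trans (partial-zero a N) (sym (partial-zero a 0))
      partial-stable (suc n) a (suc N) (suc i) (s≤s i≤n) (s≤s i<N) = begin
        partial a (suc N) (suc i)
          ≈⟨ partial-at-suc a N i ⟩
        (partial (shift a) N *ˢ h) (suc i)
          ≈⟨ *ˢ-h-cong {partial (shift a) N} {partial (shift a) (suc i)} i (λ k k≤i → trans
               (partial-stable n (shift a) N k (ℕₚ.≤-trans k≤i i≤n) (ℕₚ.≤-<-trans k≤i i<N))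
               (sym (partial-stable n (shift a) (suc i) k (ℕₚ.≤-trans k≤i i≤n) (s≤s k≤i)))) ⟩
        (partial (shift a) (suc i) *ˢ h) (suc i)
          ≈⟨ partial-at-suc a (suc i) i ⟨
        (a ∘ˢ h) (suc i) ∎

    -- The number of summands in `∘ˢ` grows with the coefficient, so it differs between the two
    -- sides; `partial-stable` makes up for this.
    ∘ˢ-horner : ∀ a → a ∘ˢ h ≈ˢ constˢ (a 0) +ˢ (shift a ∘ˢ h) *ˢ h
    ∘ˢ-horner a zero = trans (partial-zero a 0) (sym (trans (+-congˡ (*ˢ-h-zero (shift a ∘ˢ h))) (+-identityʳ _)))
    ∘ˢ-horner a (suc n) = begin
      (a ∘ˢ h) (suc n)
        ≈⟨ partial-at-suc a (suc n) n ⟩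
      (partial (shift a) (suc n) *ˢ h) (suc n)
        ≈⟨ *ˢ-h-cong {partial (shift a) (suc n)} {shift a ∘ˢ h} n (λ k k≤n → partial-stable n (shift a) (suc n) k k≤n (s≤s k≤n)) ⟩
      ((shift a ∘ˢ h) *ˢ h) (suc n)
        ≈⟨ +-identityˡ _ ⟨
      0# + ((shift a ∘ˢ h) *ˢ h) (suc n) ∎

    ∘ˢ-zero : ∀ a → (a ∘ˢ h) 0 ≈ a 0
    ∘ˢ-zero a = partial-zero a 0

    ∘ˢ-suc : ∀ a n → (a ∘ˢ h) (suc n) ≈ ((shift a ∘ˢ h) *ˢ h) (suc n)
    ∘ˢ-suc a n = trans (∘ˢ-horner a (suc n)) (+-identityˡ _)

    ∘ˢ-cong : ∀ {a b} → a ≈ˢ b → a ∘ˢ h ≈ˢ b ∘ˢ h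
    ∘ˢ-cong p n = sum-cong-≋ {suc n} λ k → *-congʳ {(h ^ˢ toℕ k) n} (p (toℕ k))

    private
      module S = CommutativeRing seriesRing
      module SS = IntegerSolver seriesRing

      -- Identities that hold up to order n are multiplied by h to hold up to order n + 1.

      induction : ∀ {i} {I : Set i} {F G : I → Series} →
        (∀ n → (∀ i k → k ℕ.≤ n → F i k ≈ G i k) → ∀ i → F i (suc n) ≈ G i (suc n)) →
        (∀ i → F i 0 ≈ G i 0) → ∀ i → F i ≈ˢ G i
      induction {F = F} {G} step init i n = below n i n ℕₚ.≤-refl
        where
        below : ∀ n i k → k ℕ.≤ n → F i k ≈ G i k
        below zero    i zero    _   = init i
        below (suc n) i zero    _   = init i
        below (suc n) i (suc k) (s≤s k≤n) = step k (λ j l l≤k → below n j l (ℕₚ.≤-trans l≤k k≤n)) i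

    ∘ˢ-+ : ∀ a b → (a +ˢ b) ∘ˢ h ≈ˢ (a ∘ˢ h) +ˢ (b ∘ˢ h)
    ∘ˢ-+ = λ a b → induction {F = λ (a , b) → (a +ˢ b) ∘ˢ h} {λ (a , b) → (a ∘ˢ h) +ˢ (b ∘ˢ h)}
      (λ n ih (a , b) → begin
        ((a +ˢ b) ∘ˢ h) (suc n)
          ≈⟨ ∘ˢ-suc (a +ˢ b) n ⟩
        (((shift a +ˢ shift b) ∘ˢ h) *ˢ h) (suc n)
          ≈⟨ *ˢ-h-cong {(shift a +ˢ shift b) ∘ˢ h} {(shift a ∘ˢ h) +ˢ (shift b ∘ˢ h)} n (ih (shift a , shift b)) ⟩
        (((shift a ∘ˢ h) +ˢ (shift b ∘ˢ h)) *ˢ h) (suc n)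
          ≈⟨ *ˢ-distribʳ h (shift a ∘ˢ h) (shift b ∘ˢ h) (suc n) ⟩
        ((shift a ∘ˢ h) *ˢ h) (suc n) + ((shift b ∘ˢ h) *ˢ h) (suc n)
          ≈⟨ +-cong (∘ˢ-suc a n) (∘ˢ-suc b n) ⟨
        (a ∘ˢ h) (suc n) + (b ∘ˢ h) (suc n) ∎)
      (λ (a , b) → trans (∘ˢ-zero (a +ˢ b)) (sym (+-cong (∘ˢ-zero a) (∘ˢ-zero b))))
      (a , b)

    ∘ˢ-scale : ∀ c a n → ((λ i → c * a i) ∘ˢ h) n ≈ c * (a ∘ˢ h) n
    ∘ˢ-scale c = induction {F = λ a → (λ i → c * a i) ∘ˢ h} {λ a i → c * (a ∘ˢ h) i}
      (λ n ih a → begin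
        ((λ i → c * a i) ∘ˢ h) (suc n)
          ≈⟨ ∘ˢ-suc (λ i → c * a i) n ⟩
        (((λ i → c * shift a i) ∘ˢ h) *ˢ h) (suc n)
          ≈⟨ *ˢ-h-cong {(λ i → c * shift a i) ∘ˢ h} {λ i → c * (shift a ∘ˢ h) i} n (ih (shift a)) ⟩
        ((λ i → c * (shift a ∘ˢ h) i) *ˢ h) (suc n)
          ≈⟨ *ˢ-scaleˡ c (shift a ∘ˢ h) h (suc n) ⟩
        c * ((shift a ∘ˢ h) *ˢ h) (suc n)
          ≈⟨ *-congˡ (∘ˢ-suc a n) ⟨
        c * (a ∘ˢ h) (suc n) ∎)
      (λ a → trans (∘ˢ-zero (λ i → c * a i)) (*-congˡ (sym (∘ˢ-zero a))))

    ∘ˢ-constˢ : ∀ c → constˢ c ∘ˢ h ≈ˢ constˢ c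
    ∘ˢ-constˢ c n = trans (∘ˢ-horner (constˢ c) n) (trans (+-congˡ (vanish n)) (at (S.+-identityʳ (constˢ c)) n))
      where
      zero∘ : (0ˢ ∘ˢ h) ≈ˢ 0ˢ
      -- The zero series is 0 times itself, which brings it within reach of `∘ˢ-scale`.
      zero∘ = at (S.trans (coefficientwise (λ n → trans (∘ˢ-cong {0ˢ} {λ i → 0# * 0ˢ i} (at scaled) n) (∘ˢ-scale 0# 0ˢ n)))
        (coefficientwise λ { zero → zeroˡ _ ; (suc n) → zeroˡ _ }))
        where
        scaled : 0ˢ ≋ (λ i → 0# * 0ˢ i)
        scaled = coefficientwise λ { zero → sym (zeroˡ _) ; (suc n) → sym (zeroˡ _) }
      vanish : ((shift (constˢ c) ∘ˢ h) *ˢ h) ≈ˢ 0ˢ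
      vanish = at (S.trans (S.*-congʳ {h} {shift (constˢ c) ∘ˢ h} {0ˢ} (coefficientwise λ n → trans
        (∘ˢ-cong {shift (constˢ c)} {0ˢ} (λ { zero → refl ; (suc n) → refl }) n) (zero∘ n))) (S.zeroˡ h))

    X-∘ˢ : X ∘ˢ h ≈ˢ h
    X-∘ˢ zero    = trans (∘ˢ-zero X) (sym h₀≈0)
    X-∘ˢ (suc n) = begin
      (X ∘ˢ h) (suc n)              ≈⟨ ∘ˢ-suc X n ⟩
      ((shift X ∘ˢ h) *ˢ h) (suc n) ≈⟨ *ˢ-cong {shift X ∘ˢ h} {1ˢ} {h} {h} shiftX∘ (λ _ → refl) (suc n) ⟩
      (1ˢ *ˢ h) (suc n)             ≈⟨ *ˢ-identityˡ h (suc n) ⟩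
      h (suc n)                     ∎
      where
      shiftX∘ : shift X ∘ˢ h ≈ˢ 1ˢ
      shiftX∘ n = trans (∘ˢ-cong {shift X} {1ˢ} (λ { zero → refl ; (suc i) → refl }) n) (∘ˢ-constˢ 1# n)

    ∘ˢ-* : ∀ a b → (a *ˢ b) ∘ˢ h ≈ˢ (a ∘ˢ h) *ˢ (b ∘ˢ h)
    ∘ˢ-* = λ a b → induction {F = λ (a , b) → (a *ˢ b) ∘ˢ h} {λ (a , b) → (a ∘ˢ h) *ˢ (b ∘ˢ h)}
      (λ n ih (a , b) → begin
        ((a *ˢ b) ∘ˢ h) (suc n)
          ≈⟨ ∘ˢ-suc (a *ˢ b) n ⟩
        ((((λ i → a 0 * shift b i) +ˢ shift a *ˢ b) ∘ˢ h) *ˢ h) (suc n)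
          ≈⟨ *ˢ-h-cong
               {((λ i → a 0 * shift b i) +ˢ shift a *ˢ b) ∘ˢ h}
               {constˢ (a 0) *ˢ (shift b ∘ˢ h) +ˢ (shift a ∘ˢ h) *ˢ (b ∘ˢ h)} n
               (λ k k≤n → trans (∘ˢ-+ (λ i → a 0 * shift b i) (shift a *ˢ b) k) (+-cong
                 (trans (∘ˢ-scale (a 0) (shift b) k) (sym (constˢ-* (a 0) (shift b ∘ˢ h) k)))
                 (ih (shift a , b) k k≤n))) ⟩
        ((constˢ (a 0) *ˢ (shift b ∘ˢ h) +ˢ (shift a ∘ˢ h) *ˢ (b ∘ˢ h)) *ˢ h) (suc n)
          ≈⟨ at (SS.solve 5 (λ c u v w h → (c SS.:* u SS.:+ v SS.:* w) SS.:* h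
               SS.:= c SS.:* (u SS.:* h) SS.:+ (v SS.:* h) SS.:* w) S.refl
               (constˢ (a 0)) (shift b ∘ˢ h) (shift a ∘ˢ h) (b ∘ˢ h) h) (suc n) ⟩
        (constˢ (a 0) *ˢ ((shift b ∘ˢ h) *ˢ h)) (suc n) + (((shift a ∘ˢ h) *ˢ h) *ˢ (b ∘ˢ h)) (suc n)
          ≈⟨ +-congʳ (trans (constˢ-* (a 0) ((shift b ∘ˢ h) *ˢ h) (suc n))
               (trans (*-congˡ (sym (∘ˢ-suc b n))) (sym (constˢ-* (a 0) (b ∘ˢ h) (suc n))))) ⟩
        (constˢ (a 0) *ˢ (b ∘ˢ h)) (suc n) + (((shift a ∘ˢ h) *ˢ h) *ˢ (b ∘ˢ h)) (suc n)
          ≈⟨ *ˢ-distribʳ (b ∘ˢ h) (constˢ (a 0)) ((shift a ∘ˢ h) *ˢ h) (suc n) ⟨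
        ((constˢ (a 0) +ˢ (shift a ∘ˢ h) *ˢ h) *ˢ (b ∘ˢ h)) (suc n)
          ≈⟨ *ˢ-cong {a ∘ˢ h} {constˢ (a 0) +ˢ (shift a ∘ˢ h) *ˢ h} {b ∘ˢ h} {b ∘ˢ h} (∘ˢ-horner a) (λ _ → refl) (suc n) ⟨
        ((a ∘ˢ h) *ˢ (b ∘ˢ h)) (suc n) ∎)
      (λ (a , b) → trans (∘ˢ-zero (a *ˢ b)) (trans (*ˢ-zero a b)
        (trans (sym (*-cong (∘ˢ-zero a) (∘ˢ-zero b))) (sym (*ˢ-zero (a ∘ˢ h) (b ∘ˢ h))))))
      (a , b)

    chain-rule : ∀ a → θ (a ∘ˢ h) ≈ˢ (derivative a ∘ˢ h) *ˢ θ h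
    chain-rule = induction {F = λ a → θ (a ∘ˢ h)} {λ a → (derivative a ∘ˢ h) *ˢ θ h}
      (λ n ih a → begin
        θ (a ∘ˢ h) (suc n)
          ≈⟨ θ-cong (∘ˢ-horner a) (suc n) ⟩
        θ (constˢ (a 0) +ˢ (shift a ∘ˢ h) *ˢ h) (suc n)
          ≈⟨ θ-+ (constˢ (a 0)) ((shift a ∘ˢ h) *ˢ h) (suc n) ⟩
        θ (constˢ (a 0)) (suc n) + θ ((shift a ∘ˢ h) *ˢ h) (suc n)
          ≈⟨ +-cong (θ-constˢ (a 0) (suc n)) (θ-* (shift a ∘ˢ h) h (suc n)) ⟩
        0# + ((θ (shift a ∘ˢ h) *ˢ h) (suc n) + ((shift a ∘ˢ h) *ˢ θ h) (suc n))
          ≈⟨ trans (+-identityˡ _) (+-congʳ (*ˢ-h-cong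
               {θ (shift a ∘ˢ h)} {(derivative (shift a) ∘ˢ h) *ˢ θ h} n (ih (shift a)))) ⟩
        (((derivative (shift a) ∘ˢ h) *ˢ θ h) *ˢ h) (suc n) + ((shift a ∘ˢ h) *ˢ θ h) (suc n)
          ≈⟨ at (SS.solve 4 (λ u t h v → (u SS.:* t) SS.:* h SS.:+ v SS.:* t
               SS.:= (v SS.:+ h SS.:* u) SS.:* t) S.refl
               (derivative (shift a) ∘ˢ h) (θ h) h (shift a ∘ˢ h)) (suc n) ⟩
        (((shift a ∘ˢ h) +ˢ h *ˢ (derivative (shift a) ∘ˢ h)) *ˢ θ h) (suc n)
          ≈⟨ *ˢ-cong {derivative a ∘ˢ h} {(shift a ∘ˢ h) +ˢ h *ˢ (derivative (shift a) ∘ˢ h)} {θ h} {θ h}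
               (derivative∘ a) (λ _ → refl) (suc n) ⟨
        ((derivative a ∘ˢ h) *ˢ θ h) (suc n) ∎)
      (λ a → sym (trans (*ˢ-zero (derivative a ∘ˢ h) (θ h)) (zeroʳ _)))
      where
      derivative∘ : ∀ a → derivative a ∘ˢ h ≈ˢ (shift a ∘ˢ h) +ˢ h *ˢ (derivative (shift a) ∘ˢ h)
      derivative∘ a n = begin
        (derivative a ∘ˢ h) n
          ≈⟨ ∘ˢ-cong {derivative a} {shift a +ˢ X *ˢ derivative (shift a)} (derivative-horner a) n ⟩
        ((shift a +ˢ X *ˢ derivative (shift a)) ∘ˢ h) n
          ≈⟨ ∘ˢ-+ (shift a) (X *ˢ derivative (shift a)) n ⟩
        (shift a ∘ˢ h) n + ((X *ˢ derivative (shift a)) ∘ˢ h) n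
          ≈⟨ +-congˡ (∘ˢ-* X (derivative (shift a)) n) ⟩
        (shift a ∘ˢ h) n + ((X ∘ˢ h) *ˢ (derivative (shift a) ∘ˢ h)) n
          ≈⟨ +-congˡ (*ˢ-cong {X ∘ˢ h} {h} {derivative (shift a) ∘ˢ h} {derivative (shift a) ∘ˢ h}
               X-∘ˢ (λ _ → refl) n) ⟩
        (shift a ∘ˢ h) n + (h *ˢ (derivative (shift a) ∘ˢ h)) n ∎

    -- The chain rule with denominators cleared: (h / θ h) θ acts on a ∘ h as θ acts on a. For the
    -- mirror map this operator is D = z d/dz.
    h-*-θ : ∀ a → h *ˢ θ (a ∘ˢ h) ≈ˢ (θ a ∘ˢ h) *ˢ θ h
    h-*-θ a n = begin
      (h *ˢ θ (a ∘ˢ h)) n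
        ≈⟨ *ˢ-cong {h} {h} {θ (a ∘ˢ h)} {(derivative a ∘ˢ h) *ˢ θ h} (λ _ → refl) (chain-rule a) n ⟩
      (h *ˢ ((derivative a ∘ˢ h) *ˢ θ h)) n
        ≈⟨ *ˢ-assoc h (derivative a ∘ˢ h) (θ h) n ⟨
      ((h *ˢ (derivative a ∘ˢ h)) *ˢ θ h) n
        ≈⟨ *ˢ-cong {θ a ∘ˢ h} {h *ˢ (derivative a ∘ˢ h)} {θ h} {θ h} θ∘ (λ _ → refl) n ⟨
      ((θ a ∘ˢ h) *ˢ θ h) n ∎
      where
      θ∘ : θ a ∘ˢ h ≈ˢ h *ˢ (derivative a ∘ˢ h)
      θ∘ n = trans (sym (∘ˢ-cong {X *ˢ derivative a} {θ a} (X-*-derivative a) n)) (trans (∘ˢ-* X (derivative a) n)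
        (*ˢ-cong {X ∘ˢ h} {h} {derivative a ∘ˢ h} {derivative a ∘ˢ h} X-∘ˢ (λ _ → refl) n))

  module _ (f : Series) (f₀≈1 : f 0 ≈ 1#) where

    private
      module S = CommutativeRing seriesRing
      module SS = IntegerSolver seriesRing

    -- Geometric series: with all coefficients equal to 1, the Horner form of r = `recip f` reads r
    -- = 1 + r (1 - f).
    recip-inverse : f *ˢ recip f ≋ 1ˢ
    recip-inverse = S.trans
      (SS.solve 2 (λ f r → f SS.:* r SS.:= r SS.:- r SS.:* (SS.con (+ 1) SS.:- f)) S.refl f (recip f))
      (S.trans (S.+-congʳ {S.- (recip f S.* (S.1# S.- f))} (coefficientwise (∘ˢ-horner (λ _ → 1#))))
        (SS.solve 2 (λ f r → (SS.con (+ 1) SS.:+ r SS.:* (SS.con (+ 1) SS.:- f))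
           SS.:- r SS.:* (SS.con (+ 1) SS.:- f) SS.:= SS.con (+ 1)) S.refl f (recip f)))
      where open Composition (1ˢ -ˢ f) (trans (+-congˡ (-‿cong f₀≈1)) (-‿inverseʳ 1#))

-- The operators (s T + 1)⋯(s T + j) and their leading coefficients

module Pochhammer (S : CommutativeRing 0ℓ 0ℓ) where

  open CommutativeRing S
  open RawMonoidDefs +-rawMonoid using () renaming (_×_ to _·_)
  open Subrings S
  open IntegerSolver S
  open ≈-Reasoning setoid

  -- If H k = Tᵏ h then pochhammer s H j i = (s T + 1)(s T + 2)⋯(s T + j) Tⁱ h.

  pochhammer : Carrier → (ℕ → Carrier) → ℕ → ℕ → Carrier
  pochhammer s H zero    i = H i
  pochhammer s H (suc j) i = s * pochhammer s H j (suc i) + (suc j · 1#) * pochhammer s H j i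

  power : Carrier → ℕ → Carrier
  power s zero    = 1#
  power s (suc j) = s * power s j

  power-cong : ∀ k {x y} → x ≈ y → power x k ≈ power y k
  power-cong zero    e = refl
  power-cong (suc k) e = *-cong e (power-cong k e)

  power-* : ∀ x y k → power (x * y) k ≈ power x k * power y k
  power-* x y zero    = sym (*-identityˡ _)
  power-* x y (suc k) = trans (*-congˡ (power-* x y k))
    (solve 4 (λ x y p q → (x :* y) :* (p :* q) := (x :* p) :* (y :* q)) refl x y _ _)

  -- A property of single elements, because cancellation will take place among dual numbers, which
  -- have zero divisors.
  Cancellable : Carrier → Set
  Cancellable u = ∀ {x y} → u * x ≈ u * y → x ≈ y

  1-cancellable : Cancellable 1#
  1-cancellable e = trans (sym (*-identityˡ _)) (trans e (*-identityˡ _))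

  *-cancellable : ∀ {u v} → Cancellable u → Cancellable v → Cancellable (u * v)
  *-cancellable p q e = q (p (trans (sym (*-assoc _ _ _)) (trans e (*-assoc _ _ _))))

  power-cancellable : ∀ {u} k → Cancellable u → Cancellable (power u k)
  power-cancellable zero    p = 1-cancellable
  power-cancellable {u} (suc k) p = *-cancellable {u} p (power-cancellable k p)

  -- d = b / aⁿ and d′ = b′ / (a u)ⁿ with b′ = s u p b.

  ratio-step : ∀ {a a′ b b′ d d′ u p s} n → Cancellable a → Cancellable u →
    d * power a (suc n) ≈ b → d′ * power a′ (suc n) ≈ b′ →
    a′ ≈ u * a → b′ ≈ ((s * u) * p) * b →
    power u n * d′ ≈ s * (p * d)
  ratio-step {a} {a′} {b} {b′} {d} {d′} {u} {p} {s} n ca cu d≈ d′≈ a′≈ b′≈ =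
    cu (power-cancellable (suc n) ca (begin
      power a (suc n) * (u * (power u n * d′))
        ≈⟨ solve 4 (λ A u p d → A :* (u :* (p :* d)) := d :* ((u :* p) :* A))
             refl (power a (suc n)) u (power u n) d′ ⟩
      d′ * (power u (suc n) * power a (suc n))
        ≈⟨ *-congˡ (trans (power-cong (suc n) a′≈) (power-* u a (suc n))) ⟨
      d′ * power a′ (suc n)
        ≈⟨ trans d′≈ b′≈ ⟩
      ((s * u) * p) * b
        ≈⟨ *-congˡ d≈ ⟨
      ((s * u) * p) * (d * power a (suc n))
        ≈⟨ solve 5 (λ A u s p d → ((s :* u) :* p) :* (d :* A) := A :* (u :* (s :* (p :* d))))
             refl (power a (suc n)) u s p d ⟩
      power a (suc n) * (u * (s * (p * d))) ∎))

  comb-suc : ∀ {K : Carrier → Set} {n F G x x′} → Comb S K n F G x x′ → Comb S K (suc n) F G x x′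
  comb-suc (term k<)     = term (ℕₚ.m≤n⇒m≤1+n k<)
  comb-suc null          = null
  comb-suc (sum p q)     = sum (comb-suc p) (comb-suc q)
  comb-suc (scale c p)   = scale c (comb-suc p)
  comb-suc (resp e e′ p) = resp e e′ (comb-suc p)

  module _ {K : Carrier → Set} (K-sub : IsSubring K) where

    open IsSubring K-sub hiding (resp)

    multiple∈ : ∀ n → K (n · 1#)
    multiple∈ zero    = nil
    multiple∈ (suc n) = add one (multiple∈ n)

    power∈ : ∀ {s} → K s → ∀ j → K (power s j)
    power∈ k zero    = one
    power∈ k (suc j) = mul k (power∈ k j)

    -- Each factor s T + i contributes s to the leading coefficient. Both sequences are expanded at
    -- once, since the lower terms must have the same coefficients for either.
    pochhammer-leading : ∀ {s} → K s → ∀ F G j i → ∃[ r ] ∃[ r′ ] Comb S K (i ℕ.+ j) F G r r′ ×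
      pochhammer s F j i ≈ power s j * F (i ℕ.+ j) + r ×
      pochhammer s G j i ≈ power s j * G (i ℕ.+ j) + r′
    pochhammer-leading k F G zero i = 0# , 0# , null , unit F , unit G
      where
      unit : ∀ (H : ℕ → Carrier) → H i ≈ 1# * H (i ℕ.+ 0) + 0#
      unit H = trans (reflexive (≡.cong H (≡.sym (ℕₚ.+-identityʳ i))))
        (sym (trans (+-identityʳ _) (*-identityˡ _)))
    pochhammer-leading {s} k F G (suc j) i
      rewrite ℕₚ.+-suc i j
      with pochhammer-leading k F G j (suc i) | pochhammer-leading k F G j i
    ... | r₁ , r₁′ , c₁ , e₁ , e₁′ | r₂ , r₂′ , c₂ , e₂ , e₂′ =
      s * r₁ + (suc j · 1#) * (power s j * F (i ℕ.+ j) + r₂)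
      , s * r₁′ + (suc j · 1#) * (power s j * G (i ℕ.+ j) + r₂′)
      , sum (scale k c₁) (scale (multiple∈ (suc j)) (sum (scale (power∈ k j) (term ℕₚ.≤-refl)) (comb-suc c₂)))
      , expand e₁ e₂ , expand e₁′ e₂′
      where
      expand : ∀ {p q u r v} → p ≈ power s j * u + r → q ≈ v →
        s * p + (suc j · 1#) * q ≈ (s * power s j) * u + (s * r + (suc j · 1#) * v)
      expand {p} {q} {u} {r} {v} e e′ = trans (+-cong (*-congˡ e) (*-congˡ e′))
        (solve 6 (λ s a u r b v → s :* (a :* u :+ r) :+ b :* v := (s :* a) :* u :+ (s :* r :+ b :* v))
          refl s (power s j) u r (suc j · 1#) v)

    -- The equation F N = x (s T + 1)⋯(s T + N) s F 0 solved for F N.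

    solve-leading : ∀ {s x} → K s → K x → ∀ F G N →
      F N ≈ x * (s * pochhammer s F N 0) → G N ≈ x * (s * pochhammer s G N 0) →
      let a = 1# - x * (s * power s N)
      in Comb S K N F G (a * F N) (a * G N)
    solve-leading {s} {x} ks kx F G N eF eG =
      let r , r′ , c , e , e′ = pochhammer-leading ks F G N 0
      in resp (expand e eF) (expand e′ eG) (scale (mul kx ks) c)
      where
      expand : ∀ {p u r} → p ≈ power s N * u + r → u ≈ x * (s * p) →
        (x * s) * r ≈ (1# - x * (s * power s N)) * u
      expand {p} {u} {r} e eq = begin
        (x * s) * r
          ≈⟨ solve 5 (λ x s r q u → (x :* s) :* r := x :* (s :* (q :* u :+ r)) :- x :* (s :* q) :* u)
               refl x s r (power s N) u ⟩
        x * (s * (power s N * u + r)) - x * (s * power s N) * u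
          ≈⟨ +-congʳ (*-congˡ (*-congˡ e)) ⟨
        x * (s * p) - x * (s * power s N) * u
          ≈⟨ +-congʳ eq ⟨
        u - x * (s * power s N) * u
          ≈⟨ solve 2 (λ u q → u :- q :* u := (con (+ 1) :- q) :* u) refl u _ ⟩
        (1# - x * (s * power s N)) * u ∎

-- Substitution of the mirror map into the two solutions

-- φ is the substitution of the mirror map, from series in z to (fractions of) series in q.

record Substitution (S : CommutativeRing 0ℓ 0ℓ) (D : DifferentialField) (T : Jets D) : Set₁ where
  private
    module S = CommutativeRing S
  open DifferentialField D
  open Jets T
  field
    y₀≉0      : ¬ y 0 ≈ 0#
    θ         : S.Carrier → S.Carrier
    θ-*       : ∀ x y → θ (x S.* y) S.≈ θ x S.* y S.+ x S.* θ y
    X         : S.Carrier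
    θX≈X      : θ X S.≈ X
    φ         : S.Carrier → Carrier
    φ-cong    : ∀ {x y} → x S.≈ y → φ x ≈ φ y
    φ-+       : ∀ x y → φ (x S.+ y) ≈ φ x + φ y
    φ-*       : ∀ x y → φ (x S.* y) ≈ φ x * φ y
    φ-1       : φ S.1# ≈ 1#
    φX≈y₀     : φ X ≈ y 0
    chain     : ∀ x → y 0 * ∂ (φ x) ≈ φ (θ x) * ∂ (y 0)
    g E U     : S.Carrier
    U-inverse : (S.1# S.+ θ g) S.* U S.≈ S.1#
    θE        : θ E S.≈ E S.* θ g
    q         : Carrier
    q≉0       : ¬ q ≈ 0#
    ∂q≈q      : ∂ q ≈ q
    φ[XE]≈q   : φ (X S.* E) ≈ q
    F G       : ℕ → S.Carrier
    F-suc     : ∀ i → F (suc i) S.≈ θ (F i)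
    G-suc     : ∀ i → G (suc i) S.≈ θ (G i) S.+ F i
    G₀        : G 0 S.≈ g S.* F 0
    F₀≉0      : ¬ φ (F 0) ≈ 0#

module Mirror
  (em : ExcludedMiddle 0ℓ)
  (S : CommutativeRing 0ℓ 0ℓ) (D : DifferentialField) (T : Jets D) (P : Substitution S D T)
  where

  private
    module S = CommutativeRing S
    module SS = IntegerSolver S
  open DifferentialField D
  open Subrings ring
  open Jets T
  open Substitution P
  open IntegerSolver ring
  open ≈-Reasoning setoid

  -- From t = log z + g follows D t = 1 + θ g, read as a function of q; this is W.
  W V : Carrier
  W = φ (S.1# S.+ θ g)
  V = φ U

  VW≈1 : V * W ≈ 1#
  VW≈1 = trans (*-comm V W) (trans (sym (φ-* _ _)) (trans (φ-cong U-inverse) φ-1))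

  -- The logarithmic derivative of q = z exp g.

  z≈W∂z : y 0 ≈ W * ∂ (y 0)
  z≈W∂z = *-cancelˡ 1≉0 domain q≉0 (begin
    q * y 0                                  ≈⟨ *-comm q (y 0) ⟩
    y 0 * q                                  ≈⟨ *-congˡ ∂q≈q ⟨
    y 0 * ∂ q                                ≈⟨ *-congˡ (∂-cong φ[XE]≈q) ⟨
    y 0 * ∂ (φ (X S.* E))                    ≈⟨ chain (X S.* E) ⟩
    φ (θ (X S.* E)) * ∂ (y 0)                ≈⟨ *-congʳ (φ-cong θ[XE]) ⟩
    φ ((X S.* E) S.* (S.1# S.+ θ g)) * ∂ (y 0) ≈⟨ *-congʳ (trans (φ-* _ _) (*-congʳ φ[XE]≈q)) ⟩
    (q * W) * ∂ (y 0)                        ≈⟨ *-assoc _ _ _ ⟩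
    q * (W * ∂ (y 0))                        ∎)
    where
    θ[XE] : θ (X S.* E) S.≈ (X S.* E) S.* (S.1# S.+ θ g)
    θ[XE] = S.trans (θ-* X E) (S.trans (S.+-cong (S.*-congʳ θX≈X) (S.*-congˡ θE))
      (SS.solve 3 (λ X E g → X SS.:* E SS.:+ X SS.:* (E SS.:* g)
         SS.:= (X SS.:* E) SS.:* (SS.con (+ 1) SS.:+ g)) S.refl X E (θ g)))

  ∂z≈Vz : ∂ (y 0) ≈ V * y 0
  ∂z≈Vz = begin
    ∂ (y 0)              ≈⟨ *-identityˡ _ ⟨
    1# * ∂ (y 0)         ≈⟨ *-congʳ VW≈1 ⟨
    (V * W) * ∂ (y 0)    ≈⟨ *-assoc _ _ _ ⟩
    V * (W * ∂ (y 0))    ≈⟨ *-congˡ z≈W∂z ⟨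
    V * y 0              ∎

  φ-0 : φ S.0# ≈ 0#
  φ-0 = begin
    φ S.0#                        ≈⟨ solve 1 (λ u → u := (u :+ u) :- u) refl (φ S.0#) ⟩
    (φ S.0# + φ S.0#) - φ S.0#    ≈⟨ +-congʳ (φ-+ _ _) ⟨
    φ (S.0# S.+ S.0#) - φ S.0#    ≈⟨ +-congʳ (φ-cong (S.+-identityˡ S.0#)) ⟩
    φ S.0# - φ S.0#               ≈⟨ -‿inverseʳ _ ⟩
    0#                            ∎

  ∂-φ : ∀ x → ∂ (φ x) ≈ V * φ (θ x)
  ∂-φ x = *-cancelˡ 1≉0 domain y₀≉0 (begin
    y 0 * ∂ (φ x)          ≈⟨ chain x ⟩
    φ (θ x) * ∂ (y 0)      ≈⟨ *-congˡ ∂z≈Vz ⟩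
    φ (θ x) * (V * y 0)    ≈⟨ solve 3 (λ f V y → f :* (V :* y) := y :* (V :* f)) refl _ V (y 0) ⟩
    y 0 * (V * φ (θ x))    ∎)

  -- The log-free part of θⁱ(f₀ log z + g₁) is G i, and its logarithmic part is F i log z.
  -- Subtracting (log z + g) F i, which is t θⁱf₀, cancels the logarithm and leaves G i - g F i.
  f m : ℕ → Carrier
  f i = φ (F i)
  m i = φ (G i) - φ g * φ (F i)

  ∂-f : ∀ i → ∂ (f i) ≈ V * f (suc i)
  ∂-f i = trans (∂-φ (F i)) (*-congˡ (φ-cong (S.sym (F-suc i))))

  m₀≈0 : m 0 ≈ 0#
  m₀≈0 = trans (+-congʳ (trans (φ-cong G₀) (φ-* g (F 0)))) (-‿inverseʳ _)

  ∂-minus : ∀ u v → ∂ (u - v) ≈ ∂ u - ∂ v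
  ∂-minus u v = begin
    ∂ (u - v)                    ≈⟨ solve 2 (λ d v → d := (d :+ v) :- v) refl _ (∂ v) ⟩
    (∂ (u - v) + ∂ v) - ∂ v      ≈⟨ +-congʳ (∂-+ (u - v) v) ⟨
    ∂ ((u - v) + v) - ∂ v        ≈⟨ +-congʳ (∂-cong (solve 2 (λ u v → (u :- v) :+ v := u) refl u v)) ⟩
    ∂ u - ∂ v                    ∎

  ∂-m : ∀ i → ∂ (m i) + f i ≈ V * m (suc i)
  ∂-m i = begin
    ∂ (m i) + f i
      ≈⟨ +-cong (trans (∂-minus _ _) (+-congˡ (-‿cong (∂-* _ _)))) (sym (*-identityˡ _)) ⟩
    (∂ (φ (G i)) - (∂ (φ g) * f i + φ g * ∂ (f i))) + 1# * f i
      -- The summand f i, which stems from ∂t = 1, is multiplied by 1 = V W = V (1 + φ (θ g)), so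
      -- that V factors out of the whole sum.
      ≈⟨ +-cong (+-cong (∂-φ (G i)) (-‿cong (+-cong (*-congʳ (∂-φ g)) (*-congˡ (∂-f i)))))
           (*-congʳ (sym (trans (*-congˡ (sym (trans (φ-+ _ _) (+-congʳ φ-1)))) VW≈1))) ⟩
    (V * φ (θ (G i)) - (V * φ (θ g) * f i + φ g * (V * f (suc i)))) + V * (1# + φ (θ g)) * f i
      ≈⟨ solve 6 (λ V G′ g′ f g f⁺ →
           (V :* G′ :- (V :* g′ :* f :+ g :* (V :* f⁺))) :+ V :* (con (+ 1) :+ g′) :* f
           := V :* ((G′ :+ f) :- g :* f⁺)) refl V (φ (θ (G i))) (φ (θ g)) (f i) (φ g) (f (suc i)) ⟩
    V * ((φ (θ (G i)) + f i) - φ g * f (suc i))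
      ≈⟨ *-congˡ (+-congʳ (trans (φ-cong (G-suc i)) (φ-+ _ _))) ⟨
    V * m (suc i) ∎

  pair : LogarithmicPair D T
  pair = record
    { y₀≉0 = y₀≉0
    ; V = V
    ; W = W
    ; VW≈1 = VW≈1
    ; Vy₀≈y₁ = trans (sym ∂z≈Vz) (∂-y 0)
    ; f = f
    ; m = m
    ; f₀≉0 = F₀≉0
    ; ∂-f = ∂-f
    ; m₀≈0 = m₀≈0
    ; ∂-m = ∂-m
    }

  open JetFields em D T using (J; y∈J; module J)
  open LinearSystem em D T pair using (y-rational)
  open Pochhammer S using (pochhammer; power; solve-leading)

  K : S.Carrier → Set
  K x = J 1 (φ x)

  K-sub : Subrings.IsSubring S K
  K-sub = record
    { resp = λ e → J.resp 1 (φ-cong e)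
    ; one  = J.resp 1 (sym φ-1) (J.one 1)
    ; add  = λ p q → J.resp 1 (sym (φ-+ _ _)) (J.add 1 p q)
    ; mul  = λ p q → J.resp 1 (sym (φ-* _ _)) (J.mul 1 p q)
    ; neg  = λ {x} p → J.resp 1 (trans (sym (+-identityˡ _)) (trans (+-congʳ (sym (φ-inverse x)))
        (solve 2 (λ u v → (v :+ u) :- u := v) refl (φ x) (φ (S.- x))))) (J.neg 1 p)
    }
    where
    φ-inverse : ∀ x → φ (S.- x) + φ x ≈ 0#
    φ-inverse x = trans (sym (φ-+ _ _)) (trans (φ-cong (S.-‿inverseˡ x)) φ-0)

  -- The expression φ x′ - φ g φ x is linear over φ in the pair (x, x′), and it sends (F k, G k) to
  -- m k. So a relation shared by F and G becomes one shared by f and m.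
  φ-comb : ∀ {n x x′} → Comb S K n F G x x′ → Comb ring (J 1) n f m (φ x) (φ x′ - φ g * φ x)
  φ-comb (term k<)   = term k<
  φ-comb null        = resp refl′ (begin
    0#              ≈⟨ solve 2 (λ z g → con (+ 0) := con (+ 0) :- g :* con (+ 0)) refl 0# (φ g) ⟩
    0# - φ g * 0#   ≈⟨ +-cong refl′ (-‿cong (*-congˡ refl′)) ⟩
    φ S.0# - φ g * φ S.0# ∎) null
    where
    refl′ : 0# ≈ φ S.0#
    refl′ = sym φ-0
  φ-comb (sum {x} {x′} {w} {w′} p q) = resp (sym (φ-+ _ _))
    (begin
      (φ x′ - φ g * φ x) + (φ w′ - φ g * φ w)
        ≈⟨ solve 5 (λ x′ x w′ w g → (x′ :- g :* x) :+ (w′ :- g :* w) := (x′ :+ w′) :- g :* (x :+ w))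
             refl (φ x′) (φ x) (φ w′) (φ w) (φ g) ⟩
      (φ x′ + φ w′) - φ g * (φ x + φ w)
        ≈⟨ +-cong (φ-+ _ _) (-‿cong (*-congˡ (φ-+ _ _))) ⟨
      φ (x′ S.+ w′) - φ g * φ (x S.+ w) ∎)
    (sum (φ-comb p) (φ-comb q))
  φ-comb (scale {c} {x} {x′} k p) = resp (sym (φ-* _ _))
    (begin
      φ c * (φ x′ - φ g * φ x)
        ≈⟨ solve 4 (λ c x′ x g → c :* (x′ :- g :* x) := c :* x′ :- g :* (c :* x))
             refl (φ c) (φ x′) (φ x) (φ g) ⟩
      φ c * φ x′ - φ g * (φ c * φ x)
        ≈⟨ +-cong (φ-* _ _) (-‿cong (*-congˡ (φ-* _ _))) ⟨
      φ (c S.* x′) - φ g * φ (c S.* x) ∎)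
    (scale k (φ-comb p))
  φ-comb (resp e e′ p) = resp (φ-cong e) (+-cong (φ-cong e′) (-‿cong (*-congˡ (φ-cong e)))) (φ-comb p)

  module _ (n : ℕ) {ŝ : S.Carrier} (ŝ∈K : K ŝ)
    (F-ode : F (suc n) S.≈ X S.* (ŝ S.* pochhammer ŝ F (suc n) 0))
    (G-ode : G (suc n) S.≈ X S.* (ŝ S.* pochhammer ŝ G (suc n) 0))
    (leading≉0 : ¬ φ (S.1# S.- X S.* (ŝ S.* power ŝ (suc n))) ≈ 0#)
    where

    z-rational : J (suc (n ℕ.+ n)) (y (suc (n ℕ.+ n)))
    z-rational = y-rational n a a∈J leading≉0
      (resp (φ-* _ _) (begin
          φ (â S.* G (suc n)) - φ g * φ (â S.* F (suc n))
            ≈⟨ +-cong (φ-* _ _) (-‿cong (*-congˡ (φ-* _ _))) ⟩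
          φ â * φ (G (suc n)) - φ g * (φ â * φ (F (suc n)))
            ≈⟨ solve 4 (λ c x′ x g → c :* x′ :- g :* (c :* x) := c :* (x′ :- g :* x))
                 refl (φ â) (φ (G (suc n))) (φ (F (suc n))) (φ g) ⟩
          φ â * m (suc n) ∎)
        (φ-comb (solve-leading K-sub ŝ∈K X∈K F G (suc n) F-ode G-ode)))
      where
      -- For ŝ = s = n + 2 this is 1 - sˢ X, the leading coefficient of the differential equation.
      â = S.1# S.- X S.* (ŝ S.* power ŝ (suc n))
      a = φ â
      X∈K : K X
      X∈K = J.resp 1 (sym φX≈y₀) (y∈J 0)
      open Subrings.IsSubring K-sub using (sub; mul; one)
      a∈J : J 1 a
      a∈J = sub one (mul X∈K (mul ŝ∈K (Pochhammer.power∈ S K-sub ŝ∈K (suc n))))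

-- Dual numbers and the Frobenius recurrence

module DualNumbers (R : CommutativeRing 0ℓ 0ℓ) where

  open CommutativeRing R
  open IntegerSolver R

  infix 5 _+ε_
  infix 4 _≈ᴰ_

  record Dual : Set where
    constructor _+ε_
    field
      std inf : Carrier

  open Dual public

  record _≈ᴰ_ (x y : Dual) : Set where
    constructor dual
    field
      std≈ : std x ≈ std y
      inf≈ : inf x ≈ inf y

  open _≈ᴰ_ public

  dualRing : CommutativeRing 0ℓ 0ℓ
  dualRing = record
    { Carrier = Dual
    ; _≈_     = _≈ᴰ_
    ; _+_     = λ x y → std x + std y +ε inf x + inf y
    ; _*_     = λ x y → std x * std y +ε std x * inf y + inf x * std y
    ; -_      = λ x → - std x +ε - inf x
    ; 0#      = 0# +ε 0#
    ; 1#      = 1# +ε 0#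
    ; isCommutativeRing = record
      { isRing = record
        { +-isAbelianGroup = record
          { isGroup = record
            { isMonoid = record
              { isSemigroup = record
                { isMagma = record
                  { isEquivalence = record
                    { refl  = dual refl refl
                    ; sym   = λ (dual p q) → dual (sym p) (sym q)
                    ; trans = λ (dual p q) (dual p′ q′) → dual (trans p p′) (trans q q′)
                    }
                  ; ∙-cong = λ (dual p q) (dual p′ q′) → dual (+-cong p p′) (+-cong q q′)
                  }
                ; assoc = λ x y z → dual (+-assoc _ _ _) (+-assoc _ _ _)
                }
              ; identity = (λ x → dual (+-identityˡ _) (+-identityˡ _))
                         , (λ x → dual (+-identityʳ _) (+-identityʳ _))
              }
            ; inverse = (λ x → dual (-‿inverseˡ _) (-‿inverseˡ _))
                      , (λ x → dual (-‿inverseʳ _) (-‿inverseʳ _))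
            ; ⁻¹-cong = λ (dual p q) → dual (-‿cong p) (-‿cong q)
            }
          ; comm = λ x y → dual (+-comm _ _) (+-comm _ _)
          }
        ; *-cong = λ (dual p q) (dual p′ q′) → dual (*-cong p p′) (+-cong (*-cong p q′) (*-cong q p′))
        ; *-assoc = λ (a +ε a′) (b +ε b′) (c +ε c′) → dual (*-assoc a b c)
            (solve 6 (λ a a′ b b′ c c′ → (a :* b) :* c′ :+ (a :* b′ :+ a′ :* b) :* c
              := a :* (b :* c′ :+ b′ :* c) :+ a′ :* (b :* c)) refl a a′ b b′ c c′)
        ; *-identity = (λ (a +ε a′) → dual (*-identityˡ a)
                          (solve 2 (λ a a′ → con (+ 1) :* a′ :+ con (+ 0) :* a := a′) refl a a′))
                     , (λ (a +ε a′) → dual (*-identityʳ a)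
                          (solve 2 (λ a a′ → a :* con (+ 0) :+ a′ :* con (+ 1) := a′) refl a a′))
        ; distrib = (λ (a +ε a′) (b +ε b′) (c +ε c′) → dual (distribˡ a b c)
                       (solve 6 (λ a a′ b b′ c c′ → a :* (b′ :+ c′) :+ a′ :* (b :+ c)
                         := (a :* b′ :+ a′ :* b) :+ (a :* c′ :+ a′ :* c)) refl a a′ b b′ c c′))
                  , (λ (a +ε a′) (b +ε b′) (c +ε c′) → dual (distribʳ a b c)
                       (solve 6 (λ a a′ b b′ c c′ → (b :+ c) :* a′ :+ (b′ :+ c′) :* a
                         := (b :* a′ :+ b′ :* a) :+ (c :* a′ :+ c′ :* a)) refl a a′ b b′ c c′))
        }
      ; *-comm = λ (a +ε a′) (b +ε b′) → dual (*-comm a b)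
          (solve 4 (λ a a′ b b′ → a :* b′ :+ a′ :* b := b :* a′ :+ b′ :* a) refl a a′ b b′)
      }
    }

-- The coefficients c l = (s l)!/(l!)ˢ and c l · s ∑ 1/k are the two parts of
-- ∏ (i + s ε) / ∏ (i + ε)ˢ, the products being over i ≤ s l and i ≤ l.

module Recurrence
  (R : CommutativeRing 0ℓ 0ℓ)
  where

  open CommutativeRing R
  open RawMonoidDefs +-rawMonoid using () renaming (_×_ to _·_)
  open MonoidMult +-monoid using (×-congʳ)
  open SemiringMult semiring using (×1-homo-*; ×-assoc-*)
  open MonoidSum +-monoid using (sum-syntax; sum-cong-≋)
  open DualNumbers R
  open IntegerSolver R
  open Pochhammer R using (power)
  private
    module E = CommutativeRing dualRing
    module Eᵖ = Pochhammer dualRing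
  open ≈-Reasoning setoid

  ι : ℕ → Carrier
  ι n = n · 1#

  ·≈ι* : ∀ n x → n · x ≈ ι n * x
  ·≈ι* n x = trans (×-congʳ n (sym (*-identityˡ x))) (sym (×-assoc-* n 1# x))

  ι-power : ∀ m n → ι (m ℕ.^ n) ≈ power (ι m) n
  ι-power m zero    = +-identityʳ 1#
  ι-power m (suc n) = trans (×1-homo-* m (m ℕ.^ n)) (*-congˡ (ι-power m n))

  factor : ℕ → Carrier → Dual
  factor n b = ι n +ε b

  -- (n + 1 + b ε)(n + 2 + b ε)⋯(n + j + b ε)

  rising : Carrier → ℕ → ℕ → Dual
  rising b n zero    = E.1#
  rising b n (suc j) = factor (suc (j ℕ.+ n)) b E.* rising b n j

  rising-+ : ∀ b n j → rising b 0 (j ℕ.+ n) E.≈ rising b n j E.* rising b 0 n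
  rising-+ b n zero    = E.sym (E.*-identityˡ _)
  rising-+ b n (suc j)
    rewrite ℕₚ.+-identityʳ (j ℕ.+ n) = E.trans (E.*-congˡ (rising-+ b n j)) (E.sym (E.*-assoc _ _ _))

  module _ (r : ℕ → Carrier) (ι*r≈1 : ∀ n → ι (suc n) * r n ≈ 1#) where

    harmonic : ℕ → Carrier
    harmonic zero    = 0#
    harmonic (suc n) = harmonic n + r n

    harmonic-+ : ∀ l d → harmonic (l ℕ.+ d) ≈ harmonic l + ∑[ j < d ] r (l ℕ.+ toℕ j)
    harmonic-+ l zero    = trans (reflexive (≡.cong harmonic (ℕₚ.+-identityʳ l))) (sym (+-identityʳ _))
    harmonic-+ l (suc d) = begin
      harmonic (l ℕ.+ suc d)
        ≡⟨ ≡.cong harmonic (ℕₚ.+-suc l d) ⟩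
      harmonic (suc l ℕ.+ d)
        ≈⟨ harmonic-+ (suc l) d ⟩
      (harmonic l + r l) + ∑[ j < d ] r (suc l ℕ.+ toℕ j)
        ≈⟨ +-assoc _ _ _ ⟩
      harmonic l + (r l + ∑[ j < d ] r (suc l ℕ.+ toℕ j))
        ≈⟨ +-congˡ (+-cong (reflexive (≡.cong r (≡.sym (ℕₚ.+-identityʳ l))))
             (sum-cong-≋ {d} λ j → reflexive (≡.cong r (≡.sym (ℕₚ.+-suc l (toℕ j)))))) ⟩
      harmonic l + ∑[ j < suc d ] r (l ℕ.+ toℕ j) ∎

    -- The ε-part of a product is its standard part times the sum of the logarithmic derivatives of
    -- the factors, here b / i for i ≤ n.
    rising-harmonic : ∀ b n → rising b 0 n E.≈ (ι (n !) +ε ι (n !) * (b * harmonic n))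
    rising-harmonic b zero = dual (sym (+-identityʳ 1#))
      (solve 2 (λ b u → con (+ 0) := u :* (b :* con (+ 0))) refl b (ι 1))
    rising-harmonic b (suc n) rewrite ℕₚ.+-identityʳ n = E.trans (E.*-congˡ (rising-harmonic b n)) (dual
      (sym (×1-homo-* (suc n) (n !)))
      (begin
        ι (suc n) * (ι (n !) * (b * harmonic n)) + b * ι (n !)
          ≈⟨ +-congˡ (*-congʳ (trans (sym (*-identityʳ b)) (*-congˡ (sym (ι*r≈1 n))))) ⟩
        ι (suc n) * (ι (n !) * (b * harmonic n)) + (b * (ι (suc n) * r n)) * ι (n !)
          ≈⟨ solve 5 (λ m k b h r → m :* (k :* (b :* h)) :+ (b :* (m :* r)) :* k
               := (m :* k) :* (b :* (h :+ r))) refl (ι (suc n)) (ι (n !)) b (harmonic n) (r n) ⟩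
        (ι (suc n) * ι (n !)) * (b * (harmonic n + r n))
          ≈⟨ *-congʳ (×1-homo-* (suc n) (n !)) ⟨
        ι (suc n !) * (b * harmonic (suc n)) ∎))

    power-harmonic : ∀ a b k → Eᵖ.power (a +ε a * b) k E.≈ (power a k +ε power a k * (ι k * b))
    power-harmonic a b zero    = dual refl
      (solve 1 (λ b → con (+ 0) := con (+ 1) :* (con (+ 0) :* b)) refl b)
    power-harmonic a b (suc k) = E.trans (E.*-congˡ (power-harmonic a b k)) (dual refl
      (solve 4 (λ a b p k → a :* (p :* (k :* b)) :+ (a :* b) :* p
        := (a :* p) :* ((con (+ 1) :+ k) :* b)) refl a b (power a k) (ι k)))

    module _ (s : ℕ) (c g : ℕ → Carrier)
      (c-closed : ∀ l → c l * ι ((l !) ℕ.^ suc s) ≈ ι ((suc s ℕ.* l) !))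
      (g-closed : ∀ l → g l ≈ ι (suc s) * (c l * ∑[ j < suc s ℕ.* l ℕ.∸ l ] r (l ℕ.+ toℕ j)))
      where

      -- With `suc s` in the role of s, the quotient of the two products has logarithmic derivative
      -- s H(s l) - s H(l) for harmonic numbers H. This is s times the sum of 1/k over l < k ≤ s l,
      -- as in g₁.
      closed-form : ∀ l → (c l +ε g l) E.* Eᵖ.power (rising 1# 0 l) (suc s)
                          E.≈ rising (ι (suc s)) 0 (suc s ℕ.* l)
      closed-form l = E.trans (E.*-congˡ (E.trans (Eᵖ.power-cong (suc s) (rising-harmonic 1# l))
          (power-harmonic (ι (l !)) (1# * harmonic l) (suc s))))
        (E.trans (dual p≈ inf-part) (E.sym (rising-harmonic (ι (suc s)) (suc s ℕ.* l))))
        where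
        d = suc s ℕ.* l ℕ.∸ l
        h = ∑[ j < d ] r (l ℕ.+ toℕ j)
        P = power (ι (l !)) (suc s)
        p≈ : c l * P ≈ ι ((suc s ℕ.* l) !)
        p≈ = trans (*-congˡ (sym (ι-power (l !) (suc s)))) (c-closed l)
        harmonic≈ : harmonic (suc s ℕ.* l) ≈ harmonic l + h
        harmonic≈ = trans (reflexive (≡.cong harmonic (≡.sym (ℕₚ.m+[n∸m]≡n (ℕₚ.m≤m+n l (s ℕ.* l))))))
          (harmonic-+ l d)
        inf-part : c l * (P * (ι (suc s) * (1# * harmonic l))) + g l * P
                   ≈ ι ((suc s ℕ.* l) !) * (ι (suc s) * harmonic (suc s ℕ.* l))
        inf-part = begin
          c l * (P * (ι (suc s) * (1# * harmonic l))) + g l * P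
            ≈⟨ +-congˡ (*-congʳ (g-closed l)) ⟩
          c l * (P * (ι (suc s) * (1# * harmonic l))) + (ι (suc s) * (c l * h)) * P
            ≈⟨ solve 5 (λ c P s H h → c :* (P :* (s :* (con (+ 1) :* H))) :+ (s :* (c :* h)) :* P
                 := (c :* P) :* (s :* (H :+ h))) refl (c l) P (ι (suc s)) (harmonic l) h ⟩
          (c l * P) * (ι (suc s) * (harmonic l + h))
            ≈⟨ *-cong p≈ (*-congˡ (sym harmonic≈)) ⟩
          ι ((suc s ℕ.* l) !) * (ι (suc s) * harmonic (suc s ℕ.* l)) ∎

      module _ (cancel : ∀ n {x y} → ι (suc n) * x ≈ ι (suc n) * y → x ≈ y) where

        -- Only the standard part of the factor must be cancellable: it gives x = y first, and then
        -- the mixed terms b x and b y drop out of the ε-part.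
        factor-cancellable : ∀ n b → Eᵖ.Cancellable (factor (suc n) b)
        factor-cancellable n b {x +ε x′} {y +ε y′} (dual p q) = dual x≈y (cancel n (begin
          ι (suc n) * x′
            ≈⟨ solve 2 (λ u v → u := (u :+ v) :- v) refl _ (b * x) ⟩
          (ι (suc n) * x′ + b * x) - b * x
            ≈⟨ +-cong q (-‿cong (*-congˡ x≈y)) ⟩
          (ι (suc n) * y′ + b * y) - b * y
            ≈⟨ solve 2 (λ u v → (u :+ v) :- v := u) refl _ (b * y) ⟩
          ι (suc n) * y′ ∎))
          where x≈y = cancel n p

        rising-cancellable : ∀ b n j → Eᵖ.Cancellable (rising b n j)
        rising-cancellable b n zero    = Eᵖ.1-cancellable
        rising-cancellable b n (suc j) =
          Eᵖ.*-cancellable {factor (suc (j ℕ.+ n)) b} (factor-cancellable (j ℕ.+ n) b) (rising-cancellable b n j)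

        -- The Frobenius recurrence with l + ε in place of l, as (s+1)(l+1+ε) is the last
        -- factor of rising (ι (suc s)) ((s+1) l) (s+1).

        recurrence : ∀ l → Eᵖ.power (factor (suc l) 1#) s E.* (c (suc l) +ε g (suc l))
          E.≈ (ι (suc s) +ε 0#) E.* (rising (ι (suc s)) (suc s ℕ.* l) s E.* (c l +ε g l))
        recurrence l = Eᵖ.ratio-step s (rising-cancellable 1# 0 l) (factor-cancellable l 1#)
          (closed-form l) (closed-form (suc l))
          (E.*-congʳ {rising 1# 0 l} (dual (reflexive (≡.cong (λ k → ι (suc k)) (ℕₚ.+-identityʳ l))) refl))
          (E.trans (E.reflexive (≡.cong (rising (ι (suc s)) 0) (ℕₚ.*-suc (suc s) l)))
            (E.trans (rising-+ (ι (suc s)) (suc s ℕ.* l) (suc s))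
              (E.*-congʳ {rising (ι (suc s)) 0 (suc s ℕ.* l)}
                (E.*-congʳ {rising (ι (suc s)) (suc s ℕ.* l) s} last-factor))))
          where
          last-factor : factor (suc s ℕ.+ suc s ℕ.* l) (ι (suc s))
                        E.≈ (ι (suc s) +ε 0#) E.* factor (suc l) 1#
          last-factor = dual
            (trans (reflexive (≡.cong ι (≡.sym (ℕₚ.*-suc (suc s) l)))) (×1-homo-* (suc s) (suc l)))
            (solve 2 (λ s m → s := s :* con (+ 1) :+ con (+ 0) :* m) refl (ι (suc s)) (ι (suc l)))

-- Power series over a domain have no zero divisors

module SeriesDomain
  (em : ExcludedMiddle 0ℓ) (R : CommutativeRing 0ℓ 0ℓ)
  (domain : ∀ {a b} → CommutativeRing._≈_ R (CommutativeRing._*_ R a b) (CommutativeRing.0# R) →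
            ¬ CommutativeRing._≈_ R a (CommutativeRing.0# R) →
            CommutativeRing._≈_ R b (CommutativeRing.0# R))
  where

  open CommutativeRing R
  open PowerSeries R
  open SeriesRing R

  private
    -- A nonzero f 0 forces g 0 = 0, and then f times `shift g` is again zero, so the coefficients
    -- of g vanish one after another.
    case-constant : ∀ f → ¬ f 0 ≈ 0# → ∀ n g → (∀ i → (f *ˢ g) i ≈ 0#) → g n ≈ 0#
    case-constant f f₀≉0 zero    g fg≈0 = domain (trans (sym (*ˢ-zero f g)) (fg≈0 0)) f₀≉0
    case-constant f f₀≉0 (suc n) g fg≈0 = case-constant f f₀≉0 n (shift g) λ i →
      trans (sym (trans (*ˢ-sucʳ f g i) (trans (+-congˡ (trans
        (*-congˡ (case-constant f f₀≉0 0 g fg≈0)) (zeroʳ _))) (+-identityʳ _)))) (fg≈0 (suc i))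

    -- Vanishing initial coefficients of f are shifted away without making the product nonzero,
    -- until the constant term is nonzero.
    case-order : ∀ k f → ¬ f k ≈ 0# → ∀ g → (∀ i → (f *ˢ g) i ≈ 0#) → ∀ n → g n ≈ 0#
    case-order k f fₖ≉0 g fg≈0 = go k fₖ≉0 em
      where
      go : ∀ k → ¬ f k ≈ 0# → Dec (f 0 ≈ 0#) → ∀ n → g n ≈ 0#
      go k       fₖ≉0 (no f₀≉0)  n = case-constant f f₀≉0 n g fg≈0
      go zero    fₖ≉0 (yes f₀≈0) n = ⊥-elim (fₖ≉0 f₀≈0)
      go (suc k) fₖ≉0 (yes f₀≈0) n = case-order k (shift f) fₖ≉0 g
        (λ i → trans (sym (trans (+-congʳ (trans (*-congʳ f₀≈0) (zeroˡ _))) (+-identityˡ _)))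
          (fg≈0 (suc i))) n

  *ˢ-domain : ∀ {f g} → f *ˢ g ≋ 0ˢ → ¬ f ≋ 0ˢ → g ≋ 0ˢ
  *ˢ-domain {f} {g} fg≋0 f≉0 = go em
    where
    0ˢ≈0 : ∀ n → 0ˢ n ≈ 0#
    0ˢ≈0 zero    = refl
    0ˢ≈0 (suc n) = refl
    go : Dec (∃[ k ] ¬ f k ≈ 0#) → g ≋ 0ˢ
    go (yes (k , fₖ≉0)) = coefficientwise λ n → trans
      (case-order k f fₖ≉0 g (λ i → trans (at fg≋0 i) (0ˢ≈0 i)) n) (sym (0ˢ≈0 n))
    go (no none) = ⊥-elim (f≉0 (coefficientwise λ n → trans (vanish n em) (sym (0ˢ≈0 n))))
      where
      vanish : ∀ n → Dec (f n ≈ 0#) → f n ≈ 0#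
      vanish n (yes e) = e
      vanish n (no ne) = ⊥-elim (none (n , ne))

-- The differential equation for the holomorphic and the logarithmic solution

module LogarithmicSolution (R : CommutativeRing 0ℓ 0ℓ) where

  open CommutativeRing R
  open PowerSeries R
  open SeriesRing R
  open DualNumbers R
  open Recurrence R
  open IntegerSolver R
  open MonoidMult +-monoid using (×-homo-+)
  open SemiringMult semiring using (×1-homo-*)
  open Pochhammer seriesRing using (pochhammer)
  private
    module S = CommutativeRing seriesRing
    module S× = RawMonoidDefs S.+-rawMonoid
    module E = CommutativeRing dualRing
    module ES = IntegerSolver dualRing
    module Eᵖ = Pochhammer dualRing

  multiple-1ˢ : ∀ k n → (k S×.× 1ˢ) n ≈ constˢ (ι k) n
  multiple-1ˢ zero    zero    = refl
  multiple-1ˢ zero    (suc n) = refl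
  multiple-1ˢ (suc k) zero    = +-congˡ (multiple-1ˢ k 0)
  multiple-1ˢ (suc k) (suc n) = trans (+-identityˡ _) (multiple-1ˢ k (suc n))

  -- The coefficients of θⁱ(f + ε(f log z + g)) that do not involve log z.

  iterates : Series → ℕ → Series
  iterates f zero    = f
  iterates f (suc i) = θ (iterates f i)

  log-iterates : Series → Series → ℕ → Series
  log-iterates f g zero    = g
  log-iterates f g (suc i) = θ (log-iterates f g i) +ˢ iterates f i

  module _ (f g : Series) where

    private
      F = iterates f
      G = log-iterates f g

      D : ℕ → ℕ → Dual
      D i l = F i l +ε G i l

      -- As z^(l + ε) = zˡ (1 + ε log z), `D i l` is the coefficient of z^(l + ε) in θⁱ(f + ε (f log
      -- z + g)), and θ multiplies it by l + ε.
      D-suc : ∀ i l → D (suc i) l E.≈ factor l 1# E.* D i l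
      D-suc i l = dual (·≈ι* l (F i l)) (+-cong (·≈ι* l (G i l)) (sym (*-identityˡ _)))

      D-power : ∀ i l → D i l E.≈ Eᵖ.power (factor l 1#) i E.* D 0 l
      D-power zero    l = E.sym (E.*-identityˡ _)
      D-power (suc i) l = E.trans (D-suc i l)
        (E.trans (E.*-congˡ (D-power i l)) (E.sym (E.*-assoc _ _ _)))

    module _ (s : ℕ) where

      private
        ŝ = constˢ (ι s)

        P : ℕ → ℕ → ℕ → Dual
        P j i l = pochhammer ŝ F j i l +ε pochhammer ŝ G j i l

        scalar : ℕ → Dual
        scalar k = ι k +ε 0#

        dual-scale : ∀ k u v l → (constˢ (ι k) *ˢ u) l +ε (constˢ (ι k) *ˢ v) l E.≈ scalar k E.* (u l +ε v l)
        dual-scale k u v l = dual (constˢ-* (ι k) u l)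
          (trans (constˢ-* (ι k) v l) (solve 2 (λ a b → a := a :+ con (+ 0) :* b) refl _ (u l)))

        P-suc : ∀ j i l → P (suc j) i l E.≈ scalar s E.* P j (suc i) l E.+ scalar (suc j) E.* P j i l
        P-suc j i l = E.+-cong (dual-scale s (pochhammer ŝ F j (suc i)) (pochhammer ŝ G j (suc i)) l)
          (E.trans (dual (*ˢ-cong {suc j S×.× 1ˢ} {constˢ (ι (suc j))} {u} {u} (multiple-1ˢ (suc j)) (λ _ → refl) l)
                         (*ˢ-cong {suc j S×.× 1ˢ} {constˢ (ι (suc j))} {v} {v} (multiple-1ˢ (suc j)) (λ _ → refl) l))
            (dual-scale (suc j) u v l))
          where
          u = pochhammer ŝ F j i
          v = pochhammer ŝ G j i

        factor-split : ∀ j l → factor (suc (j ℕ.+ s ℕ.* l)) (ι s)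
                               E.≈ scalar s E.* factor l 1# E.+ scalar (suc j)
        factor-split j l = dual
          (trans (×-homo-+ 1# (suc j) (s ℕ.* l)) (trans (+-comm _ _) (+-congʳ (×1-homo-* s l))))
          (solve 2 (λ s l → s := (s :* con (+ 1) :+ con (+ 0) :* l) :+ con (+ 0)) refl (ι s) (ι l))

      -- On z^(l + ε) the operator s θ + j acts as multiplication by s l + j + s ε, the next factor
      -- of `rising`.
      pochhammer-rising : ∀ j i l → P j i l E.≈ rising (ι s) (s ℕ.* l) j E.* D i l
      pochhammer-rising zero    i l = E.sym (E.*-identityˡ _)
      pochhammer-rising (suc j) i l = E.trans (P-suc j i l)
        (E.trans (E.+-cong
            (E.*-congˡ (E.trans (pochhammer-rising j (suc i) l) (E.*-congˡ (D-suc i l))))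
            (E.*-congˡ (pochhammer-rising j i l)))
          (E.trans
            (ES.solve 5 (λ s r f d j → s ES.:* (r ES.:* (f ES.:* d)) ES.:+ j ES.:* (r ES.:* d)
               ES.:= ((s ES.:* f ES.:+ j) ES.:* r) ES.:* d) E.refl
               (scalar s) (rising (ι s) (s ℕ.* l) j) (factor l 1#) (D i l) (scalar (suc j)))
            (E.*-congʳ {D i l} (E.*-congʳ {rising (ι s) (s ℕ.* l) j} (E.sym (factor-split j l))))))

      module _ (k : ℕ)
        (rec : ∀ l → Eᵖ.power (factor (suc l) 1#) (suc (suc k)) E.* D 0 (suc l)
               E.≈ (ι s +ε 0#) E.* (rising (ι s) (s ℕ.* l) (suc (suc k)) E.* D 0 l))
        where

        private
          N = suc (suc k)

          ode : ∀ l → D N l E.≈ (X *ˢ (ŝ *ˢ pochhammer ŝ F N 0)) l +ε (X *ˢ (ŝ *ˢ pochhammer ŝ G N 0)) l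
          -- The left side vanishes at l = 0 because εᴺ = 0 for N ≥ 2: the constant term of G N is
          -- that of F (N - 1), which is still in the image of θ. For N = 1 this would fail, so s ≥
          -- 3 matters.
          ode zero    = dual (sym (X-*-zero (ŝ *ˢ pochhammer ŝ F N 0)))
            (trans (+-identityˡ 0#) (sym (X-*-zero (ŝ *ˢ pochhammer ŝ G N 0))))
          ode (suc l) = E.trans (D-power N (suc l)) (E.trans (rec l)
            (E.trans (E.*-congˡ (E.sym (pochhammer-rising N 0 l)))
              (E.trans (E.sym (dual-scale s (pochhammer ŝ F N 0) (pochhammer ŝ G N 0) l))
                (dual (sym (X-*-suc (ŝ *ˢ pochhammer ŝ F N 0) l)) (sym (X-*-suc (ŝ *ˢ pochhammer ŝ G N 0) l))))))

        F-ode : F N ≋ X *ˢ (ŝ *ˢ pochhammer ŝ F N 0)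
        F-ode = coefficientwise λ l → std≈ (ode l)

        G-ode : G N ≋ X *ˢ (ŝ *ˢ pochhammer ŝ G N 0)
        G-ode = coefficientwise λ l → inf≈ (ode l)

-- Rational numbers and the hypergeometric coefficients

module RationalNumbers where

  ℚ-ring : CommutativeRing 0ℓ 0ℓ
  ℚ-ring = ℚₚ.+-*-commutativeRing

  open CommutativeRing ℚ-ring using (+-rawMonoid)
  open RawMonoidDefs +-rawMonoid using () renaming (_×_ to _·_)
  open Recurrence ℚ-ring using (ι; ·≈ι*)

  +-/1 : ∀ n → + suc n / 1 ≡ 1ℚ ℚ.+ + n / 1
  +-/1 n = ℚₚ.toℚᵘ-injective (begin-equality
    ℚ.toℚᵘ (+ suc n / 1)                 ≃⟨ ℚₚ.toℚᵘ-fromℚᵘ (ℚᵘ.mkℚᵘ (+ suc n) 0) ⟩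
    ℚᵘ.mkℚᵘ (+ suc n) 0                  ≃⟨ ℚᵘ.*≡* (≡.cong (λ i → (+ 1 ℤ.+ i) ℤ.* + 1) (≡.sym (ℤₚ.*-identityʳ (+ n)))) ⟩
    ℚᵘ.mkℚᵘ (+ 1) 0 ℚᵘ.+ ℚᵘ.mkℚᵘ (+ n) 0 ≃⟨ ℚᵘₚ.+-congʳ (ℚᵘ.mkℚᵘ (+ 1) 0) (ℚᵘₚ.≃-sym (ℚₚ.toℚᵘ-fromℚᵘ (ℚᵘ.mkℚᵘ (+ n) 0))) ⟩
    ℚ.toℚᵘ 1ℚ ℚᵘ.+ ℚ.toℚᵘ (+ n / 1)      ≃⟨ ℚₚ.toℚᵘ-homo-+ 1ℚ (+ n / 1) ⟨
    ℚ.toℚᵘ (1ℚ ℚ.+ + n / 1)              ∎)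
    where open ℚᵘₚ.≤-Reasoning

  /1≡ι : ∀ n → + n / 1 ≡ ι n
  /1≡ι zero    = ≡.refl
  /1≡ι (suc n) = ≡.trans (+-/1 n) (≡.cong (1ℚ ℚ.+_) (/1≡ι n))

  /-*-ι : ∀ a b .{{_ : ℕ.NonZero b}} → (+ a / b) ℚ.* ι b ≡ ι a
  /-*-ι a b@(suc b-1) = ≡.trans (≡.cong ((+ a / b) ℚ.*_) (≡.sym (/1≡ι b)))
    (≡.trans (ℚₚ.toℚᵘ-injective (begin-equality
      ℚ.toℚᵘ ((+ a / b) ℚ.* (+ b / 1))          ≃⟨ ℚₚ.toℚᵘ-homo-* (+ a / b) (+ b / 1) ⟩
      ℚ.toℚᵘ (+ a / b) ℚᵘ.* ℚ.toℚᵘ (+ b / 1)    ≃⟨ ℚᵘₚ.*-cong (ℚₚ.toℚᵘ-fromℚᵘ (ℚᵘ.mkℚᵘ (+ a) b-1)) (ℚₚ.toℚᵘ-fromℚᵘ (ℚᵘ.mkℚᵘ (+ b) 0)) ⟩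
      ℚᵘ.mkℚᵘ (+ a) b-1 ℚᵘ.* ℚᵘ.mkℚᵘ (+ b) 0    ≃⟨ ℚᵘ.*≡* (cross a b) ⟩
      ℚᵘ.mkℚᵘ (+ a) 0                           ≃⟨ ℚₚ.toℚᵘ-fromℚᵘ (ℚᵘ.mkℚᵘ (+ a) 0) ⟨
      ℚ.toℚᵘ (+ a / 1)                          ∎)) (/1≡ι a))
    where
    open ℚᵘₚ.≤-Reasoning
    cross : ∀ a b → (+ a ℤ.* + b) ℤ.* + 1 ≡ + a ℤ.* + (b ℕ.* 1)
    cross a b = ≡.trans (ℤₚ.*-identityʳ _) (≡.cong (λ k → + a ℤ.* + k) (≡.sym (ℕₚ.*-identityʳ b)))

  ι-suc≢0 : ∀ n → ι (suc n) ≢ 0ℚ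
  ι-suc≢0 n e = ℚₚ.<-irrefl (≡.sym (≡.trans (/1≡ι (suc n)) e)) (ℚₚ.positive⁻¹ _ {{ℚₚ.normalize-pos (suc n) 1}})

  domain : ∀ {a b} → a ℚ.* b ≡ 0ℚ → a ≢ 0ℚ → b ≡ 0ℚ
  domain {a} {b} ab≡0 a≢0 = begin
    b                        ≡⟨ ℚₚ.*-identityˡ b ⟨
    1ℚ ℚ.* b                 ≡⟨ ≡.cong (ℚ._* b) (ℚₚ.*-inverseˡ a) ⟨
    (ℚ.1/ a ℚ.* a) ℚ.* b     ≡⟨ ℚₚ.*-assoc (ℚ.1/ a) a b ⟩
    ℚ.1/ a ℚ.* (a ℚ.* b)     ≡⟨ ≡.cong (ℚ.1/ a ℚ.*_) ab≡0 ⟩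
    ℚ.1/ a ℚ.* 0ℚ            ≡⟨ ℚₚ.*-zeroʳ (ℚ.1/ a) ⟩
    0ℚ                       ∎
    where
    open ≡.≡-Reasoning
    instance _ = ℚ.≢-nonZero a≢0

  torsion-free : ∀ n {a} → suc n · a ≡ 0ℚ → a ≡ 0ℚ
  torsion-free n {a} e = domain (≡.trans (≡.sym (·≈ι* (suc n) a)) e) (ι-suc≢0 n)

  ι-cancel : ∀ n {x y} → ι (suc n) ℚ.* x ≡ ι (suc n) ℚ.* y → x ≡ y
  ι-cancel n = Subrings.*-cancelˡ ℚ-ring (λ ()) domain (ι-suc≢0 n)

  ι-NonZero-cancel : ∀ n .{{_ : ℕ.NonZero n}} {x y} → ι n ℚ.* x ≡ ι n ℚ.* y → x ≡ y
  ι-NonZero-cancel (suc n) = ι-cancel n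

module Hypergeometric (s : ℕ) where

  open RationalNumbers
  open CommutativeRing ℚ-ring using (semiring; +-monoid)
  open SemiringMult semiring using (×1-homo-*)
  open MonoidSum +-monoid using (sum-syntax)
  open Recurrence ℚ-ring using (ι; ·≈ι*)
  open PowerSeries ℚ-ring
  open SeriesRing ℚ-ring

  private
    S = suc s

  reciprocal : ℕ → ℚ
  reciprocal n = + 1 / suc n

  ι-*-reciprocal : ∀ n → ι (suc n) ℚ.* reciprocal n ≡ 1ℚ
  ι-*-reciprocal n = ≡.trans (ℚₚ.*-comm (ι (suc n)) (reciprocal n)) (/-*-ι 1 (suc n))

  f₀-closed : ∀ l → f₀ S l ℚ.* ι ((l !) ℕ.^ S) ≡ ι ((S ℕ.* l) !)
  f₀-closed l = /-*-ι ((S ℕ.* l) !) ((l !) ℕ.^ S)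
    where instance
      _ = l ℕₚ.!≢0
      _ = ℕₚ.m^n≢0 (l !) S

  g₁-closed : ∀ l → g₁ S l ≡ ι S ℚ.* (f₀ S l ℚ.* ∑[ j < S ℕ.* l ℕ.∸ l ] reciprocal (l ℕ.+ toℕ j))
  g₁-closed l = ≡.cong
    (ℚ._* (f₀ S l ℚ.* ∑[ j < S ℕ.* l ℕ.∸ l ] reciprocal (l ℕ.+ toℕ j))) (/1≡ι S)

  -- The quotient does not compute for a variable `S`, so its value comes from the closed form at l
  -- = 0, with 1 to the power S as denominator.
  f₀-constant : f₀ S 0 ≡ 1ℚ
  f₀-constant = ≡.trans (≡.sym (ℚₚ.*-identityʳ _))
    (≡.trans (≡.cong (f₀ S 0 ℚ.*_) (≡.sym (≡.cong ι (ℕₚ.^-zeroˡ S))))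
      (≡.trans (f₀-closed 0) (≡.cong (λ k → ι (k !)) (ℕₚ.*-zeroʳ S))))

  g₁-constant : g₁ S 0 ≡ 0ℚ
  g₁-constant = ≡.trans (g₁-closed 0) (≡.trans (≡.cong (λ x → ι S ℚ.* (f₀ S 0 ℚ.* x)) empty)
    (≡.trans (≡.cong (ι S ℚ.*_) (ℚₚ.*-zeroʳ (f₀ S 0))) (ℚₚ.*-zeroʳ (ι S))))
    where
    empty : ∑[ j < S ℕ.* 0 ] reciprocal (toℕ j) ≡ 0ℚ
    empty = ≡.cong (λ k → ∑[ j < k ] reciprocal (toℕ j)) (ℕₚ.*-zeroʳ S)

  g : Series
  g = g₁ S *ˢ recip (f₀ S)

  g-constant : g 0 ≡ 0ℚ
  g-constant = ≡.trans (*ˢ-zero (g₁ S) (recip (f₀ S)))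
    (≡.trans (≡.cong (ℚ._* recip (f₀ S) 0) g₁-constant) (ℚₚ.*-zeroˡ (recip (f₀ S) 0)))

  g-*-f₀ : g₁ S ≋ g *ˢ f₀ S
  g-*-f₀ = A.sym (A.trans (A.*-assoc (g₁ S) (recip (f₀ S)) (f₀ S))
    (A.trans (A.*-congˡ {g₁ S} (A.trans (A.*-comm (recip (f₀ S)) (f₀ S)) (recip-inverse (f₀ S) f₀-constant)))
      (A.*-identityʳ (g₁ S))))
    where module A = CommutativeRing seriesRing

  derivative-exp : derivative expˢ ≈ˢ expˢ
  derivative-exp n = ≡.trans (·≈ι* (suc n) (expˢ (suc n)))
    (ι-NonZero-cancel (n !) {{n ℕₚ.!≢0}} (begin
      ι (n !) ℚ.* (ι (suc n) ℚ.* expˢ (suc n))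
        ≡⟨ IntegerSolver.solve ℚ-ring 3 (λ a b c → a ∗ (b ∗ c) ≔ c ∗ (b ∗ a)) ≡.refl (ι (n !)) (ι (suc n)) _ ⟩
      expˢ (suc n) ℚ.* (ι (suc n) ℚ.* ι (n !))
        ≡⟨ ≡.cong (expˢ (suc n) ℚ.*_) (×1-homo-* (suc n) (n !)) ⟨
      expˢ (suc n) ℚ.* ι (suc n !)
        ≡⟨ /-*-ι 1 (suc n !) {{suc n ℕₚ.!≢0}} ⟩
      ι 1
        ≡⟨ /-*-ι 1 (n !) {{n ℕₚ.!≢0}} ⟨
      expˢ n ℚ.* ι (n !)
        ≡⟨ ℚₚ.*-comm (expˢ n) (ι (n !)) ⟩
      ι (n !) ℚ.* expˢ n ∎))
    where
    open ≡.≡-Reasoning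
    open IntegerSolver ℚ-ring using () renaming (_:*_ to _∗_; _:=_ to _≔_)

  θ-exp : θ (expˢ ∘ˢ g) ≋ (expˢ ∘ˢ g) *ˢ θ g
  θ-exp = coefficientwise λ n → ≡.trans (chain-rule expˢ n)
    (*ˢ-cong {derivative expˢ ∘ˢ g} {expˢ ∘ˢ g} {θ g} {θ g}
      (∘ˢ-cong {derivative expˢ} {expˢ} derivative-exp) (λ _ → ≡.refl) n)
    where open Composition g g-constant

-- The mirror map in the fraction field of the rational power series

module RationalSeries (em : ExcludedMiddle 0ℓ) where

  open RationalNumbers
  open PowerSeries ℚ-ring public
  open SeriesRing ℚ-ring public
  module A = CommutativeRing seriesRing

  private
    module S× = RawMonoidDefs A.+-rawMonoid
    module Q× = RawMonoidDefs (CommutativeRing.+-rawMonoid ℚ-ring)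

  seriesDomain : IntegralDomain
  seriesDomain = record
    { ring   = seriesRing
    ; 1≉0    = λ e → 1≢0 (at e 0)
    ; domain = SeriesDomain.*ˢ-domain em ℚ-ring domain
    }
    where
    1≢0 : 1ℚ ≢ 0ℚ
    1≢0 ()

  open Fractions seriesDomain public

  series-torsion-free : ∀ n {f} → suc n S×.× f ≋ 0ˢ → f ≋ 0ˢ
  series-torsion-free n {f} e = coefficientwise λ i →
    ≡.trans (torsion-free n (≡.trans (≡.sym (coefficient (suc n) i)) (≡.trans (at e i) (0ˢ≡0 i)))) (≡.sym (0ˢ≡0 i))
    where
    0ˢ≡0 : ∀ i → 0ˢ i ≡ 0ℚ
    0ˢ≡0 zero    = ≡.refl
    0ˢ≡0 (suc i) = ≡.refl
    coefficient : ∀ n i → (n S×.× f) i ≡ n Q×.× f i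
    coefficient zero    i = 0ˢ≡0 i
    coefficient (suc n) i = ≡.cong (f i ℚ.+_) (coefficient n i)

  open Derivation θ (λ e → coefficientwise (θ-cong (at e))) (λ f g → coefficientwise (θ-+ f g))
    (λ f g → coefficientwise (θ-* f g)) public

  quotients : DifferentialField
  quotients = record
    { ring         = fractionField
    ; 1≉0          = 1≄0
    ; inverse      = inverse
    ; torsion-free = fraction-torsion-free series-torsion-free
    ; ∂            = ∂ᶠ
    ; ∂-cong       = ∂ᶠ-cong
    ; ∂-+          = ∂ᶠ-+
    ; ∂-*          = ∂ᶠ-*
    }

  private
    module Q = CommutativeRing fractionField

  IsConstant : Fraction → Set
  IsConstant x = ∃[ a ] x Q.≈ ι (constˢ a)

  constˢ-+ : ∀ a b → constˢ (a ℚ.+ b) ≋ constˢ a +ˢ constˢ b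
  constˢ-+ a b = coefficientwise λ { zero → ≡.refl ; (suc n) → ≡.sym (ℚₚ.+-identityʳ 0ℚ) }

  constˢ-*ˢ : ∀ a b → constˢ (a ℚ.* b) ≋ constˢ a *ˢ constˢ b
  constˢ-*ˢ a b = coefficientwise λ
    { zero    → ≡.sym (constˢ-* a (constˢ b) 0)
    ; (suc n) → ≡.sym (≡.trans (constˢ-* a (constˢ b) (suc n)) (ℚₚ.*-zeroʳ a)) }

  constˢ-neg : ∀ a → constˢ (ℚ.- a) ≋ -ˢ constˢ a
  constˢ-neg a = coefficientwise λ { zero → ≡.refl ; (suc n) → ≡.refl }

  constants-isSubring : Subrings.IsSubring fractionField IsConstant
  constants-isSubring = record
    { resp = λ { e (a , p) → a , Q.trans (Q.sym e) p }
    ; one  = 1ℚ , Q.refl {Q.1#}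
    ; add  = λ { (a , p) (b , q) → a ℚ.+ b ,
        Q.trans (Q.+-cong p q) (Q.sym (Q.trans (ι-cong (constˢ-+ a b)) (ι-+ (constˢ a) (constˢ b)))) }
    ; mul  = λ { (a , p) (b , q) → a ℚ.* b ,
        Q.trans (Q.*-cong p q) (Q.sym (Q.trans (ι-cong (constˢ-*ˢ a b)) (ι-* (constˢ a) (constˢ b)))) }
    ; neg  = λ { (a , p) → ℚ.- a ,
        Q.trans (Q.-‿cong p) (ι-cong (A.sym (constˢ-neg a))) }
    }

  open DifferentialAlgebra ℚ-ring public using (_⟨_⟩)

  jets-of : Series → Jets quotients
  jets-of z = record
    { C       = IsConstant
    ; C-sub   = constants-isSubring
    ; ∂-const = λ { (a , p) → Q.trans (∂ᶠ-cong p) (Q.trans (∂ᶠ-ι (constˢ a))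
        (ι-cong (coefficientwise (θ-constˢ a)))) }
    ; y       = λ k → ι (z ⟨ k ⟩)
    ; ∂-y     = λ k → ∂ᶠ-ι (z ⟨ k ⟩)
    }

  -- A record, so that its instances are compared by z and n alone.

  record RationalOverJets (z : Series) (n : ℕ) : Set where
    constructor rational
    field
      top∈J : JetFields.J em quotients (jets-of z) n (ι (z ⟨ n ⟩))

  module _ (k : ℕ) (z : Series) (mirror : IsMirrorMap (3 ℕ.+ k) z) where

    private
      -- `S` is the s of the theorem, `s` = S - 1 is the order of the differential equation, and `n`
      -- = S - 2 is the number of generators besides f.
      n = suc k
      s = suc n
      S = suc s

    open Hypergeometric s
    open Recurrence ℚ-ring using () renaming (ι to ιℕ)
    open LogarithmicSolution ℚ-ring
    open Composition z (proj₁ mirror)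
    open Pochhammer seriesRing using (power)

    φ : Series → Fraction
    φ f = ι (f ∘ˢ z)

    -- If z vanished, so would its multiple z exp(g(z)), which is q.
    z≉0 : ¬ z ≋ 0ˢ
    z≉0 z≋0 = X≉0 (A.trans (coefficientwise λ i → ≡.sym (proj₂ mirror i))
      (A.trans (coefficientwise (∘ˢ-* X (expˢ ∘ˢ g)))
        (A.trans (A.*-congʳ {(expˢ ∘ˢ g) ∘ˢ z} (A.trans (coefficientwise X-∘ˢ) z≋0)) (A.zeroˡ ((expˢ ∘ˢ g) ∘ˢ z)))))
      where
      X≉0 : ¬ X ≋ 0ˢ
      X≉0 e with () ← at e 1

    ι≉0 : ∀ {f} → ¬ f ≋ 0ˢ → ¬ ι f Q.≈ Q.0#
    ι≉0 f≉0 e = f≉0 (≃0⇒num≈0 e)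

    -- Composition with z preserves constant terms, because z has none. This applies to f₀ and to
    -- the leading coefficient 1 - sˢ X.
    constant≢0⇒≉0 : ∀ f → f 0 ≡ 1ℚ → ¬ φ f Q.≈ Q.0#
    constant≢0⇒≉0 f e = ι≉0 λ φf≋0 → 1≢0 (≡.trans (≡.sym (≡.trans (∘ˢ-zero f) e)) (at φf≋0 0))
      where
      1≢0 : 1ℚ ≢ 0ℚ
      1≢0 ()

    1+θg-constant : (1ˢ +ˢ θ g) 0 ≡ 1ℚ
    1+θg-constant = ≡.refl

    substitution : Substitution seriesRing quotients (jets-of z)
    substitution = record
      { y₀≉0      = ι≉0 z≉0
      ; θ         = θ
      ; θ-*       = λ f g → coefficientwise (θ-* f g)
      ; X         = X
      ; θX≈X      = coefficientwise θ-X
      ; φ         = φ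
      ; φ-cong    = λ {f} {g} e → ι-cong (coefficientwise (∘ˢ-cong {f} {g} (at e)))
      ; φ-+       = λ f g → Q.trans (ι-cong (coefficientwise (∘ˢ-+ f g))) (ι-+ (f ∘ˢ z) (g ∘ˢ z))
      ; φ-*       = λ f g → Q.trans (ι-cong (coefficientwise (∘ˢ-* f g))) (ι-* (f ∘ˢ z) (g ∘ˢ z))
      ; φ-1       = ι-cong (coefficientwise (∘ˢ-constˢ 1ℚ))
      ; φX≈y₀     = ι-cong (coefficientwise X-∘ˢ)
      ; chain     = λ f → begin
          ι z Q.* ∂ᶠ (φ f)              ≈⟨ Q.*-congˡ {ι z} (∂ᶠ-ι (f ∘ˢ z)) ⟩
          ι z Q.* ι (θ (f ∘ˢ z))        ≈⟨ ι-* z (θ (f ∘ˢ z)) ⟨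
          ι (z *ˢ θ (f ∘ˢ z))           ≈⟨ ι-cong (coefficientwise (h-*-θ f)) ⟩
          ι ((θ f ∘ˢ z) *ˢ θ z)         ≈⟨ ι-* (θ f ∘ˢ z) (θ z) ⟩
          φ (θ f) Q.* ι (θ z)           ≈⟨ Q.*-congˡ {φ (θ f)} (∂ᶠ-ι z) ⟨
          φ (θ f) Q.* ∂ᶠ (ι z)          ∎
      ; g         = g
      ; E         = expˢ ∘ˢ g
      ; U         = recip (1ˢ +ˢ θ g)
      ; U-inverse = recip-inverse (1ˢ +ˢ θ g) 1+θg-constant
      ; θE        = θ-exp
      ; q         = ι X
      ; q≉0       = ι≉0 (λ e → X≉0 (at e 1))
      ; ∂q≈q      = Q.trans (∂ᶠ-ι X) (ι-cong (coefficientwise θ-X))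
      ; φ[XE]≈q   = ι-cong (coefficientwise (proj₂ mirror))
      ; F         = iterates (f₀ S)
      ; G         = log-iterates (f₀ S) (g₁ S)
      ; F-suc     = λ i → A.refl {iterates (f₀ S) (suc i)}
      ; G-suc     = λ i → A.refl {log-iterates (f₀ S) (g₁ S) (suc i)}
      ; G₀        = g-*-f₀
      ; F₀≉0      = constant≢0⇒≉0 (f₀ S) f₀-constant
      }
      where
      open import Relation.Binary.Reasoning.Setoid Q.setoid
      X≉0 : 1ℚ ≢ 0ℚ
      X≉0 ()

    open Mirror em seriesRing quotients (jets-of z) substitution using (K; z-rational)
    open JetFields em quotients (jets-of z) using (J; jets⊆J; J-suc; module J)

    mirror-rational : RationalOverJets z (suc (n ℕ.+ n))
    mirror-rational = rational (z-rational n {ŝ} ŝ∈K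
      (F-ode (f₀ S) (g₁ S) S k rec) (G-ode (f₀ S) (g₁ S) S k rec)
      (constant≢0⇒≉0 (1ˢ A.- X *ˢ (ŝ *ˢ power ŝ s))
        (≡.cong (λ u → 1ℚ ℚ.- u) (X-*-zero (ŝ *ˢ power ŝ s)))))
      where
      ŝ = constˢ (ιℕ S)
      ŝ∈K : K ŝ
      ŝ∈K = J.resp 1 (Q.sym (ι-cong (coefficientwise (∘ˢ-constˢ (ιℕ S)))))
        (J-suc {0} {ι ŝ} (jets⊆J {0} {ι ŝ} (ιℕ S , Q.refl {ι ŝ})))
      rec = Recurrence.recurrence ℚ-ring reciprocal ι-*-reciprocal s (f₀ S) (g₁ S) f₀-closed g₁-closed ι-cancel

  order : ∀ k → suc (suc k ℕ.+ suc k) ≡ 2 ℕ.* (3 ℕ.+ k) ℕ.∸ 3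
  order k rewrite ℕₚ.+-identityʳ k =
    ≡.sym (≡.trans (ℕₚ.+-suc k (suc (suc k))) (≡.cong suc (ℕₚ.+-suc k (suc k))))

  mirrorMap-rational : ∀ s → 3 ℕ.≤ s → ∀ z → IsMirrorMap s z → RationalOverJets z (2 ℕ.* s ℕ.∸ 3)
  mirrorMap-rational (suc (suc (suc k))) (s≤s (s≤s (s≤s z≤n))) z mirror =
    ≡.subst (RationalOverJets z) (order k) (mirror-rational k z mirror)

-- From rational to complex coefficients

module GaussianEmbedding (R : CommutativeRing 0ℓ 0ℓ) where

  open CommutativeRing R
  open IntegerSolver R

  real-product : ∀ x y → x * y ≈ x * y - 0# * 0#
  real-product = solve 2 (λ x y → x :* y := x :* y :- con (+ 0) :* con (+ 0)) refl

  imaginary-product : ∀ x y → 0# ≈ x * 0# + 0# * y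
  imaginary-product = solve 2 (λ x y → con (+ 0) := x :* con (+ 0) :+ con (+ 0) :* y) refl

record RationalEmbedding (R : CommutativeRing 0ℓ 0ℓ) : Set₁ where
  open CommutativeRing R
  field
    embed           : ℚ → Carrier
    embed-0         : embed 0ℚ ≈ 0#
    embed-+         : ∀ p q → embed (p ℚ.+ q) ≈ embed p + embed q
    embed-*         : ∀ p q → embed (p ℚ.* q) ≈ embed p * embed q
    embed-injective : ∀ p → embed p ≈ 0# → p ≡ 0ℚ

module Extension (R : CommutativeRing 0ℓ 0ℓ) (E : RationalEmbedding R) where

  open RationalNumbers using (ℚ-ring)
  private
    module C where
      open CommutativeRing R public
      open RationalEmbedding E public
    module Cˢ = SeriesRing R
    module Qˢ = SeriesRing ℚ-ring
    module ℚD = DifferentialAlgebra ℚ-ring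
    module C× = RawMonoidDefs C.+-rawMonoid
    module Q× = RawMonoidDefs (CommutativeRing.+-rawMonoid ℚ-ring)
    module R⟦X⟧ = PowerSeries R

  open DifferentialAlgebra R
  open Cˢ using (_≋_; coefficientwise; at; seriesRing)
  private
    module CS = CommutativeRing seriesRing

  extend : ℚ⟦X⟧.Series → R⟦X⟧.Series
  extend f n = C.embed (f n)

  extend-cong : ∀ {f g} → f ℚ⟦X⟧.≈ˢ g → extend f ≋ extend g
  extend-cong e = coefficientwise λ n → C.reflexive (≡.cong C.embed (e n))

  extend-+ : ∀ f g → extend (f ℚ⟦X⟧.+ˢ g) ≋ extend f R⟦X⟧.+ˢ extend g
  extend-+ f g = coefficientwise λ n → C.embed-+ (f n) (g n)

  extend-* : ∀ f g → extend (f ℚ⟦X⟧.*ˢ g) ≋ extend f R⟦X⟧.*ˢ extend g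
  extend-* f g = coefficientwise (go f)
    where
    go : ∀ f n → C.embed ((f ℚ⟦X⟧.*ˢ g) n) C.≈ (extend f R⟦X⟧.*ˢ extend g) n
    go f zero    = C.trans (C.embed-+ (f 0 ℚ.* g 0) 0ℚ) (C.+-cong (C.embed-* (f 0) (g 0)) C.embed-0)
    go f (suc n) = C.trans (C.embed-+ (f 0 ℚ.* g (suc n)) ((Qˢ.shift f ℚ⟦X⟧.*ˢ g) n))
      (C.+-cong (C.embed-* (f 0) (g (suc n))) (go (Qˢ.shift f) n))

  extend-θ : ∀ f → extend (ℚ⟦X⟧.θ f) ≋ R⟦X⟧.θ (extend f)
  extend-θ f = coefficientwise λ n → multiple n (f n)
    where
    multiple : ∀ n p → C.embed (n Q×.× p) C.≈ n C×.× C.embed p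
    multiple zero    p = C.embed-0
    multiple (suc n) p = C.trans (C.embed-+ p (n Q×.× p)) (C.+-congˡ {C.embed p} (multiple n p))

  extend-constˢ : ∀ a → extend (ℚ⟦X⟧.constˢ a) ≋ R⟦X⟧.constˢ (C.embed a)
  extend-constˢ a = coefficientwise λ { zero → C.refl ; (suc n) → C.embed-0 }

  extend-0ˢ : extend ℚ⟦X⟧.0ˢ ≋ R⟦X⟧.0ˢ
  extend-0ˢ = coefficientwise λ { zero → C.embed-0 ; (suc n) → C.embed-0 }

  extend-⟨⟩ : ∀ {f g} → extend f ≋ g → ∀ k → extend (f ℚD.⟨ k ⟩) ≋ g ⟨ k ⟩
  extend-⟨⟩     e zero    = e
  extend-⟨⟩ {f} e (suc k) = CS.trans (extend-θ (f ℚD.⟨ k ⟩)) (coefficientwise (Cˢ.θ-cong (at (extend-⟨⟩ e k))))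

  extend-≉0 : ∀ {f} → ¬ f Qˢ.≋ ℚ⟦X⟧.0ˢ → ¬ extend f ≋ R⟦X⟧.0ˢ
  extend-≉0 f≉0 e = f≉0 (Qˢ.coefficientwise λ
    { zero → C.embed-injective _ (at e 0) ; (suc n) → C.embed-injective _ (at e (suc n)) })

  -- By contraposition, a nonzero value certifies that a polynomial has a nonzero coefficient.
  eval-IsZero : ∀ n P y → IsZero n P → eval n P y ≋ R⟦X⟧.0ˢ
  eval-IsZero zero    a        y a≈0      = coefficientwise λ { zero → a≈0 ; (suc n) → C.refl }
  eval-IsZero (suc n) []       y _        = CS.refl {R⟦X⟧.0ˢ}
  eval-IsZero (suc n) (p ∷ ps) y (e ∷ es) = CS.trans
    (CS.+-cong (eval-IsZero n p y e) (CS.trans (CS.*-congˡ {y n} (eval-IsZero (suc n) ps y es)) (CS.zeroʳ (y n))))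
    (CS.+-identityʳ R⟦X⟧.0ˢ)

module Transfer (em : ExcludedMiddle 0ℓ) (R : CommutativeRing 0ℓ 0ℓ) (E : RationalEmbedding R)
  (z : ℚ⟦X⟧.Series) (z′ : PowerSeries.Series R)
  (z≋z′ : SeriesRing._≋_ R (Extension.extend R E z) z′)
  where

  open Extension R E
  open RationalSeries em hiding (_⟨_⟩; _≋_; coefficientwise; at; seriesRing)
  open JetFields em quotients (jets-of z) using (jets; J; module Polynomials)
  open Subrings fractionField using (ev; value)
  open DifferentialAlgebra R
  open SeriesRing R using (_≋_; coefficientwise; at; seriesRing)
  private
    module Q = CommutativeRing fractionField
    module CS = CommutativeRing seriesRing
    module R⟦X⟧ = PowerSeries R
    module ℚD = DifferentialAlgebra RationalNumbers.ℚ-ring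
    ż = z′ ⟨_⟩

  -- A polynomial in the jets is a fraction only nominally: its value is an actual power series `u`.
  -- Exhibiting `u` allows comparison with an evaluation over R, where no fractions are formed.
  Represented : ℕ → Fraction → Set
  Represented n g = ∃[ P ] ∃[ u ] g Q.≈ ι u × eval n P ż ≋ extend u

  represent : ∀ n {g} → jets n g → Represented n g
  represent zero (a , e) = RationalEmbedding.embed E a , ℚ⟦X⟧.constˢ a , e , CS.sym (extend-constˢ a)
  represent (suc n) (value ps js e) =
    let P , u , e′ , e″ = go ps js in P , u , Q.trans e e′ , e″
    where
    go : ∀ ps → All (jets n) ps → Represented (suc n) (ev ps (ι (z ℚD.⟨ n ⟩)))
    go []       []       = [] , ℚ⟦X⟧.0ˢ , Q.refl {Q.0#} , CS.sym extend-0ˢ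
    go (p ∷ ps) (j ∷ js) =
      let P , u , p≈ , P≈    = represent n j
          Ps , us , ps≈ , Ps≈ = go ps js
      in P ∷ Ps , u ℚ⟦X⟧.+ˢ (z ℚD.⟨ n ⟩) ℚ⟦X⟧.*ˢ us
       , Q.trans (Q.+-cong p≈ (Q.*-congˡ {ι (z ℚD.⟨ n ⟩)} ps≈))
           (Q.sym (Q.trans (ι-+ u ((z ℚD.⟨ n ⟩) ℚ⟦X⟧.*ˢ us)) (Q.+-congˡ {ι u} (ι-* (z ℚD.⟨ n ⟩) us))))
       , CS.sym (CS.trans (extend-+ u ((z ℚD.⟨ n ⟩) ℚ⟦X⟧.*ˢ us)) (CS.+-cong (CS.sym P≈)
           (CS.trans (extend-* (z ℚD.⟨ n ⟩) us) (CS.*-cong (extend-⟨⟩ z≋z′ n) (CS.sym Ps≈)))))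

  module _ {n : ℕ} (r : RationalOverJets z n) where

    private
      frac : J n (ι (z ℚD.⟨ n ⟩))
      frac = RationalOverJets.top∈J r
      a = proj₁ frac
      b = proj₁ (proj₂ frac)
      zₙ = z ℚD.⟨ n ⟩
      ja = proj₁ (proj₂ (proj₂ frac))
      jb = proj₁ (proj₂ (proj₂ (proj₂ frac)))
      b≉0 = proj₁ (proj₂ (proj₂ (proj₂ (proj₂ frac))))
      zₙb≈a = proj₂ (proj₂ (proj₂ (proj₂ (proj₂ frac))))

      Rᵃ = represent n ja
      Rᵇ = represent n jb
      R⁻ᵃ = represent n (Polynomials.neg n ja)

      Pᵃ = proj₁ Rᵃ
      Pᵇ = proj₁ Rᵇ
      P⁻ᵃ = proj₁ R⁻ᵃ
      uᵃ = proj₁ (proj₂ Rᵃ)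
      uᵇ = proj₁ (proj₂ Rᵇ)
      u⁻ᵃ = proj₁ (proj₂ R⁻ᵃ)

      a≈ : a Q.≈ ι uᵃ
      a≈ = proj₁ (proj₂ (proj₂ Rᵃ))
      b≈ : b Q.≈ ι uᵇ
      b≈ = proj₁ (proj₂ (proj₂ Rᵇ))
      -a≈ : Q.- a Q.≈ ι u⁻ᵃ
      -a≈ = proj₁ (proj₂ (proj₂ R⁻ᵃ))

      Pᵃ≈ : eval n Pᵃ ż ≋ extend uᵃ
      Pᵃ≈ = proj₂ (proj₂ (proj₂ Rᵃ))
      Pᵇ≈ : eval n Pᵇ ż ≋ extend uᵇ
      Pᵇ≈ = proj₂ (proj₂ (proj₂ Rᵇ))
      P⁻ᵃ≈ : eval n P⁻ᵃ ż ≋ extend u⁻ᵃ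
      P⁻ᵃ≈ = proj₂ (proj₂ (proj₂ R⁻ᵃ))

      ι-product : ι (zₙ ℚ⟦X⟧.*ˢ uᵇ) Q.≈ a
      ι-product = Q.trans (ι-* zₙ uᵇ) (Q.trans (Q.*-congˡ {ι zₙ} (Q.sym b≈)) zₙb≈a)

      product : extend zₙ R⟦X⟧.*ˢ extend uᵇ ≋ extend (zₙ ℚ⟦X⟧.*ˢ uᵇ)
      product = CS.sym (extend-* zₙ uᵇ)

      denominator≉0 : ¬ eval n Pᵇ ż ≋ R⟦X⟧.0ˢ
      denominator≉0 e = extend-≉0 (λ uᵇ≋0 → b≉0 (Q.trans b≈ (ι-cong uᵇ≋0))) (CS.trans (CS.sym Pᵇ≈) e)

    -- g is a variable because Agda compares two instances of z′ ⟨ n ⟩ over a concrete ring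
    -- by unfolding its multiplication.

    inJetField : ∀ g → z′ ⟨ n ⟩ ≋ g → DifferentialAlgebra.InJetField R n z′ g
    inJetField g e = Pᵃ , Pᵇ , (λ e → denominator≉0 (coefficientwise e)) , at
      (CS.trans (CS.*-cong (CS.sym e) Pᵇ≈) (CS.trans (CS.*-congʳ {extend uᵇ} (CS.sym (extend-⟨⟩ z≋z′ n)))
        (CS.trans product (CS.trans (extend-cong (SeriesRing.at (ι-injective (Q.trans ι-product a≈)))) (CS.sym Pᵃ≈)))))

    -- Clearing the denominator of z⁽ⁿ⁾ = a / b gives the polynomial - a + b Yₙ. It involves Yₙ
    -- because the value of b is nonzero.
    satisfiesADE : DifferentialAlgebra.SatisfiesADE R n z′
    satisfiesADE = P⁻ᵃ ∷ Pᵇ ∷ [] , (λ { (Pᵇ-zero ∷ []) → denominator≉0 (eval-IsZero n Pᵇ ż Pᵇ-zero) }) , at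
      (CS.trans (CS.+-cong P⁻ᵃ≈ (CS.trans (CS.*-cong (CS.sym (extend-⟨⟩ z≋z′ n)) linear) product))
        (CS.trans (CS.sym (extend-+ u⁻ᵃ (zₙ ℚ⟦X⟧.*ˢ uᵇ))) (CS.trans (extend-cong (SeriesRing.at sum≈0)) extend-0ˢ)))
      where
      linear : eval n Pᵇ ż R⟦X⟧.+ˢ ż n R⟦X⟧.*ˢ R⟦X⟧.0ˢ ≋ extend uᵇ
      linear = CS.trans (CS.+-congˡ {eval n Pᵇ ż} (CS.zeroʳ (ż n)))
        (CS.trans (CS.+-identityʳ (eval n Pᵇ ż)) Pᵇ≈)
      sum≈0 = ι-injective (Q.trans (ι-+ u⁻ᵃ (zₙ ℚ⟦X⟧.*ˢ uᵇ))
        (Q.trans (Q.+-cong (Q.sym -a≈) ι-product) (Q.-‿inverseˡ a)))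

module ComplexNumbers where

  private
    module C = CommutativeRing ℂ-commutativeRing
    open GaussianEmbedding RationalNumbers.ℚ-ring

  constant : ∀ {p q} → p ≡ q → (λ (_ : ℕ) → p) ∼ (λ (_ : ℕ) → q)
  constant {p} ≡.refl = ℝ.cauchy (fromℚ p)

  fromℚᶜ-+ : ∀ p q → fromℚᶜ (p ℚ.+ q) C.≈ fromℚᶜ p C.+ fromℚᶜ q
  fromℚᶜ-+ p q = same-limit (constant ≡.refl) , same-limit (constant ≡.refl)

  fromℚᶜ-* : ∀ p q → fromℚᶜ (p ℚ.* q) C.≈ fromℚᶜ p C.* fromℚᶜ q
  fromℚᶜ-* p q = same-limit (constant (real-product p q)) , same-limit (constant (imaginary-product p q))

  -- For nonzero p the tolerance ∣p∣ is positive, and closeness to 0 within it would say ∣p∣ < ∣p∣.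
  fromℚᶜ-injective : ∀ p → fromℚᶜ p C.≈ C.0# → p ≡ 0ℚ
  fromℚᶜ-injective p (same-limit (within close) , _) = go (p ℚₚ.≟ 0ℚ)
    where
    go : Dec (p ≡ 0ℚ) → p ≡ 0ℚ
    go (yes e) = e
    go (no p≢0) =
      let N , h = close ℚ.∣ p ∣ (ℚₚ.≰⇒> λ ∣p∣≤0 → p≢0 (ℚₚ.∣p∣≡0⇒p≡0 p (ℚₚ.≤-antisym ∣p∣≤0 (ℚₚ.0≤∣p∣ p))))
      in ⊥-elim (ℚₚ.<-irrefl (≡.cong ℚ.∣_∣ (ℚₚ.+-identityʳ p)) (h N N ℕₚ.≤-refl ℕₚ.≤-refl))

  complexNumbers : RationalEmbedding ℂ-commutativeRing
  complexNumbers = record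
    { embed           = fromℚᶜ
    ; embed-0         = C.refl {C.0#}
    ; embed-+         = fromℚᶜ-+
    ; embed-*         = fromℚᶜ-*
    ; embed-injective = fromℚᶜ-injective
    }

open ComplexNumbers using (complexNumbers)
open ℂ-DifferentialAlgebra using (SatisfiesADE; InJetField; _⟨_⟩)

module ComplexTransfer (em : ExcludedMiddle 0ℓ) (z : ℚ⟦X⟧.Series) (n : ℕ)
  (r : RationalSeries.RationalOverJets em z n) where

  open SeriesRing ℂ-commutativeRing using (_≋_; coefficientwise)
  private
    module C = CommutativeRing ℂ-commutativeRing

  extend≋toℂ : Extension.extend ℂ-commutativeRing complexNumbers z ≋ toℂ⟦X⟧ z
  extend≋toℂ = coefficientwise λ m → C.refl {fromℚᶜ (z m)}

  ℂ-satisfiesADE : SatisfiesADE n (toℂ⟦X⟧ z)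
  ℂ-satisfiesADE = Transfer.satisfiesADE em ℂ-commutativeRing complexNumbers z (toℂ⟦X⟧ z) extend≋toℂ {n} r

  -- Matching on g ≡ f ⟨ n ⟩ instead of substituting for g avoids unfolding complex
  -- multiplication.

  ℂ-inJetField : InJetField n (toℂ⟦X⟧ z) (toℂ⟦X⟧ z ⟨ n ⟩)
  ℂ-inJetField = along (toℂ⟦X⟧ z ⟨ n ⟩) ≡.refl
    where
    transport : ∀ {f g} → InJetField n f g → g ≡ f ⟨ n ⟩ → InJetField n f (f ⟨ n ⟩)
    transport p ≡.refl = p
    along : ∀ g → g ≡ toℂ⟦X⟧ z ⟨ n ⟩ → InJetField n (toℂ⟦X⟧ z) (toℂ⟦X⟧ z ⟨ n ⟩)
    along g e = transport {toℂ⟦X⟧ z} {g}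
      (Transfer.inJetField em ℂ-commutativeRing complexNumbers z (toℂ⟦X⟧ z) extend≋toℂ {n} r g
        (coefficientwise λ m → C.reflexive (≡.cong (λ h → h m) (≡.sym e)))) e

proposition1 : ExcludedMiddle 0ℓ → (s : ℕ) → 3 ℕ.≤ s →
               (z : ℚ⟦X⟧.Series) → IsMirrorMap s z →
               SatisfiesADE (2 ℕ.* s ℕ.∸ 3) (toℂ⟦X⟧ z) ×
               InJetField (2 ℕ.* s ℕ.∸ 3) (toℂ⟦X⟧ z) (toℂ⟦X⟧ z ⟨ 2 ℕ.* s ℕ.∸ 3 ⟩)
proposition1 em s 3≤s z mirror = ℂ-satisfiesADE , ℂ-inJetField
  where open ComplexTransfer em z (2 ℕ.* s ℕ.∸ 3) (RationalSeries.mirrorMap-rational em s 3≤s z mirror)
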